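{- Let $\mu,\nu,\lambda$ be partitions and let $n=\max\{\ell(\mu),\ell(\nu),\ell(\lambda)\}$. Then the degree of the quasi-polynomial $n_{t\mu,t\nu}^{t\lambda}$ in $t$ satisfies $$\deg n_{t\mu,t\nu}^{t\lambda}\leq \frac{3n(n-1)}{2}.$$ That is, if $P_e,P_o$ are polynomials such that for all integers $t\geq1$ one has $n_{t\mu,t\nu}^{t\lambda}=P_e(t)$ for $t$ even and $n_{t\mu,t\nu}^{t\lambda}=P_o(t)$ for $t$ odd, then $P_e$ and $P_o$ both have degree at most $3n(n-1)/2$.
   Context: For partitions $\mu,\nu,\lambda$, let $c_{\mu,\nu}^{\lambda}$ be the Littlewood--Richardson coefficient, i.e. the coefficient of the Schur function $s_\lambda$ in $s_\mu s_\nu$. The Newell--Littlewood coefficient is $$n_{\mu,\nu}^{\lambda}=\sum_{\alpha,\beta,\gamma} c_{\alpha,\beta}^{\mu}\,c_{\alpha,\gamma}^{\nu}\,c_{\beta,\gamma}^{\lambda},$$ the sum being over all partitions $\alpha,\beta,\gamma$. $\ell(\kappa)$ is the number of nonzero parts of a partition $\kappa$ and $t\kappa=(t\kappa_1,t\kappa_2,\ldots)$. It is known that, as a function of $t$, $n_{t\mu,t\nu}^{t\lambda}$ is a quasi-polynomial of quasi-period at most $2$, i.e. polynomials $P_e,P_o$ as in the claim exist; its degree is the maximum of the degrees of $P_e$ and $P_o$. The zero polynomial is regarded as having degree $-\infty$. -}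

module Defs where

open import Data.Fin.Base as Fin using (Fin)
open import Data.Fin.Properties as Fin using ()
open import Data.Integer.Base using (ℤ; +_; 0ℤ) renaming (_+_ to _+ℤ_; _*_ to _*ℤ_)
open import Data.List.Base using (List; []; _∷_; allFin; cartesianProductWith; concat; concatMap; filter; foldr; length; map; mapMaybe; upTo)
open import Data.List.Relation.Binary.Prefix.Heterogeneous using (Prefix)
open import Data.List.Relation.Binary.Prefix.Heterogeneous.Properties using (prefix?)
open import Data.List.Relation.Unary.All as All using (All)
open import Data.List.Relation.Unary.All.Properties as All using ()
open import Data.List.Relation.Unary.Linked as Linked using (Linked)
open import Data.List.Relation.Unary.Linked.Properties as Linked using ()
open import Data.Maybe.Base as Maybe using ()
open import Data.Nat.Base using (ℕ; zero; suc; _+_; _*_; _∸_; _≥_; _<_; NonZero)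
open import Data.Nat.Properties using (_≟_; _≥?_; nonZero?; *-monoʳ-≤; m*n≢0)
open import Data.Product.Base using (_×_; _,_)
open import Data.Rational.Base as ℚ using (ℚ; 0ℚ)
open import Data.Vec.Base as Vec using (Vec; []; _∷_)
open import Data.Vec.Properties as Vec using ()
open import Relation.Binary.PropositionalEquality using (_≡_)
open import Relation.Nullary.Decidable using (_×-dec_; dec⇒maybe)
open import Relation.Unary using (Decidable)

∑ : {A : Set} → List A → (A → ℤ) → ℤ
∑ xs f = foldr (λ x s → f x +ℤ s) 0ℤ xs

infixr 6 ∑
syntax ∑ xs (λ x → e) = ∑[ x ∈ xs ] e

-- The trailing zeros of a partition are not stored.

IsPartition : List ℕ → Set
IsPartition xs = Linked _≥_ xs × All NonZero xs

record Partition : Set where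
  constructor mkPartition
  field
    parts       : List ℕ
    isPartition : IsPartition parts

open Partition public

∣_∣ : Partition → ℕ
∣ κ ∣ = foldr _+_ 0 (parts κ)

ℓ : Partition → ℕ
ℓ κ = length (parts κ)

infixr 8 _·_

_·_ : (t : ℕ) .{{_ : NonZero t}} → Partition → Partition
_·_ t {{t≢0}} (mkPartition xs (dec , pos)) = mkPartition (map (t *_) xs)
  ( Linked.map⁺ (Linked.map (*-monoʳ-≤ t) dec)
  , All.map⁺ (All.map (λ {x} x≢0 → m*n≢0 t x {{t≢0}} {{x≢0}}) pos) )

isPartition? : Decidable IsPartition
isPartition? xs = Linked.linked? _≥?_ xs ×-dec All.all? nonZero? xs

-- All sequences of positive integers with sum d, each listed once: a
-- composition of suc d either has first entry 1 or arises from a composition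
-- of d by increasing the first entry.
compositions : ℕ → List (List ℕ)
compositions zero    = [] ∷ []
compositions (suc d) = concatMap extend (compositions d)
  where
  extend : List ℕ → List (List ℕ)
  extend []       = (1 ∷ []) ∷ []
  extend (x ∷ xs) = (1 ∷ x ∷ xs) ∷ (suc x ∷ xs) ∷ []

partitionsOf : ℕ → List Partition
partitionsOf d = mapMaybe (λ xs → Maybe.map (mkPartition xs) (dec⇒maybe (isPartition? xs))) (compositions d)

partitionsUpTo : ℕ → List Partition
partitionsUpTo d = concatMap partitionsOf (upTo (suc d))

-- A tableau is the list of its rows, from the top row down (English notation).

Tableau : ℕ → Set
Tableau N = List (List (Fin N))

module _ {N : ℕ} where

  -- Each entry of the lower row has an entry of the upper row above it, and
  -- that entry is smaller.
  ColumnStrict : (upper lower : List (Fin N)) → Set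
  ColumnStrict upper lower = Prefix Fin._>_ lower upper

  Semistandard : Tableau N → Set
  Semistandard T = All (Linked Fin._≤_) T × Linked ColumnStrict T

  semistandard? : Decidable Semistandard
  semistandard? T =
    All.all? (Linked.linked? Fin._≤?_) T
      ×-dec Linked.linked? (λ upper lower → prefix? (λ a b → b Fin.<? a) lower upper) T

  content : Tableau N → Vec ℕ N
  content T = Vec.tabulate (λ i → length (filter (i Fin.≟_) (concat T)))

words : (N k : ℕ) → List (List (Fin N))
words N zero    = [] ∷ []
words N (suc k) = cartesianProductWith _∷_ (allFin N) (words N k)

-- All fillings, with entries in Fin N, of the diagram with the given row lengths.
fillings : (N : ℕ) → List ℕ → List (Tableau N)
fillings N []       = [] ∷ []
fillings N (k ∷ ks) = cartesianProductWith _∷_ (words N k) (fillings N ks)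

-- A formal power series in x₁, x₂, … with integer coefficients, given by its
-- coefficients: f w, for w : Vec ℕ N, is the coefficient of x₁^w₁ ⋯ x_N^w_N.
-- The monomial w is the same as w extended by zeros, so a power series gives
-- these the same coefficient; the series used below do.
Series : Set
Series = ∀ {N} → Vec ℕ N → ℤ

-- The Schur function as the generating function of the semistandard tableaux
-- of shape κ.  A tableau of weight x₁^w₁ ⋯ x_N^w_N has all its entries among
-- the first N letters.
schur : Partition → Series
schur κ {N} w = + length (filter (λ T → semistandard? T ×-dec Vec.≡-dec _≟_ (content T) w) (fillings N (parts κ)))

-- All pairs (u , v) with u + v = w.
splittings : ∀ {N} → Vec ℕ N → List (Vec ℕ N × Vec ℕ N)
splittings []      = ([] , []) ∷ []
splittings (k ∷ w) = cartesianProductWith (λ i (u , v) → (i ∷ u , k ∸ i ∷ v)) (upTo (suc k)) (splittings w)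

infixl 7 _⊛_

_⊛_ : Series → Series → Series
(f ⊛ g) w = ∑ (splittings w) λ (u , v) → f u *ℤ g v

-- f = Σ_κ a κ · s_κ, the sum being over all partitions.  As s_κ is homogeneous
-- of degree |κ|, only the partitions of the degree of a monomial contribute to
-- its coefficient.  The Schur functions being linearly independent, a is
-- determined by f: a κ is the coefficient of s_κ in f.
IsSchurExpansion : Series → (Partition → ℤ) → Set
IsSchurExpansion f a =
  ∀ {N} (w : Vec ℕ N) → f w ≡ ∑[ κ ∈ partitionsOf (Vec.sum w) ] a κ *ℤ schur κ w

-- c μ ν κ is the Littlewood–Richardson coefficient of s_κ in s_μ s_ν.
IsLittlewoodRichardson : (Partition → Partition → Partition → ℤ) → Set
IsLittlewoodRichardson c = ∀ μ ν → IsSchurExpansion (schur μ ⊛ schur ν) (c μ ν)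

-- As c μ ν κ vanishes unless |μ| + |ν| = |κ|, the terms of the sum over all
-- partitions α, β, γ that are left out here are zero.
newellLittlewood : (Partition → Partition → Partition → ℤ) → Partition → Partition → Partition → ℤ
newellLittlewood c μ ν κ =
  ∑[ α ∈ partitionsUpTo ∣ μ ∣ ] ∑[ β ∈ partitionsUpTo ∣ μ ∣ ] ∑[ γ ∈ partitionsUpTo ∣ ν ∣ ]
    c α β μ *ℤ c α γ ν *ℤ c β γ κ

-- Polynomials over ℚ as lists of coefficients, the constant term first.
-- Trailing zeros are allowed.

Polynomial : Set
Polynomial = List ℚ

eval : Polynomial → ℚ → ℚ
eval p x = foldr (λ a s → a ℚ.+ x ℚ.* s) 0ℚ p

coefficient : Polynomial → ℕ → ℚ
coefficient []      _       = 0ℚ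
coefficient (a ∷ p) zero    = a
coefficient (a ∷ p) (suc k) = coefficient p k

-- Holds for every d if p is zero, in line with deg 0 = -∞.
DegreeAtMost : Polynomial → ℕ → Set
DegreeAtMost p d = ∀ k → d < k → coefficient p k ≡ 0ℚ

{-# OPTIONS --safe #-}
module Submission where

-- Let V be the Vandermonde product in n variables.  Then V s_κ is the alternant
-- with exponents κ + ρ, so that c_{μν}^κ, for ℓ(κ) ≤ n, is the coefficient of
-- x^{κ+ρ} in V s_μ s_ν.  As V s_μ is the sum of the n! terms ± x^{w(μ+ρ)}, this is
-- a signed sum of n! Kostka numbers of ν.  A Kostka number counts
-- Gelfand–Tsetlin patterns with prescribed row sums, which leaves
-- n(n−1)/2 − (n−1) free entries, so that c is O(t^{(n−1)(n−2)/2}).  In the sum for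
-- the Newell–Littlewood coefficient the sizes of α, β and γ are determined and
-- their lengths are at most n, whence O(t^{3(n−1)}) terms contribute, and
-- 3(n−1) + 3(n−1)(n−2)/2 = 3n(n−1)/2.  A polynomial with this growth along the
-- even or the odd numbers has at most this degree.

open import Defs

open import Algebra.Bundles using (CommutativeRing)
import Algebra.Construct.Pointwise as Pointwise
open import Data.Fin.Base as Fin using (Fin; zero; suc; toℕ; inject₁; fromℕ)
import Data.Fin.Properties as Fin
open import Data.Fin.Relation.Unary.Top using (view; ‵fromℕ; ‵inj₁; view-fromℕ; view-inject₁)
open import Data.Integer.Base as ℤ using (ℤ; +_; 0ℤ)
import Data.Integer.Properties as ℤ
import Data.Integer.Tactic.RingSolver as ℤ-Solver
open import Data.List.Base as List using (List; []; _∷_; _++_; length; map; mapMaybe; concat; concatMap; filter; replicate; upTo; cartesianProductWith)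
import Data.List.Membership.Propositional as Membership
open import Data.List.Membership.Propositional using (_∈_; lose)
open import Data.List.Membership.Propositional.Properties
  using (∈-∃++; ∈-++⁻; ∈-++⁺ˡ; ∈-++⁺ʳ; ∈-map⁻; ∈-map⁺; ∈-concatMap⁻; ∈-concatMap⁺; ∈-filter⁻; ∈-filter⁺; ∈-cartesianProductWith⁻; ∈-cartesianProductWith⁺; ∈-allFin; ∈-upTo⁺; ∈-upTo⁻)
import Data.List.Properties as List
open import Data.List.Relation.Binary.Prefix.Heterogeneous using ([]; _∷_)
open import Data.List.Relation.Unary.All as All using (All; []; _∷_)
import Data.List.Relation.Unary.All.Properties as All
open import Data.List.Relation.Unary.AllPairs using ([]; _∷_)
open import Data.List.Relation.Unary.Any using (here; there)
open import Data.List.Relation.Unary.Linked as Linked using (Linked; []; [-]; _∷_)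
open import Data.List.Relation.Unary.Unique.Propositional using (Unique)
import Data.List.Relation.Unary.Unique.Propositional.Properties as Unique
open import Data.Maybe.Base as Maybe using (Maybe; just; nothing)
open import Data.Nat.Base as ℕ using (ℕ; zero; suc; z≤n; s≤s; NonZero; _!)
open import Data.Nat.DivMod using (_/_; m*n/n≡m; m/n≤m)
open import Data.Nat.Divisibility using (_∣_; _∤_; divides; ∣m+n∣m⇒∣n; ∣1⇒≡1)
import Data.Nat.Properties as ℕ
open import Data.Nat.Tactic.RingSolver using (solve-∀)
open import Data.Product.Base using (∃; _×_; _,_; proj₁; proj₂)
import Data.Rational.Base as ℚ
open import Data.Rational.Base using (ℚ; 0ℚ; 1ℚ; mkℚ)
import Data.Rational.Properties as ℚ
open import Data.Rational.Unnormalised.Base as ℚᵘ using (mkℚᵘ; *≡*; *≤*)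
import Data.Rational.Unnormalised.Properties as ℚᵘ
open import Data.Sum.Base using (_⊎_; inj₁; inj₂)
open import Data.Vec.Base as Vec using (Vec; []; _∷_; _∷ʳ_)
import Data.Vec.Membership.Propositional as Vec∈
import Data.Vec.Properties as Vec
open import Data.Vec.Relation.Unary.All as VecAll using ([]; _∷_)
open import Data.Vec.Relation.Unary.AllPairs as VecAllPairs using ([]; _∷_)
open import Data.Vec.Relation.Unary.Any using (here; there)
open import Data.Vec.Relation.Unary.Linked as VecLinked using ([]; [-]; _∷_)
open import Function.Base using (_∘_; id)
open import Level using (0ℓ)
open import Relation.Binary.Definitions using (tri<; tri≈; tri>)
open import Relation.Binary.PropositionalEquality as ≡ using (_≡_; _≢_)
open import Relation.Nullary.Decidable using (Dec; yes; no; _×-dec_; dec⇒maybe)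
open import Relation.Nullary.Negation using (¬_; contradiction)

-- Interlacing vectors and alternants

-- `schur` counts tableaux, so that V s_κ is an alternant has to be proved from tableaux. The bridge
-- is the branching rule: without its copies of the last letter, a tableau of shape κ has a shape λ
-- interlacing κ. Everything therefore recurses on the number of variables: alternants are iterated
-- Laplace expansions instead of sums over permutations, and power series in n variables are
-- iterated series in one.
--
-- In the inductive step the new variable y contributes ∏ (y - xᵢ) to V, and ∏ (y - xᵢ) times the
-- alternant of m is the sum of (-1)^|s| yⁿ⁻^|s| times the alternant of m + s over 0/1-vectors s.
-- Together with the factor y^(|κ|-|λ|) of the branching rule, the power of y depends only on the
-- size of m + s, m = λ + ρ. Hence the sum over λ telescopes in every coordinate, and the boundary
-- terms without a repeated exponent are the Laplace expansion of the alternant of κ + ρ.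
--
-- Coefficients at κ + ρ can be read off because the exponents are strictly decreasing, so each
-- alternant has its own leading monomial. The bound ignores all cancellation in the signed sum, as
-- the number n! of its terms does not depend on t.

range : ℕ → ℕ → List ℕ
range y zero    = []
range y (suc k) = y ∷ range (suc y) k

interlacings : ∀ {n} → Vec ℕ (suc n) → List (Vec ℕ n)
interlacings (x ∷ [])    = [] ∷ []
interlacings (x ∷ y ∷ κ) = cartesianProductWith _∷_ (range y (suc x ℕ.∸ y)) (interlacings (y ∷ κ))

Decreasing : ∀ {n} → Vec ℕ n → Set
Decreasing = VecLinked.Linked ℕ._≥_

-- ρ is the staircase (n - 1, ..., 1, 0); its entry at the head is the length of the tail.
addρ : ∀ {n} → Vec ℕ n → Vec ℕ n
addρ []              = []
addρ (_∷_ {n} x κ) = (x ℕ.+ n) ∷ addρ κ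

data Interlaces : ∀ {n} → Vec ℕ (suc n) → Vec ℕ n → Set where
  last : ∀ {x} → Interlaces (x ∷ []) []
  cons : ∀ {n x y i} {κ : Vec ℕ n} {λ′} → y ℕ.≤ i → i ℕ.≤ x → Interlaces (y ∷ κ) λ′ → Interlaces (x ∷ y ∷ κ) (i ∷ λ′)

∈-range⁻ : ∀ {i} y k → i ∈ range y k → y ℕ.≤ i × i ℕ.< y ℕ.+ k
∈-range⁻ y (suc k) (here ≡.refl) = ℕ.≤-refl , ℕ.m<m+n y ℕ.z<s
∈-range⁻ {i} y (suc k) (there i∈)    =
  let y<i , i< = ∈-range⁻ (suc y) k i∈
  in ℕ.<⇒≤ y<i , ≡.subst (i ℕ.<_) (≡.sym (ℕ.+-suc y k)) i<

∈-range⁺ : ∀ {i} y k → y ℕ.≤ i → i ℕ.< y ℕ.+ k → i ∈ range y k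
∈-range⁺ y zero y≤i i<y = contradiction (ℕ.≤-<-trans y≤i i<y) (ℕ.<-irrefl (≡.sym (ℕ.+-identityʳ y)))
∈-range⁺ {i} y (suc k) y≤i i< with ℕ.m≤n⇒m<n∨m≡n y≤i
... | inj₁ y<i    = there (∈-range⁺ (suc y) k y<i (≡.subst (i ℕ.<_) (ℕ.+-suc y k) i<))
... | inj₂ ≡.refl = here ≡.refl

∈-interlacings⁻ : ∀ {n} {κ : Vec ℕ (suc n)} {λ′} → Decreasing κ → λ′ ∈ interlacings κ → Interlaces κ λ′
∈-interlacings⁻ {κ = x ∷ []}    _ (here ≡.refl) = last
∈-interlacings⁻ {κ = x ∷ y ∷ κ} (y≤x ∷ κ↓) λ∈
  with i , λ″ , i∈ , λ″∈ , ≡.refl ← ∈-cartesianProductWith⁻ _∷_ (range y (suc x ℕ.∸ y)) (interlacings (y ∷ κ)) λ∈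
  with y≤i , i< ← ∈-range⁻ y _ i∈
  = cons y≤i (ℕ.s≤s⁻¹ (≡.subst (i ℕ.<_) (ℕ.m+[n∸m]≡n (ℕ.m≤n⇒m≤1+n y≤x)) i<)) (∈-interlacings⁻ κ↓ λ″∈)

∈-interlacings⁺ : ∀ {n} {κ : Vec ℕ (suc n)} {λ′} → Interlaces κ λ′ → λ′ ∈ interlacings κ
∈-interlacings⁺ last = here ≡.refl
∈-interlacings⁺ (cons {x = x} {y} {i} y≤i i≤x rest) = ∈-cartesianProductWith⁺ _∷_
  (∈-range⁺ y _ y≤i (≡.subst (i ℕ.<_) (≡.sym (ℕ.m+[n∸m]≡n (ℕ.m≤n⇒m≤1+n (ℕ.≤-trans y≤i i≤x)))) (s≤s i≤x)))
  (∈-interlacings⁺ rest)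

interlaces-decreasing : ∀ {n} {κ : Vec ℕ (suc n)} {λ′} → Interlaces κ λ′ → Decreasing λ′
interlaces-decreasing last = []
interlaces-decreasing (cons _ _ last) = [-]
interlaces-decreasing (cons y≤i _ rest@(cons _ j≤y _)) = ℕ.≤-trans j≤y y≤i ∷ interlaces-decreasing rest

interlaces-sum : ∀ {n} {κ : Vec ℕ (suc n)} {λ′} → Interlaces κ λ′ → Vec.sum λ′ ℕ.≤ Vec.sum κ
interlaces-sum last              = z≤n
interlaces-sum (cons _ i≤x rest) = ℕ.+-mono-≤ i≤x (interlaces-sum rest)

-- Only adjacent equal entries count. No other repeats have to be handled in `neighbourSum`, whose
-- consecutive choices come from overlapping pairs of neighbours.
data HasRepeat : ∀ {n} → Vec ℕ n → Set where
  here  : ∀ {n x} {l : Vec ℕ n} → HasRepeat (x ∷ x ∷ l)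
  there : ∀ {n x} {l : Vec ℕ n} → HasRepeat l → HasRepeat (x ∷ l)

-- The pairs `e`, `r` that occur as terms of the Laplace expansion along `l`, so that facts such as
-- `remove-sum` can be used term by term.
data Remove : ∀ {n} → Vec ℕ (suc n) → ℕ → Vec ℕ n → Set where
  here  : ∀ {n x} {l : Vec ℕ n} → Remove (x ∷ l) x l
  there : ∀ {n x e} {l : Vec ℕ (suc n)} {r} → Remove l e r → Remove (x ∷ l) e (x ∷ r)

remove-sum : ∀ {n e} {l : Vec ℕ (suc n)} {r} → Remove l e r → e ℕ.+ Vec.sum r ≡ Vec.sum l
remove-sum here = ≡.refl
remove-sum {e = e} (there {x = x} {r = r} rem) = ≡.trans (lemma e x (Vec.sum r)) (≡.cong (x ℕ.+_) (remove-sum rem))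
  where
  lemma : ∀ a b c → a ℕ.+ (b ℕ.+ c) ≡ b ℕ.+ (a ℕ.+ c)
  lemma = solve-∀

triangle : ℕ → ℕ
triangle zero    = 0
triangle (suc n) = n ℕ.+ triangle n

sum-addρ : ∀ {n} (κ : Vec ℕ n) → Vec.sum (addρ κ) ≡ Vec.sum κ ℕ.+ triangle n
sum-addρ []                        = ≡.refl
sum-addρ (_∷_ {n} x κ) rewrite sum-addρ κ = lemma x n (Vec.sum κ) (triangle n)
  where
  lemma : ∀ x n s t → x ℕ.+ n ℕ.+ (s ℕ.+ t) ≡ x ℕ.+ s ℕ.+ (n ℕ.+ t)
  lemma = solve-∀

module Alternants (R : CommutativeRing 0ℓ 0ℓ) where

  open CommutativeRing R hiding (_-_)
  open import Algebra.Properties.Ring ring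
  open import Algebra.Properties.Semiring.Exp semiring using (_^_; ^-homo-*; ^-congʳ)
  open import Relation.Binary.Reasoning.Setoid setoid

  open import Algebra.Solver.Ring.NaturalCoefficients.Default commutativeSemiring using (solve; _:+_; _:*_; _:=_)

  -- Differences are linear combinations with natural coefficients and an
  -- additional variable −1, which brings the identities below within reach of
  -- the semiring solver.
  infixl 6 _-_

  _-_ : Carrier → Carrier → Carrier
  x - y = x + - 1# * y

  x-x≈0 : ∀ x → x - x ≈ 0#
  x-x≈0 x = trans (+-congˡ (-1*x≈-x x)) (-‿inverseʳ x)

  x-0≈x : ∀ x → x - 0# ≈ x
  x-0≈x x = trans (+-congˡ (zeroʳ _)) (+-identityʳ x)

  Σ[_] : {A : Set} → List A → (A → Carrier) → Carrier
  Σ[ xs ] f = List.foldr (λ x s → f x + s) 0# xs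

  Σ-cong-∈ : {A : Set} (xs : List A) {f g : A → Carrier} → (∀ {x} → x ∈ xs → f x ≈ g x) → Σ[ xs ] f ≈ Σ[ xs ] g
  Σ-cong-∈ []       f≈g = refl
  Σ-cong-∈ (x ∷ xs) f≈g = +-cong (f≈g (here ≡.refl)) (Σ-cong-∈ xs (f≈g ∘ there))

  Σ-cong : {A : Set} (xs : List A) {f g : A → Carrier} → (∀ x → f x ≈ g x) → Σ[ xs ] f ≈ Σ[ xs ] g
  Σ-cong xs f≈g = Σ-cong-∈ xs (λ {x} _ → f≈g x)

  *-distribˡ-Σ : {A : Set} (xs : List A) (f : A → Carrier) (c : Carrier) → c * Σ[ xs ] f ≈ Σ[ xs ] (λ x → c * f x)
  *-distribˡ-Σ []       f c = zeroʳ c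
  *-distribˡ-Σ (x ∷ xs) f c = trans (distribˡ c _ _) (+-congˡ (*-distribˡ-Σ xs f c))

  -cong : ∀ {a b c d} → a ≈ b → c ≈ d → a - c ≈ b - d
  -cong a≈b c≈d = +-cong a≈b (*-congˡ c≈d)

  Σ-sub : {A : Set} (xs : List A) (f g : A → Carrier) → Σ[ xs ] (λ x → f x - g x) ≈ Σ[ xs ] f - Σ[ xs ] g
  Σ-sub []       f g = sym (x-x≈0 0#)
  Σ-sub (x ∷ xs) f g = trans (+-congˡ (Σ-sub xs f g))
    (solve 5 (λ u a b c d → (a :+ (u :* b)) :+ (c :+ (u :* d)) := (a :+ c) :+ (u :* (b :+ d))) refl _ _ _ _ _)

  Σ-++ : {A : Set} (xs ys : List A) (f : A → Carrier) → Σ[ xs List.++ ys ] f ≈ Σ[ xs ] f + Σ[ ys ] f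
  Σ-++ []       ys f = sym (+-identityˡ _)
  Σ-++ (x ∷ xs) ys f = trans (+-congˡ (Σ-++ xs ys f)) (sym (+-assoc _ _ _))

  Σ-map : {A B : Set} (h : A → B) (xs : List A) (f : B → Carrier) → Σ[ List.map h xs ] f ≈ Σ[ xs ] (f ∘ h)
  Σ-map h []       f = refl
  Σ-map h (x ∷ xs) f = +-congˡ (Σ-map h xs f)

  Σ-cartesianProductWith : {A B C : Set} (h : A → B → C) (xs : List A) (ys : List B) (f : C → Carrier) →
    Σ[ cartesianProductWith h xs ys ] f ≈ Σ[ xs ] (λ x → Σ[ ys ] (λ y → f (h x y)))
  Σ-cartesianProductWith h []       ys f = refl
  Σ-cartesianProductWith h (x ∷ xs) ys f =
    trans (Σ-++ (List.map (h x) ys) _ f) (+-cong (Σ-map (h x) ys f) (Σ-cartesianProductWith h xs ys f))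

  Σ-telescope : (f : ℕ → Carrier) → ∀ y k → Σ[ range y k ] (λ i → f i - f (suc i)) ≈ f y - f (y ℕ.+ k)
  Σ-telescope f y zero rewrite ℕ.+-identityʳ y = sym (x-x≈0 _)
  Σ-telescope f y (suc k) rewrite ℕ.+-suc y k = begin
    f y - f (suc y) + Σ[ range (suc y) k ] (λ i → f i - f (suc i)) ≈⟨ +-congˡ (Σ-telescope f (suc y) k) ⟩
    f y - f (suc y) + (f (suc y) - f (suc y ℕ.+ k))
      ≈⟨ solve 4 (λ u a b c → (a :+ u :* b) :+ (b :+ u :* c) := (a :+ u :* c) :+ (b :+ u :* b)) refl _ _ _ _ ⟩
    f y - f (suc y ℕ.+ k) + (f (suc y) - f (suc y))                ≈⟨ +-congˡ (x-x≈0 _) ⟩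
    f y - f (suc y ℕ.+ k) + 0#                                     ≈⟨ +-identityʳ _ ⟩
    f y - f (suc y ℕ.+ k)                                          ∎

  -- Laplace expansion: Σⱼ (−1)ʲ⁻¹ φ lⱼ (l without lⱼ).
  laplace : ∀ {n} → (ℕ → Vec ℕ n → Carrier) → Vec ℕ (suc n) → Carrier
  laplace {zero}  φ (x ∷ []) = φ x []
  laplace {suc n} φ (x ∷ l)  = φ x l - laplace (λ e r → φ e (x ∷ r)) l

  -- The determinant of the powers of the variables with exponents `l`, expanded along the row of
  -- the first variable.
  alternant : ∀ {n} → Vec ℕ n → Vec Carrier n → Carrier
  alternant l []       = 1#
  alternant l (y ∷ ys) = laplace (λ e r → y ^ e * alternant r ys) l

  laplace-cong-remove : ∀ {n} {φ ψ : ℕ → Vec ℕ n → Carrier} (l : Vec ℕ (suc n)) →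
    (∀ {e r} → Remove l e r → φ e r ≈ ψ e r) → laplace φ l ≈ laplace ψ l
  laplace-cong-remove {zero}  (x ∷ []) φ≈ψ = φ≈ψ here
  laplace-cong-remove {suc n} (x ∷ l)  φ≈ψ = -cong (φ≈ψ here) (laplace-cong-remove l (φ≈ψ ∘ there))

  laplace-cong : ∀ {n} {φ ψ : ℕ → Vec ℕ n → Carrier} (l : Vec ℕ (suc n)) →
    (∀ e r → φ e r ≈ ψ e r) → laplace φ l ≈ laplace ψ l
  laplace-cong l φ≈ψ = laplace-cong-remove l λ {e} {r} _ → φ≈ψ e r

  laplace-* : ∀ {n} (c : Carrier) (φ : ℕ → Vec ℕ n → Carrier) (l : Vec ℕ (suc n)) →
    laplace (λ e r → c * φ e r) l ≈ c * laplace φ l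
  laplace-* {zero}  c φ (x ∷ []) = refl
  laplace-* {suc n} c φ (x ∷ l)  = trans (-cong refl (laplace-* c _ l))
    (solve 4 (λ u a b d → (a :* b) :+ (u :* (a :* d)) := a :* (b :+ (u :* d))) refl _ _ _ _)

  laplace-sub : ∀ {n} (φ ψ : ℕ → Vec ℕ n → Carrier) (l : Vec ℕ (suc n)) →
    laplace (λ e r → φ e r - ψ e r) l ≈ laplace φ l - laplace ψ l
  laplace-sub {zero}  φ ψ (x ∷ []) = refl
  laplace-sub {suc n} φ ψ (x ∷ l)  = trans (-cong refl (laplace-sub _ _ l))
    (solve 5 (λ u a b c d → (a :+ (u :* b)) :+ (u :* (c :+ (u :* d))) := (a :+ (u :* c)) :+ (u :* (b :+ (u :* d)))) refl _ _ _ _ _)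

  laplace-zero : ∀ {n} (φ : ℕ → Vec ℕ n → Carrier) (l : Vec ℕ (suc n)) →
    (∀ {e r} → Remove l e r → φ e r ≈ 0#) → laplace φ l ≈ 0#
  laplace-zero {zero}  φ (x ∷ []) φ≈0 = φ≈0 here
  laplace-zero {suc n} φ (x ∷ l)  φ≈0 = trans (-cong (φ≈0 here) (laplace-zero _ l (φ≈0 ∘ there))) (x-x≈0 0#)

  Alternating : ∀ {n} → (Vec ℕ n → Carrier) → Set
  Alternating φ = ∀ {l} → HasRepeat l → φ l ≈ 0#

  -- Removing either of two equal neighbours leaves the same vector with opposite signs, and
  -- removing any other entry leaves both of them in place.
  laplace-alternating : ∀ {n} (φ : ℕ → Vec ℕ n → Carrier) → (∀ e → Alternating (φ e)) → Alternating (laplace φ)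
  laplace-alternating {suc zero}    φ alt {x ∷ .x ∷ []} here = x-x≈0 _
  laplace-alternating {suc (suc n)} φ alt {x ∷ .x ∷ l}  here = begin
    φ x (x ∷ l) - (φ x (x ∷ l) - laplace (λ e r → φ e (x ∷ x ∷ r)) l)
      ≈⟨ -cong refl (-cong refl (laplace-zero _ l λ {e} _ → alt e here)) ⟩
    φ x (x ∷ l) - (φ x (x ∷ l) - 0#) ≈⟨ -cong refl (x-0≈x _) ⟩
    φ x (x ∷ l) - φ x (x ∷ l)        ≈⟨ x-x≈0 _ ⟩
    0#                               ∎
  laplace-alternating {suc n} φ alt {x ∷ l} (there rep) =
    trans (-cong (alt x rep) (laplace-alternating (λ e r → φ e (x ∷ r)) (λ e rep′ → alt e (there rep′)) rep)) (x-x≈0 0#)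
  laplace-alternating {zero} φ alt {x ∷ []} (there ())

  alternant-alternating : ∀ {n} (ys : Vec Carrier n) → Alternating (λ l → alternant l ys)
  alternant-alternating (y ∷ ys) {x ∷ l} rep =
    laplace-alternating (λ e r → y ^ e * alternant r ys)
      (λ e rep′ → trans (*-congˡ (alternant-alternating ys rep′)) (zeroʳ _)) rep

  -- Σₛ (−1)^|s| φ (m + s), over all s ∈ {0,1}ⁿ.
  difference : ∀ {n} → (Vec ℕ n → Carrier) → Vec ℕ n → Carrier
  difference φ []      = φ []
  difference φ (x ∷ m) = difference (φ ∘ (x ∷_)) m - difference (φ ∘ (suc x ∷_)) m

  -- Σₛ (−1)^|s| yⁿ⁻^|s| φ (m + s), over all s ∈ {0,1}ⁿ.
  weightedDifference : ∀ {n} → Carrier → (Vec ℕ n → Carrier) → Vec ℕ n → Carrier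
  weightedDifference y φ []      = φ []
  weightedDifference y φ (x ∷ m) = y * weightedDifference y (φ ∘ (x ∷_)) m - weightedDifference y (φ ∘ (suc x ∷_)) m

  weightedDifference-* : ∀ {n} y c (φ : Vec ℕ n → Carrier) m →
    weightedDifference y (λ l → c * φ l) m ≈ c * weightedDifference y φ m
  weightedDifference-* y c φ []      = refl
  weightedDifference-* y c φ (x ∷ m) =
    trans (-cong (*-congˡ (weightedDifference-* y c _ m)) (weightedDifference-* y c _ m))
      (solve 5 (λ u y c a b → (y :* (c :* a)) :+ (u :* (c :* b)) := c :* ((y :* a) :+ (u :* b))) refl _ _ _ _ _)

  weightedDifference-sub : ∀ {n} y (φ ψ : Vec ℕ n → Carrier) m →
    weightedDifference y (λ l → φ l - ψ l) m ≈ weightedDifference y φ m - weightedDifference y ψ m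
  weightedDifference-sub y φ ψ []      = refl
  weightedDifference-sub y φ ψ (x ∷ m) =
    trans (-cong (*-congˡ (weightedDifference-sub y _ _ m)) (weightedDifference-sub y _ _ m))
      (solve 6 (λ u y a b c d → (y :* (a :+ (u :* b))) :+ (u :* (c :+ (u :* d))) := ((y :* a) :+ (u :* c)) :+ (u :* ((y :* b) :+ (u :* d)))) refl _ _ _ _ _ _)

  -- `weightedDifference y` is the product over all coordinates of the operators "y minus the shift
  -- of this coordinate". In each term of the expansion the operator of the removed entry acts on
  -- `e`, and the others act on `r`.
  weightedDifference-laplace : ∀ {n} y (φ : ℕ → Vec ℕ n → Carrier) (m : Vec ℕ (suc n)) →
    weightedDifference y (laplace φ) m
      ≈ laplace (λ e r → y * weightedDifference y (φ e) r - weightedDifference y (φ (suc e)) r) m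
  weightedDifference-laplace {zero}  y φ (x ∷ []) = refl
  weightedDifference-laplace {suc n} y φ (x ∷ m)  = begin
    y * W (λ p → φ x p - laplace (φ′ x) p) m - W (λ p → φ (suc x) p - laplace (φ′ (suc x)) p) m
      ≈⟨ -cong (*-congˡ (expand x x)) (expand (suc x) (suc x)) ⟩
    y * (W (φ x) m - L x) - (W (φ (suc x)) m - L (suc x))
      ≈⟨ solve 6 (λ u y a b c d → (y :* (a :+ (u :* b))) :+ (u :* (c :+ (u :* d))) := ((y :* a) :+ (u :* c)) :+ (u :* ((y :* b) :+ (u :* d)))) refl _ _ _ _ _ _ ⟩
    (y * W (φ x) m - W (φ (suc x)) m) - (y * L x - L (suc x))
      ≈⟨ -cong refl (sym (trans (laplace-cong m λ e r →
           solve 6 (λ u y a b c d → (y :* ((y :* a) :+ (u :* b))) :+ (u :* ((y :* c) :+ (u :* d))) := (y :* ((y :* a) :+ (u :* c))) :+ (u :* ((y :* b) :+ (u :* d)))) refl _ _ _ _ _ _)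
           (trans (laplace-sub _ _ m) (-cong (laplace-* y _ m) refl)))) ⟩
    (y * W (φ x) m - W (φ (suc x)) m) - laplace (λ e r → y * W (φ e) (x ∷ r) - W (φ (suc e)) (x ∷ r)) m ∎
    where
    W : ∀ {n} → (Vec ℕ n → Carrier) → Vec ℕ n → Carrier
    W = weightedDifference y
    φ′ : ℕ → ℕ → Vec ℕ n → Carrier
    φ′ z e r = φ e (z ∷ r)
    L : ℕ → Carrier
    L z = laplace (λ e r → y * W (φ′ z e) r - W (φ′ z (suc e)) r) m
    expand : ∀ a z → W (λ p → φ a p - laplace (φ′ z) p) m ≈ W (φ a) m - L z
    expand a z = trans (weightedDifference-sub y (φ a) (laplace (φ′ z)) m) (-cong refl (weightedDifference-laplace y (φ′ z) m))

  linearFactors : ∀ {n} → Carrier → Vec Carrier n → Carrier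
  linearFactors y []       = 1#
  linearFactors y (x ∷ xs) = (y - x) * linearFactors y xs

  -- This collects the Pieri rules for all elementary symmetric polynomials into one generating
  -- function in `y`. Each row of the determinant absorbs its own factor, since (y - x) xᵉ = y xᵉ -
  -- xᵉ⁺¹.
  linearFactors-alternant : ∀ {n} y (xs : Vec Carrier n) m →
    linearFactors y xs * alternant m xs ≈ weightedDifference y (λ l → alternant l xs) m
  linearFactors-alternant y []       []      = *-identityˡ 1#
  linearFactors-alternant y (x ∷ xs) (k ∷ m) = begin
    (y - x) * linearFactors y xs * laplace (λ e r → x ^ e * alternant r xs) (k ∷ m)
      ≈⟨ laplace-* _ _ (k ∷ m) ⟨
    laplace (λ e r → (y - x) * linearFactors y xs * (x ^ e * alternant r xs)) (k ∷ m)
      ≈⟨ laplace-cong (k ∷ m) step ⟩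
    laplace (λ e r → y * weightedDifference y (λ l → x ^ e * alternant l xs) r - weightedDifference y (λ l → x ^ (suc e) * alternant l xs) r) (k ∷ m)
      ≈⟨ weightedDifference-laplace y (λ e r → x ^ e * alternant r xs) (k ∷ m) ⟨
    weightedDifference y (λ l → alternant l (x ∷ xs)) (k ∷ m) ∎
    where
    step : ∀ e r → (y - x) * linearFactors y xs * (x ^ e * alternant r xs)
      ≈ y * weightedDifference y (λ l → x ^ e * alternant l xs) r - weightedDifference y (λ l → x ^ (suc e) * alternant l xs) r
    step e r = begin
      (y - x) * linearFactors y xs * (x ^ e * alternant r xs)
        ≈⟨ solve 6 (λ u y x p q a → ((y :+ (u :* x)) :* p) :* (q :* a) := (y :* (q :* (p :* a))) :+ (u :* ((x :* q) :* (p :* a)))) refl _ _ _ _ _ _ ⟩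
      y * (x ^ e * (linearFactors y xs * alternant r xs)) - x ^ suc e * (linearFactors y xs * alternant r xs)
        ≈⟨ -cong (*-congˡ (*-congˡ (linearFactors-alternant y xs r))) (*-congˡ (linearFactors-alternant y xs r)) ⟩
      y * (x ^ e * weightedDifference y (λ l → alternant l xs) r) - x ^ suc e * weightedDifference y (λ l → alternant l xs) r
        ≈⟨ -cong (*-congˡ (weightedDifference-* y _ _ r)) (weightedDifference-* y _ _ r) ⟨
      _ ∎

  -- Raising an entry by one costs one power of `y`, so the power of `y` and the sum of the entries
  -- have the constant total `c`. The weight thus becomes a function of the vector alone; `k` is the
  -- sum of the entries that the recursion has passed.
  weightedDifference-difference : ∀ {n} y (φ : Vec ℕ n → Carrier) m e c k → c ≡ e ℕ.+ n ℕ.+ (k ℕ.+ Vec.sum m) →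
    y ^ e * weightedDifference y φ m ≈ difference (λ l → y ^ (c ℕ.∸ (k ℕ.+ Vec.sum l)) * φ l) m
  weightedDifference-difference y φ [] e _ k ≡.refl
    rewrite ℕ.m+n∸n≡m (e ℕ.+ 0) (k ℕ.+ 0) | ℕ.+-identityʳ e = refl
  weightedDifference-difference {suc n} y φ (x ∷ m) e c k c≡ = begin
    y ^ e * (y * weightedDifference y (φ ∘ (x ∷_)) m - weightedDifference y (φ ∘ (suc x ∷_)) m)
      ≈⟨ solve 5 (λ u q y a b → q :* ((y :* a) :+ (u :* b)) := ((y :* q) :* a) :+ (u :* (q :* b))) refl _ _ _ _ _ ⟩
    y ^ suc e * weightedDifference y (φ ∘ (x ∷_)) m - y ^ e * weightedDifference y (φ ∘ (suc x ∷_)) m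
      ≈⟨ -cong (weightedDifference-difference y _ m (suc e) c (k ℕ.+ x) (≡.trans c≡ (lemma₁ e n k x _)))
               (weightedDifference-difference y _ m e c (k ℕ.+ suc x) (≡.trans c≡ (lemma₂ e n k x _))) ⟩
    difference (λ l → y ^ (c ℕ.∸ (k ℕ.+ x ℕ.+ Vec.sum l)) * φ (x ∷ l)) m
      - difference (λ l → y ^ (c ℕ.∸ (k ℕ.+ suc x ℕ.+ Vec.sum l)) * φ (suc x ∷ l)) m
      ≈⟨ -cong (difference-cong m (λ l → *-congʳ (^-congʳ y (≡.cong (c ℕ.∸_) (ℕ.+-assoc k x _)))))
               (difference-cong m (λ l → *-congʳ (^-congʳ y (≡.cong (c ℕ.∸_) (ℕ.+-assoc k (suc x) _))))) ⟩
    _ ∎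
    where
    difference-cong : ∀ {n} {φ ψ : Vec ℕ n → Carrier} m → (∀ l → φ l ≈ ψ l) → difference φ m ≈ difference ψ m
    difference-cong []      φ≈ψ = φ≈ψ []
    difference-cong (x ∷ m) φ≈ψ = -cong (difference-cong m λ l → φ≈ψ (x ∷ l)) (difference-cong m λ l → φ≈ψ (suc x ∷ l))
    lemma₁ : ∀ e n k x s → e ℕ.+ suc n ℕ.+ (k ℕ.+ (x ℕ.+ s)) ≡ suc e ℕ.+ n ℕ.+ (k ℕ.+ x ℕ.+ s)
    lemma₁ = solve-∀
    lemma₂ : ∀ e n k x s → e ℕ.+ suc n ℕ.+ (k ℕ.+ (x ℕ.+ s)) ≡ e ℕ.+ n ℕ.+ (k ℕ.+ suc x ℕ.+ s)
    lemma₂ = solve-∀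

  -- Σ ± φ p over all p with pⱼ ∈ {lⱼ, lⱼ₊₁}, each choice pⱼ = lⱼ contributing a sign.
  neighbourSum : ∀ {n} → (Vec ℕ n → Carrier) → Vec ℕ (suc n) → Carrier
  neighbourSum φ (x ∷ [])    = φ []
  neighbourSum φ (x ∷ y ∷ l) = neighbourSum (φ ∘ (y ∷_)) (y ∷ l) - neighbourSum (φ ∘ (x ∷_)) (y ∷ l)

  -- Each coordinate telescopes over the values from `y` to `x`, which leaves the values at `y` and
  -- at `suc x`. Since ρ grows by one from a row to the row above, adding ρ turns these into two
  -- neighbouring entries of `addρ κ`.
  Σ-interlacings-difference : ∀ {n} (φ : Vec ℕ n → Carrier) (κ : Vec ℕ (suc n)) → Decreasing κ →
    Σ[ interlacings κ ] (difference φ ∘ addρ) ≈ neighbourSum φ (addρ κ)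
  Σ-interlacings-difference φ (x ∷ []) _ = +-identityʳ _
  Σ-interlacings-difference {suc n} φ (x ∷ y ∷ κ) (y≤x ∷ κ↓) = begin
    Σ[ interlacings (x ∷ y ∷ κ) ] (difference φ ∘ addρ)
      ≈⟨ Σ-cartesianProductWith _∷_ (range y (suc x ℕ.∸ y)) (interlacings (y ∷ κ)) (difference φ ∘ addρ) ⟩
    Σ[ range y (suc x ℕ.∸ y) ] (λ i → Σ[ interlacings (y ∷ κ) ] (λ λ′ → difference (φ ∘ ((i ℕ.+ n) ∷_)) (addρ λ′) - difference (φ ∘ (suc (i ℕ.+ n) ∷_)) (addρ λ′)))
      ≈⟨ Σ-cong (range y (suc x ℕ.∸ y)) (λ i → trans (Σ-sub (interlacings (y ∷ κ)) _ _)
           (-cong (Σ-interlacings-difference _ (y ∷ κ) κ↓) (Σ-interlacings-difference _ (y ∷ κ) κ↓))) ⟩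
    Σ[ range y (suc x ℕ.∸ y) ] (λ i → f i - f (suc i))
      ≈⟨ Σ-telescope f y (suc x ℕ.∸ y) ⟩
    f y - f (y ℕ.+ (suc x ℕ.∸ y)) ≈⟨ -cong refl (reflexive (≡.cong f (ℕ.m+[n∸m]≡n (ℕ.m≤n⇒m≤1+n y≤x)))) ⟩
    f y - f (suc x)
      ≈⟨ -cong refl (reflexive (≡.cong (λ z → neighbourSum (φ ∘ (z ∷_)) (addρ (y ∷ κ))) (≡.sym (ℕ.+-suc x n)))) ⟩
    _ ∎
    where
    f : ℕ → Carrier
    f i = neighbourSum (φ ∘ ((i ℕ.+ n) ∷_)) (addρ (y ∷ κ))

  -- Once the right neighbour `y` has been chosen, choosing the left one at the next position would
  -- repeat `y`. So every later choice is forced to the right, and these choices carry no sign.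
  neighbourSum-repeat : ∀ {n} (φ : Vec ℕ (suc n) → Carrier) → Alternating φ → ∀ y l →
    neighbourSum (φ ∘ (y ∷_)) (y ∷ l) ≈ φ (y ∷ l)
  neighbourSum-zero : ∀ {n} (φ : Vec ℕ n → Carrier) → (∀ l → φ l ≈ 0#) → ∀ l → neighbourSum φ l ≈ 0#

  neighbourSum-zero φ φ≈0 (x ∷ [])    = φ≈0 []
  neighbourSum-zero φ φ≈0 (x ∷ y ∷ l) =
    trans (-cong (neighbourSum-zero _ (λ r → φ≈0 (y ∷ r)) (y ∷ l)) (neighbourSum-zero _ (λ r → φ≈0 (x ∷ r)) (y ∷ l))) (x-x≈0 0#)

  neighbourSum-repeat φ alt y []      = refl
  neighbourSum-repeat φ alt y (z ∷ l) = begin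
    neighbourSum (φ ∘ (y ∷_) ∘ (z ∷_)) (z ∷ l) - neighbourSum (φ ∘ (y ∷_) ∘ (y ∷_)) (z ∷ l)
      ≈⟨ -cong (neighbourSum-repeat (φ ∘ (y ∷_)) (alt ∘ there) z l) (neighbourSum-zero _ (λ r → alt here) (z ∷ l)) ⟩
    φ (y ∷ z ∷ l) - 0# ≈⟨ x-0≈x _ ⟩
    φ (y ∷ z ∷ l)      ∎

  -- The surviving choices take left entries up to some position and right entries from there on.
  -- This omits exactly one entry of `l`, with the sign that it has in the Laplace expansion.
  neighbourSum-alternating : ∀ {n} (φ : Vec ℕ n → Carrier) → Alternating φ → ∀ l →
    neighbourSum φ l ≈ laplace (λ _ → φ) l
  neighbourSum-alternating φ alt (x ∷ [])    = refl
  neighbourSum-alternating φ alt (x ∷ y ∷ l) =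
    -cong (neighbourSum-repeat φ alt y l) (neighbourSum-alternating (φ ∘ (x ∷_)) (alt ∘ there) (y ∷ l))

  -- Schur polynomials and the bialternant formula

  vandermonde : ∀ {n} → Vec Carrier n → Carrier
  vandermonde []       = 1#
  vandermonde (y ∷ xs) = linearFactors y xs * vandermonde xs

  -- The branching rule, used as the definition: the exponent of the first variable is the number of
  -- boxes by which the shapes differ.
  schurPolynomial : ∀ {n} → Vec ℕ n → Vec Carrier n → Carrier
  schurPolynomial κ []       = 1#
  schurPolynomial κ (y ∷ xs) = Σ[ interlacings κ ] (λ λ′ → y ^ (Vec.sum κ ℕ.∸ Vec.sum λ′) * schurPolynomial λ′ xs)

  bialternant : ∀ {n} (κ : Vec ℕ n) (xs : Vec Carrier n) → Decreasing κ →
    vandermonde xs * schurPolynomial κ xs ≈ alternant (addρ κ) xs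
  bialternant []      []       _  = *-identityˡ 1#
  bialternant {suc n} κ@(k ∷ κ′) (y ∷ xs) κ↓ = begin
    linearFactors y xs * vandermonde xs * Σ[ interlacings κ ] (λ λ′ → y ^ (Vec.sum κ ℕ.∸ Vec.sum λ′) * schurPolynomial λ′ xs)
      ≈⟨ *-distribˡ-Σ (interlacings κ) _ _ ⟩
    Σ[ interlacings κ ] (λ λ′ → linearFactors y xs * vandermonde xs * (y ^ (Vec.sum κ ℕ.∸ Vec.sum λ′) * schurPolynomial λ′ xs))
      ≈⟨ Σ-cong-∈ (interlacings κ) step ⟩
    Σ[ interlacings κ ] (difference φ ∘ addρ)
      ≈⟨ Σ-interlacings-difference φ κ κ↓ ⟩
    neighbourSum φ (addρ κ)
      ≈⟨ neighbourSum-alternating φ (λ rep → trans (*-congˡ (alternant-alternating xs rep)) (zeroʳ _)) (addρ κ) ⟩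
    laplace (λ _ → φ) (addρ κ)
      -- The removed exponent and the remaining ones add up to `c`, so the weight of a surviving
      -- term is the power of `y` that the expansion along the row of `y` asks for.
      ≈⟨ laplace-cong-remove (addρ κ) (λ {e} {r} rem → *-congʳ (^-congʳ y
           (≡.trans (≡.cong (ℕ._∸ Vec.sum r) (≡.sym (remove-sum rem))) (ℕ.m+n∸n≡m e (Vec.sum r))))) ⟩
    alternant (addρ κ) (y ∷ xs) ∎
    where
    c : ℕ
    c = Vec.sum (addρ κ)
    -- The alternant in the remaining variables is completed by a power of `y` to the total degree
    -- `c` of κ + ρ. As `φ` does not involve λ′, the sum over λ′ can telescope.
    φ : Vec ℕ n → Carrier
    φ l = y ^ (c ℕ.∸ Vec.sum l) * alternant l xs
    degree : ∀ {λ′} → λ′ ∈ interlacings κ → c ≡ Vec.sum κ ℕ.∸ Vec.sum λ′ ℕ.+ n ℕ.+ Vec.sum (addρ λ′)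
    degree {λ′} λ∈ rewrite sum-addρ κ | sum-addρ λ′ =
      ≡.trans (≡.cong (ℕ._+ triangle (suc n)) (≡.sym (ℕ.m∸n+n≡m (interlaces-sum (∈-interlacings⁻ κ↓ λ∈)))))
        (lemma (Vec.sum κ ℕ.∸ Vec.sum λ′) (Vec.sum λ′) n (triangle n))
      where
      lemma : ∀ d s n t → d ℕ.+ s ℕ.+ (n ℕ.+ t) ≡ d ℕ.+ n ℕ.+ (s ℕ.+ t)
      lemma = solve-∀
    step : ∀ {λ′} → λ′ ∈ interlacings κ →
      linearFactors y xs * vandermonde xs * (y ^ (Vec.sum κ ℕ.∸ Vec.sum λ′) * schurPolynomial λ′ xs) ≈ difference φ (addρ λ′)
    step {λ′} λ∈ = begin
      linearFactors y xs * vandermonde xs * (y ^ (Vec.sum κ ℕ.∸ Vec.sum λ′) * schurPolynomial λ′ xs)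
        ≈⟨ solve 4 (λ p v q s → (p :* v) :* (q :* s) := q :* (p :* (v :* s))) refl _ _ _ _ ⟩
      y ^ (Vec.sum κ ℕ.∸ Vec.sum λ′) * (linearFactors y xs * (vandermonde xs * schurPolynomial λ′ xs))
        ≈⟨ *-congˡ (*-congˡ (bialternant λ′ xs (interlaces-decreasing (∈-interlacings⁻ κ↓ λ∈)))) ⟩
      y ^ (Vec.sum κ ℕ.∸ Vec.sum λ′) * (linearFactors y xs * alternant (addρ λ′) xs)
        ≈⟨ *-congˡ (linearFactors-alternant y xs (addρ λ′)) ⟩
      y ^ (Vec.sum κ ℕ.∸ Vec.sum λ′) * weightedDifference y (λ l → alternant l xs) (addρ λ′)
        ≈⟨ weightedDifference-difference y _ (addρ λ′) _ c 0 (degree λ∈) ⟩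
      difference φ (addρ λ′) ∎

-- Power series

module PowerSeries (R : CommutativeRing 0ℓ 0ℓ) where

  open CommutativeRing R hiding (_-_)
  open import Algebra.Solver.Ring.NaturalCoefficients.Default commutativeSemiring using (solve; _:+_; _:*_; _:=_)
  open import Relation.Binary.Reasoning.Setoid setoid

  infixl 7 _⋆_
  infix 4 _≋_

  _≋_ : (ℕ → Carrier) → (ℕ → Carrier) → Set
  f ≋ g = ∀ k → f k ≈ g k

  constant : Carrier → ℕ → Carrier
  constant a zero    = a
  constant a (suc k) = 0#

  _⊞_ : (f g : ℕ → Carrier) → ℕ → Carrier
  (f ⊞ g) k = f k + g k

  -- The Cauchy product, by splitting off the constant term of the left factor. The recursion is on
  -- the degree, so the ring laws follow by induction on it.
  _⋆_ : (f g : ℕ → Carrier) → ℕ → Carrier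
  (f ⋆ g) zero    = f 0 * g 0
  (f ⋆ g) (suc k) = f 0 * g (suc k) + ((f ∘ suc) ⋆ g) k

  ⋆-cong : ∀ {f f′ g g′} → f ≋ f′ → g ≋ g′ → f ⋆ g ≋ f′ ⋆ g′
  ⋆-cong f≋ g≋ zero    = *-cong (f≋ 0) (g≋ 0)
  ⋆-cong f≋ g≋ (suc k) = +-cong (*-cong (f≋ 0) (g≋ (suc k))) (⋆-cong (f≋ ∘ suc) g≋ k)

  ⋆-distribʳ : ∀ h f g → (f ⊞ g) ⋆ h ≋ (f ⋆ h) ⊞ (g ⋆ h)
  ⋆-distribʳ h f g zero    = distribʳ _ _ _
  ⋆-distribʳ h f g (suc k) = trans (+-cong (distribʳ _ _ _) (⋆-distribʳ h (f ∘ suc) (g ∘ suc) k))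
    (solve 4 (λ a b c d → (a :+ b) :+ (c :+ d) := (a :+ c) :+ (b :+ d)) refl _ _ _ _)

  ⋆-scale : ∀ a f g k → ((λ i → a * f i) ⋆ g) k ≈ a * (f ⋆ g) k
  ⋆-scale a f g zero    = *-assoc _ _ _
  ⋆-scale a f g (suc k) = trans (+-congˡ (⋆-scale a (f ∘ suc) g k))
    (solve 4 (λ a b c d → (a :* b) :* c :+ a :* d := a :* (b :* c :+ d)) refl _ _ _ _)

  ⋆-assoc : ∀ f g h → (f ⋆ g) ⋆ h ≋ f ⋆ (g ⋆ h)
  ⋆-assoc f g h zero    = *-assoc _ _ _
  ⋆-assoc f g h (suc k) = begin
    f 0 * g 0 * h (suc k) + (((λ i → f 0 * g (suc i)) ⊞ ((f ∘ suc) ⋆ g)) ⋆ h) k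
      ≈⟨ +-congˡ (⋆-distribʳ h _ _ k) ⟩
    f 0 * g 0 * h (suc k) + (((λ i → f 0 * g (suc i)) ⋆ h) k + (((f ∘ suc) ⋆ g) ⋆ h) k)
      ≈⟨ +-congˡ (+-cong (⋆-scale (f 0) (g ∘ suc) h k) (⋆-assoc (f ∘ suc) g h k)) ⟩
    f 0 * g 0 * h (suc k) + (f 0 * ((g ∘ suc) ⋆ h) k + ((f ∘ suc) ⋆ (g ⋆ h)) k)
      ≈⟨ solve 5 (λ a b c d e → a :* b :* c :+ (a :* d :+ e) := a :* (b :* c :+ d) :+ e) refl _ _ _ _ _ ⟩
    f 0 * (g 0 * h (suc k) + ((g ∘ suc) ⋆ h) k) + ((f ∘ suc) ⋆ (g ⋆ h)) k ∎

  -- The mirror image of the defining recursion, which is what commutativity needs.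
  ⋆-suc : ∀ f g k → (f ⋆ g) (suc k) ≈ f (suc k) * g 0 + (f ⋆ (g ∘ suc)) k
  ⋆-suc f g zero    = +-comm _ _
  ⋆-suc f g (suc k) = trans (+-congˡ (⋆-suc (f ∘ suc) g k))
    (solve 3 (λ a b c → a :+ (b :+ c) := b :+ (a :+ c)) refl _ _ _)

  ⋆-comm : ∀ f g → f ⋆ g ≋ g ⋆ f
  ⋆-comm f g zero    = *-comm _ _
  ⋆-comm f g (suc k) = trans (+-cong (*-comm _ _) (⋆-comm (f ∘ suc) g k)) (sym (⋆-suc g f k))

  ⋆-zeroˡ : ∀ f → (λ _ → 0#) ⋆ f ≋ (λ _ → 0#)
  ⋆-zeroˡ f zero    = zeroˡ _
  ⋆-zeroˡ f (suc k) = trans (+-cong (zeroˡ _) (⋆-zeroˡ f k)) (+-identityˡ _)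

  constant-⋆ : ∀ a f k → (constant a ⋆ f) k ≈ a * f k
  constant-⋆ a f zero    = refl
  constant-⋆ a f (suc k) = trans (+-congˡ (⋆-zeroˡ f k)) (+-identityʳ _)

  ⋆-identityˡ : ∀ f → constant 1# ⋆ f ≋ f
  ⋆-identityˡ f k = trans (constant-⋆ 1# f k) (*-identityˡ _)

  powerSeriesRing : CommutativeRing 0ℓ 0ℓ
  powerSeriesRing = record
    { Carrier = ℕ → Carrier ; _≈_ = _≋_ ; _+_ = _⊞_ ; _*_ = _⋆_ ; -_ = λ f k → - f k
    ; 0# = λ _ → 0# ; 1# = constant 1#
    ; isCommutativeRing = record
      { isRing = record
        { +-isAbelianGroup = Pointwise.isAbelianGroup ℕ +-isAbelianGroup
        ; *-cong = ⋆-cong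
        ; *-assoc = ⋆-assoc
        ; *-identity = ⋆-identityˡ , λ f k → trans (⋆-comm f _ k) (⋆-identityˡ f k)
        ; distrib = (λ f g h k → trans (⋆-comm f _ k) (trans (⋆-distribʳ f g h k) (+-cong (⋆-comm g f k) (⋆-comm h f k))))
                  , ⋆-distribʳ
        }
      ; *-comm = ⋆-comm
      }
    }

  variableX : ℕ → Carrier
  variableX zero          = 0#
  variableX (suc zero)    = 1#
  variableX (suc (suc k)) = 0#

  monomial : ℕ → Carrier → ℕ → Carrier
  monomial zero    a k       = constant a k
  monomial (suc e) a zero    = 0#
  monomial (suc e) a (suc k) = monomial e a k

  variableX-⋆-suc : ∀ f k → (variableX ⋆ f) (suc k) ≈ f k
  variableX-⋆-suc f k = begin
    0# * f (suc k) + ((variableX ∘ suc) ⋆ f) k ≈⟨ +-cong (zeroˡ _) (⋆-cong {g = f} (λ { zero → refl ; (suc _) → refl }) (λ _ → refl) k) ⟩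
    0# + (constant 1# ⋆ f) k                   ≈⟨ trans (+-identityˡ _) (⋆-identityˡ f k) ⟩
    f k                                        ∎

  open import Algebra.Properties.Semiring.Exp (CommutativeRing.semiring powerSeriesRing) using (_^_)

  variableX^-constant : ∀ e a → (variableX ^ e) ⋆ constant a ≋ monomial e a
  variableX^-constant zero    a k       = ⋆-identityˡ (constant a) k
  variableX^-constant (suc e) a zero    = trans (*-congʳ (zeroˡ _)) (zeroˡ _)
  variableX^-constant (suc e) a (suc k) =
    trans (⋆-assoc variableX (variableX ^ e) (constant a) (suc k))
      (trans (variableX-⋆-suc ((variableX ^ e) ⋆ constant a) k) (variableX^-constant e a k))

-- Linear maps and the extraction of coefficients

module LinearMaps (R S : CommutativeRing 0ℓ 0ℓ) where
  private
    module R = CommutativeRing R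
    module S = CommutativeRing S
    module AR = Alternants R
    module AS = Alternants S

  -- Extracting a coefficient is additive but not multiplicative. Sums and Laplace expansions only
  -- use addition and the factor -1, in the form in which differences are written in `Alternants`.
  record IsLinear (f : R.Carrier → S.Carrier) : Set where
    field
      cong : ∀ {a b} → a R.≈ b → f a S.≈ f b
      add  : ∀ a b → f (a R.+ b) S.≈ f a S.+ f b
      zero# : f R.0# S.≈ S.0#
      -1#* : ∀ a → f (R.- R.1# R.* a) S.≈ S.- S.1# S.* f a

    sub : ∀ a b → f (a AR.- b) S.≈ f a AS.- f b
    sub a b = S.trans (add a _) (S.+-congˡ (-1#* b))

    laplace-map : ∀ {n} (φ : ℕ → Vec ℕ n → R.Carrier) l →
      f (AR.laplace φ l) S.≈ AS.laplace (λ e r → f (φ e r)) l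
    laplace-map {zero}  φ (x ∷ []) = S.refl
    laplace-map {suc n} φ (x ∷ l)  = S.trans (sub _ _) (AS.-cong S.refl (laplace-map _ l))

    Σ-map : {A : Set} (xs : List A) (g : A → R.Carrier) → f (AR.Σ[ xs ] g) S.≈ AS.Σ[ xs ] (f ∘ g)
    Σ-map []       g = zero#
    Σ-map (x ∷ xs) g = S.trans (add _ _) (S.+-congˡ (Σ-map xs g))

-- The ring ℤ[[x₁,…,xₙ]], as ℤ[[xₙ]]⋯[[x₁]].
powerSeries : ℕ → CommutativeRing 0ℓ 0ℓ
powerSeries zero    = ℤ.+-*-commutativeRing
powerSeries (suc n) = PowerSeries.powerSeriesRing (powerSeries n)

⟪_⟫ : ℕ → Set
⟪ n ⟫ = CommutativeRing.Carrier (powerSeries n)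

coeff : ∀ n → ⟪ n ⟫ → Vec ℕ n → ℤ
coeff zero    z []      = z
coeff (suc n) f (k ∷ w) = coeff n (f k) w

fromCoeffs : ∀ n → (Vec ℕ n → ℤ) → ⟪ n ⟫
fromCoeffs zero    F   = F []
fromCoeffs (suc n) F k = fromCoeffs n (F ∘ (k ∷_))

coeff-fromCoeffs : ∀ n F w → coeff n (fromCoeffs n F) w ≡ F w
coeff-fromCoeffs zero    F []      = ≡.refl
coeff-fromCoeffs (suc n) F (k ∷ w) = coeff-fromCoeffs n (F ∘ (k ∷_)) w

coeff-ext : ∀ n {f g : ⟪ n ⟫} → (∀ w → coeff n f w ≡ coeff n g w) → CommutativeRing._≈_ (powerSeries n) f g
coeff-ext zero    f≡g   = f≡g []
coeff-ext (suc n) f≡g k = coeff-ext n λ w → f≡g (k ∷ w)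

module _ (R : CommutativeRing 0ℓ 0ℓ) where
  private
    module R = CommutativeRing R
  open PowerSeries R
  open import Algebra.Properties.Ring R.ring using (-1*x≈-x; -0#≈0#)
  open import Algebra.Properties.Ring (CommutativeRing.ring powerSeriesRing) using () renaming (-1*x≈-x to -1⋆f≋-f)
  open LinearMaps

  evaluation-linear : ∀ k → IsLinear powerSeriesRing R (λ f → f k)
  evaluation-linear k = record
    { cong  = λ f≋g → f≋g k
    ; add   = λ _ _ → R.refl
    ; zero# = R.refl
    ; -1#*  = λ f → R.trans (-1⋆f≋-f f k) (R.sym (-1*x≈-x (f k)))
    }

  constant-linear : IsLinear R powerSeriesRing constant
  constant-linear = record
    { cong  = λ a≈b → λ { zero → a≈b ; (suc k) → R.refl }
    ; add   = λ a b → λ { zero → R.refl ; (suc k) → R.sym (R.+-identityˡ _) }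
    ; zero# = λ { zero → R.refl ; (suc k) → R.refl }
    ; -1#*  = λ a k → R.sym (R.trans (-1⋆f≋-f (constant a) k) (negate a k))
    }
    where
    negate : ∀ a k → R.- constant a k R.≈ constant (R.- R.1# R.* a) k
    negate a zero    = R.sym (-1*x≈-x a)
    negate a (suc k) = -0#≈0#

coeff-linear : ∀ n w → LinearMaps.IsLinear (powerSeries n) ℤ.+-*-commutativeRing (λ f → coeff n f w)
coeff-linear zero [] = record { cong = λ eq → eq ; add = λ _ _ → ≡.refl ; zero# = ≡.refl ; -1#* = λ _ → ≡.refl }
coeff-linear (suc n) (k ∷ w) = record
  { cong  = λ f≋g → C.cong (f≋g k)
  ; add   = λ f g → C.add (f k) (g k)
  ; zero# = C.zero#
  ; -1#*  = λ f → ≡.trans (C.cong (E.-1#* f)) (C.-1#* (f k))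
  }
  where
  module C = LinearMaps.IsLinear (coeff-linear n w)
  module E = LinearMaps.IsLinear (evaluation-linear (powerSeries n) k)

module _ (R : CommutativeRing 0ℓ 0ℓ) where
  private
    module R = CommutativeRing R
    module AR = Alternants R
    module P = CommutativeRing (PowerSeries.powerSeriesRing R)
    module AP = Alternants (PowerSeries.powerSeriesRing R)
  open PowerSeries R
  open import Algebra.Properties.Semiring.Exp R.semiring using (_^_)
  open import Algebra.Properties.Semiring.Exp P.semiring using () renaming (_^_ to _^ₚ_)
  open LinearMaps.IsLinear (constant-linear R)
  open import Relation.Binary.Reasoning.Setoid P.setoid

  constant-* : ∀ a b → constant (a R.* b) P.≈ constant a P.* constant b
  constant-* a b k = R.sym (R.trans (constant-⋆ a (constant b) k) (at k))
    where
    at : ∀ k → a R.* constant b k R.≈ constant (a R.* b) k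
    at zero    = R.refl
    at (suc k) = R.zeroʳ a

  constant-^ : ∀ a e → constant (a ^ e) P.≈ constant a ^ₚ e
  constant-^ a zero    = P.refl
  constant-^ a (suc e) = begin
    constant (a R.* a ^ e)              ≈⟨ constant-* a (a ^ e) ⟩
    constant a P.* constant (a ^ e)     ≈⟨ P.*-congˡ {x = constant a} (constant-^ a e) ⟩
    constant a P.* (constant a ^ₚ e)    ∎

  constant-monomial : ∀ a e b → constant (a ^ e R.* b) P.≈ (constant a ^ₚ e) P.* constant b
  constant-monomial a e b = begin
    constant (a ^ e R.* b)            ≈⟨ constant-* (a ^ e) b ⟩
    constant (a ^ e) P.* constant b   ≈⟨ P.*-congʳ {x = constant b} (constant-^ a e) ⟩
    (constant a ^ₚ e) P.* constant b  ∎

  -- In the iterated ring all variables but the first are constants, so the cofactors of an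
  -- expansion along the first variable are constants too.
  alternant-constant : ∀ {n} (l : Vec ℕ n) xs → AP.alternant l (Vec.map constant xs) P.≈ constant (AR.alternant l xs)
  alternant-constant l []       = P.refl
  alternant-constant l (x ∷ xs) = begin
    AP.laplace (λ e r → (constant x ^ₚ e) P.* AP.alternant r (Vec.map constant xs)) l
      ≈⟨ AP.laplace-cong l (λ e r → P.*-congˡ {x = constant x ^ₚ e} (alternant-constant r xs)) ⟩
    AP.laplace (λ e r → (constant x ^ₚ e) P.* constant (AR.alternant r xs)) l
      ≈⟨ AP.laplace-cong l (λ e r → constant-monomial x e (AR.alternant r xs)) ⟨
    AP.laplace (λ e r → constant (x ^ e R.* AR.alternant r xs)) l
      ≈⟨ laplace-map _ l ⟨
    constant (AR.alternant l (x ∷ xs)) ∎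

  schurPolynomial-constant : ∀ {n} (κ : Vec ℕ n) xs →
    AP.schurPolynomial κ (Vec.map constant xs) P.≈ constant (AR.schurPolynomial κ xs)
  schurPolynomial-constant κ []       = P.refl
  schurPolynomial-constant κ (x ∷ xs) = begin
    AP.Σ[ interlacings κ ] (λ λ′ → (constant x ^ₚ e λ′) P.* AP.schurPolynomial λ′ (Vec.map constant xs))
      ≈⟨ AP.Σ-cong (interlacings κ) (λ λ′ → P.*-congˡ {x = constant x ^ₚ e λ′} (schurPolynomial-constant λ′ xs)) ⟩
    AP.Σ[ interlacings κ ] (λ λ′ → (constant x ^ₚ e λ′) P.* constant (AR.schurPolynomial λ′ xs))
      ≈⟨ AP.Σ-cong (interlacings κ) (λ λ′ → constant-monomial x (e λ′) (AR.schurPolynomial λ′ xs)) ⟨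
    AP.Σ[ interlacings κ ] (λ λ′ → constant (x ^ e λ′ R.* AR.schurPolynomial λ′ xs))
      ≈⟨ Σ-map (interlacings κ) _ ⟨
    constant (AR.schurPolynomial κ (x ∷ xs)) ∎
    where
    e : Vec ℕ _ → ℕ
    e λ′ = Vec.sum κ ℕ.∸ Vec.sum λ′

variables : ∀ n → Vec ⟪ n ⟫ n
variables zero    = []
variables (suc n) = PowerSeries.variableX (powerSeries n) ∷ Vec.map (PowerSeries.constant (powerSeries n)) (variables n)

module _ (n : ℕ) where
  private
    module P = CommutativeRing (powerSeries n)
    module P⁺ = CommutativeRing (powerSeries (suc n))
    module A = Alternants (powerSeries n)
    module A⁺ = Alternants (powerSeries (suc n))
    module Aℤ = Alternants ℤ.+-*-commutativeRing
    module Mℤ = PowerSeries ℤ.+-*-commutativeRing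
  open PowerSeries (powerSeries n)
  open import Algebra.Properties.Semiring.Exp P⁺.semiring using (_^_)

  coeff-monomial : ∀ e a k w → coeff n (monomial e a k) w ≡ Mℤ.monomial e (coeff n a w) k
  coeff-monomial zero    a zero    w = ≡.refl
  coeff-monomial zero    a (suc k) w = LinearMaps.IsLinear.zero# (coeff-linear n w)
  coeff-monomial (suc e) a zero    w = LinearMaps.IsLinear.zero# (coeff-linear n w)
  coeff-monomial (suc e) a (suc k) w = coeff-monomial e a k w

  private
    coeff-variableX : ∀ e {f a} → f P⁺.≈ constant a → ∀ k w →
      coeff (suc n) ((variableX ^ e) P⁺.* f) (k ∷ w) ≡ Mℤ.monomial e (coeff n a w) k
    coeff-variableX e {f} {a} f≋a k w = ≡.trans
      (LinearMaps.IsLinear.cong (coeff-linear n w)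
        (P.trans (P⁺.*-congˡ {x = variableX ^ e} f≋a k) (variableX^-constant e a k)))
      (coeff-monomial e a k w)

  -- The first variable occurs in a term of the expansion only as its `e`-th power, so only the
  -- terms with e = k can contribute.
  coeff-alternant : ∀ l k w → coeff (suc n) (A⁺.alternant l (variables (suc n))) (k ∷ w)
    ≡ Aℤ.laplace (λ e r → Mℤ.monomial e (coeff n (A.alternant r (variables n)) w) k) l
  coeff-alternant l k w = ≡.trans (LinearMaps.IsLinear.laplace-map (coeff-linear (suc n) (k ∷ w)) _ l)
    (Aℤ.laplace-cong l λ e r → coeff-variableX e (alternant-constant (powerSeries n) r (variables n)) k w)

  coeff-schurPolynomial : ∀ κ k w → coeff (suc n) (A⁺.schurPolynomial κ (variables (suc n))) (k ∷ w)
    ≡ Aℤ.Σ[ interlacings κ ] (λ λ′ → Mℤ.monomial (Vec.sum κ ℕ.∸ Vec.sum λ′) (coeff n (A.schurPolynomial λ′ (variables n)) w) k)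
  coeff-schurPolynomial κ k w = ≡.trans (LinearMaps.IsLinear.Σ-map (coeff-linear (suc n) (k ∷ w)) (interlacings κ) _)
    (Aℤ.Σ-cong (interlacings κ) λ λ′ → coeff-variableX (Vec.sum κ ℕ.∸ Vec.sum λ′) (schurPolynomial-constant (powerSeries n) λ′ (variables n)) k w)

-- Lists without repetitions

private
  variable
    A B : Set

∈-concatMap : {f : A → List B} {x : A} {xs : List A} {y : B} → x ∈ xs → y ∈ f x → y ∈ concatMap f xs
∈-concatMap {f = f} x∈xs y∈fx = ∈-concatMap⁺ f (lose x∈xs y∈fx)

∈-concatMap-∃ : (f : A → List B) (xs : List A) {y : B} → y ∈ concatMap f xs → ∃ λ x → x ∈ xs × y ∈ f x
∈-concatMap-∃ f xs y∈ = Membership.find (∈-concatMap⁻ f {xs = xs} y∈)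

-- The pigeonhole principle: delete one occurrence of the image of the head from `ys`. By
-- injectivity the images of the other elements remain.
injection-length : (f : A → B) {xs : List A} {ys : List B} → Unique xs → (∀ {x} → x ∈ xs → f x ∈ ys) →
  (∀ {x y} → x ∈ xs → y ∈ xs → f x ≡ f y → x ≡ y) → length xs ℕ.≤ length ys
injection-length f {[]}     _           f∈ inj = z≤n
injection-length f {x ∷ xs} (x∉ ∷ xs!) f∈ inj
  with as , bs , ≡.refl ← ∈-∃++ (f∈ (here ≡.refl)) = begin
    suc (length xs)              ≤⟨ s≤s (injection-length f xs! f∈′ λ p q → inj (there p) (there q)) ⟩
    suc (length (as ++ bs))      ≡⟨ List.length-++-sucʳ as (f x) bs ⟨
    length (as ++ f x ∷ bs)      ∎
  where
  open ℕ.≤-Reasoning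
  f∈′ : ∀ {y} → y ∈ xs → f y ∈ as ++ bs
  f∈′ {y} y∈ with ∈-++⁻ as (f∈ (there y∈))
  ... | inj₁ ∈as          = ∈-++⁺ˡ ∈as
  ... | inj₂ (here fy≡fx) = contradiction (inj (here ≡.refl) (there y∈) (≡.sym fy≡fx)) (All.lookup x∉ y∈)
  ... | inj₂ (there ∈bs)  = ∈-++⁺ʳ as ∈bs

⊆-length : {xs ys : List A} → Unique xs → (∀ {x} → x ∈ xs → x ∈ ys) → length xs ℕ.≤ length ys
⊆-length xs! xs⊆ys = injection-length id xs! xs⊆ys λ _ _ → id

map-unique : (f : A → B) {xs : List A} → Unique xs → (∀ {x y} → x ∈ xs → y ∈ xs → f x ≡ f y → x ≡ y) → Unique (map f xs)
map-unique f []           inj = []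
map-unique f (x∉ ∷ xs!) inj =
  All.map⁺ (All.tabulate λ y∈ fx≡fy → All.lookup x∉ y∈ (inj (here ≡.refl) (there y∈) fx≡fy))
    ∷ map-unique f xs! λ p q → inj (there p) (there q)

concatMap-unique : (f : A → List B) {xs : List A} → Unique xs → (∀ {x} → x ∈ xs → Unique (f x)) →
  (∀ {x y z} → x ∈ xs → y ∈ xs → z ∈ f x → z ∈ f y → x ≡ y) → Unique (concatMap f xs)
concatMap-unique f {[]}     _          _   _        = []
concatMap-unique f {x ∷ xs} (x∉ ∷ xs!) fx! disjoint =
  Unique.++⁺ (fx! (here ≡.refl))
    (concatMap-unique f xs! (fx! ∘ there) λ p q → disjoint (there p) (there q))
    λ (z∈fx , z∈rest) → let y , y∈ , z∈fy = ∈-concatMap-∃ f xs z∈rest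
                        in All.lookup x∉ y∈ (disjoint (here ≡.refl) (there y∈) z∈fx z∈fy)

-- Tableaux and interlacing vectors

Row : ℕ → Set
Row n = List (Fin n)

-- Empty rows are kept, so that a shape padded with zeros determines the number of rows as well.
data HasShape {n} : ∀ {m} → Tableau n → Vec ℕ m → Set where
  []  : HasShape [] []
  _∷_ : ∀ {m r k T} {κ : Vec ℕ m} → length r ≡ k → HasShape T κ → HasShape (r ∷ T) (k ∷ κ)

hasShape-unique : ∀ {n m} {T : Tableau n} {κ κ′ : Vec ℕ m} → HasShape T κ → HasShape T κ′ → κ ≡ κ′
hasShape-unique []           []            = ≡.refl
hasShape-unique (≡.refl ∷ s) (≡.refl ∷ s′) = ≡.cong (_ ∷_) (hasShape-unique s s′)

IsTableau : ∀ {n} → Vec ℕ n → Vec ℕ n → Tableau n → Set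
IsTableau κ w T = HasShape T κ × Semistandard T × content T ≡ Vec.reverse w

extendRow : ∀ {n} → ℕ → Row n → Row (suc n)
extendRow k r = map inject₁ r ++ replicate (k ℕ.∸ length r) (fromℕ _)

extend : ∀ {n m} → Vec ℕ m → Tableau n → Tableau (suc n)
extend []      T       = []
extend (k ∷ κ) []      = extendRow k [] ∷ extend κ []
extend (k ∷ κ) (r ∷ T) = extendRow k r ∷ extend κ T

-- The first entry of w is the multiplicity of the last letter: the content of
-- these tableaux is the reverse of w.
tableaux : ∀ {n} → Vec ℕ n → Vec ℕ n → List (Tableau n)
tableaux {zero}  []  []      = [] ∷ []
tableaux {suc n} κ   (k ∷ w) = concatMap (λ λ′ → map (extend κ) (tableaux λ′ w))
  (filter (λ λ′ → Vec.sum κ ℕ.∸ Vec.sum λ′ ℕ.≟ k) (interlacings κ))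

kostka : ∀ {n} → Vec ℕ n → Vec ℕ n → ℕ
kostka κ w = length (tableaux κ w)

-- Adding the last letter

length-extendRow : ∀ {n} k (r : Row n) → length r ℕ.≤ k → length (extendRow k r) ≡ k
length-extendRow k r r≤k = begin
  length (map inject₁ r ++ replicate (k ℕ.∸ length r) (fromℕ _))                ≡⟨ List.length-++ (map inject₁ r) ⟩
  length (map inject₁ r) ℕ.+ length (replicate (k ℕ.∸ length r) (fromℕ _))      ≡⟨ ≡.cong₂ ℕ._+_ (List.length-map inject₁ r) (List.length-replicate _) ⟩
  length r ℕ.+ (k ℕ.∸ length r)                                                  ≡⟨ ℕ.m+[n∸m]≡n r≤k ⟩
  k                                                                              ∎
  where open ≡.≡-Reasoning

extend-shape : ∀ {n m} {κ : Vec ℕ (suc m)} {λ′} {T : Tableau n} → Interlaces κ λ′ → HasShape T λ′ → HasShape (extend κ T) κ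
extend-shape last                    []           = length-extendRow _ [] z≤n ∷ []
extend-shape (cons {x = x} _ i≤x ks) (_∷_ {r = r} ≡.refl s) = length-extendRow x r i≤x ∷ extend-shape ks s

replicate-weaklyIncreasing : ∀ {n} m (x : Fin n) → Linked Fin._≤_ (replicate m x)
replicate-weaklyIncreasing zero          x = []
replicate-weaklyIncreasing (suc zero)    x = [-]
replicate-weaklyIncreasing (suc (suc m)) x = Fin.≤-refl ∷ replicate-weaklyIncreasing (suc m) x

inject₁≤top : ∀ {n} (x : Fin n) → inject₁ x Fin.≤ fromℕ n
inject₁≤top x = Fin.≤fromℕ (inject₁ x)

extendRow-weaklyIncreasing : ∀ {n} m {r : Row n} → Linked Fin._≤_ r → Linked Fin._≤_ (map inject₁ r ++ replicate m (fromℕ n))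
extendRow-weaklyIncreasing m       []  = replicate-weaklyIncreasing m _
extendRow-weaklyIncreasing zero    [-] = [-]
extendRow-weaklyIncreasing (suc m) ([-] {x}) = inject₁≤top x ∷ replicate-weaklyIncreasing (suc m) _
extendRow-weaklyIncreasing m (_∷_ {x} {y} x≤y r↑) =
  ≡.subst₂ ℕ._≤_ (≡.sym (Fin.toℕ-inject₁ x)) (≡.sym (Fin.toℕ-inject₁ y)) x≤y ∷ extendRow-weaklyIncreasing m r↑

inject₁<top : ∀ {n} (x : Fin n) → inject₁ x Fin.< fromℕ n
inject₁<top {n} x = ≡.subst₂ ℕ._<_ (≡.sym (Fin.toℕ-inject₁ x)) (≡.sym (Fin.toℕ-fromℕ n)) (Fin.toℕ<n x)

-- The copies of the last letter added to the lower row must end below old entries of the upper row.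
-- The bound on `m` is the horizontal strip condition, one half of interlacing.
extendRow-columnStrict : ∀ {n} {r₁ r₂ : Row n} m {rest} → ColumnStrict r₁ r₂ → m ℕ.≤ length r₁ ℕ.∸ length r₂ →
  ColumnStrict (map inject₁ r₁ ++ rest) (map inject₁ r₂ ++ replicate m (fromℕ n))
extendRow-columnStrict zero    []                              m≤ = []
extendRow-columnStrict {r₁ = x ∷ r₁} (suc m) []                m≤ = inject₁<top x ∷ extendRow-columnStrict {r₁ = r₁} m [] (ℕ.s≤s⁻¹ m≤)
extendRow-columnStrict m       (_∷_ {a = a} {b} a>b r₂≻r₁)    m≤ =
  ≡.subst₂ ℕ._<_ (≡.sym (Fin.toℕ-inject₁ b)) (≡.sym (Fin.toℕ-inject₁ a)) a>b ∷ extendRow-columnStrict m r₂≻r₁ m≤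

extend-semistandard : ∀ {n m} {κ : Vec ℕ (suc m)} {λ′} {T : Tableau n} → Interlaces κ λ′ → HasShape T λ′ →
  Semistandard T → Semistandard (extend κ T)
extend-semistandard {κ = k ∷ _} last [] _ = extendRow-weaklyIncreasing k [] ∷ [] , [-]
extend-semistandard (cons y≤i i≤x last) (_∷_ {r = r} ≡.refl []) (r↑ ∷ _ , _) =
  extendRow-weaklyIncreasing _ r↑ ∷ extendRow-weaklyIncreasing _ [] ∷ [] , extendRow-columnStrict {r₁ = r} _ [] y≤i ∷ [-]
extend-semistandard (cons {x = x} {y} y≤i i≤x ks@(cons _ _ _)) (_∷_ {r = r} ≡.refl s@(_∷_ {r = r′} ≡.refl _)) (r↑ ∷ T↑ , r≺r′ ∷ T≺) =
  let T↑′ , T≺′ = extend-semistandard ks s (T↑ , T≺)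
  in extendRow-weaklyIncreasing _ r↑ ∷ T↑′ , extendRow-columnStrict _ r≺r′ (ℕ.∸-monoˡ-≤ (length r′) y≤i) ∷ T≺′

multiplicity : ∀ {n} → Fin n → List (Fin n) → ℕ
multiplicity i xs = length (filter (i Fin.≟_) xs)

multiplicity-++ : ∀ {n} (i : Fin n) xs ys → multiplicity i (xs ++ ys) ≡ multiplicity i xs ℕ.+ multiplicity i ys
multiplicity-++ i xs ys = ≡.trans (≡.cong length (List.filter-++ (i Fin.≟_) xs ys)) (List.length-++ (filter (i Fin.≟_) xs))

multiplicity-inject₁ : ∀ {n} (i : Fin n) xs → multiplicity (inject₁ i) (map inject₁ xs) ≡ multiplicity i xs
multiplicity-inject₁ i []       = ≡.refl
multiplicity-inject₁ i (x ∷ xs) with i Fin.≟ x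
... | yes ≡.refl = ≡.trans (≡.cong length (List.filter-accept (inject₁ i Fin.≟_) ≡.refl)) (≡.cong suc (multiplicity-inject₁ i xs))
... | no i≢x     = ≡.trans (≡.cong length (List.filter-reject (inject₁ i Fin.≟_) (i≢x ∘ Fin.inject₁-injective))) (multiplicity-inject₁ i xs)

multiplicity-absent : ∀ {n} {i : Fin n} {xs} → All (i ≢_) xs → multiplicity i xs ≡ 0
multiplicity-absent {i = i} i∉xs = ≡.cong length (List.filter-none (i Fin.≟_) i∉xs)

multiplicity-replicate : ∀ {n} (i : Fin n) m → multiplicity i (replicate m i) ≡ m
multiplicity-replicate i m = ≡.trans (≡.cong length (List.filter-all (i Fin.≟_) (All.replicate⁺ m ≡.refl))) (List.length-replicate m)

multiplicity-extendRow-inject₁ : ∀ {n} (i : Fin n) k r → multiplicity (inject₁ i) (extendRow k r) ≡ multiplicity i r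
multiplicity-extendRow-inject₁ i k r = begin
  multiplicity (inject₁ i) (extendRow k r)
    ≡⟨ multiplicity-++ (inject₁ i) (map inject₁ r) _ ⟩
  multiplicity (inject₁ i) (map inject₁ r) ℕ.+ multiplicity (inject₁ i) (replicate (k ℕ.∸ length r) (fromℕ _))
    ≡⟨ ≡.cong₂ ℕ._+_ (multiplicity-inject₁ i r) (multiplicity-absent {i = inject₁ i} {xs = replicate (k ℕ.∸ length r) (fromℕ _)} (All.replicate⁺ _ (Fin.fromℕ≢inject₁ ∘ ≡.sym))) ⟩
  multiplicity i r ℕ.+ 0 ≡⟨ ℕ.+-identityʳ _ ⟩
  multiplicity i r ∎
  where open ≡.≡-Reasoning

multiplicity-extendRow-top : ∀ {n} k (r : Row n) → multiplicity (fromℕ n) (extendRow k r) ≡ k ℕ.∸ length r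
multiplicity-extendRow-top k r = ≡.trans (multiplicity-++ (fromℕ _) (map inject₁ r) _)
  (≡.cong₂ ℕ._+_ (multiplicity-absent (All.map⁺ (All.universal (λ _ → Fin.fromℕ≢inject₁) r))) (multiplicity-replicate _ _))

multiplicity-extend-inject₁ : ∀ {n m} (i : Fin n) (κ : Vec ℕ (suc m)) {λ′ T} → Interlaces κ λ′ → HasShape T λ′ →
  multiplicity (inject₁ i) (concat (extend κ T)) ≡ multiplicity i (concat T)
multiplicity-extend-inject₁ i (k ∷ []) last [] =
  ≡.trans (≡.cong (multiplicity (inject₁ i)) (List.++-identityʳ (extendRow k []))) (multiplicity-extendRow-inject₁ i k [])
multiplicity-extend-inject₁ i (k ∷ κ) {T = r ∷ T} (cons _ _ ks) (≡.refl ∷ s) = begin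
  multiplicity (inject₁ i) (extendRow k r ++ concat (extend κ T))
    ≡⟨ multiplicity-++ (inject₁ i) (extendRow k r) _ ⟩
  multiplicity (inject₁ i) (extendRow k r) ℕ.+ multiplicity (inject₁ i) (concat (extend κ T))
    ≡⟨ ≡.cong₂ ℕ._+_ (multiplicity-extendRow-inject₁ i k r) (multiplicity-extend-inject₁ i κ ks s) ⟩
  multiplicity i r ℕ.+ multiplicity i (concat T) ≡⟨ multiplicity-++ i r (concat T) ⟨
  multiplicity i (r ++ concat T) ∎
  where open ≡.≡-Reasoning

multiplicity-extend-top : ∀ {n m} (κ : Vec ℕ (suc m)) {λ′} {T : Tableau n} → Interlaces κ λ′ → HasShape T λ′ →
  multiplicity (fromℕ n) (concat (extend κ T)) ℕ.+ Vec.sum λ′ ≡ Vec.sum κ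
multiplicity-extend-top {n} (k ∷ []) last [] = ≡.cong (ℕ._+ 0)
  (≡.trans (≡.cong (multiplicity (fromℕ n)) (List.++-identityʳ (extendRow k []))) (multiplicity-extendRow-top k []))
multiplicity-extend-top {n} (k ∷ κ) {i ∷ λ′} {T = r ∷ T} (cons _ r≤k ks) (≡.refl ∷ s) = begin
  multiplicity (fromℕ n) (extendRow k r ++ concat (extend κ T)) ℕ.+ (i ℕ.+ Vec.sum λ′)
    ≡⟨ ≡.cong (ℕ._+ (i ℕ.+ Vec.sum λ′)) (multiplicity-++ (fromℕ n) (extendRow k r) _) ⟩
  multiplicity (fromℕ n) (extendRow k r) ℕ.+ multiplicity (fromℕ n) (concat (extend κ T)) ℕ.+ (i ℕ.+ Vec.sum λ′)
    ≡⟨ lemma (multiplicity (fromℕ n) (extendRow k r)) _ i _ ⟩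
  (multiplicity (fromℕ n) (extendRow k r) ℕ.+ i) ℕ.+ (multiplicity (fromℕ n) (concat (extend κ T)) ℕ.+ Vec.sum λ′)
    ≡⟨ ≡.cong₂ ℕ._+_ (≡.trans (≡.cong (ℕ._+ i) (multiplicity-extendRow-top k r)) (ℕ.m∸n+n≡m r≤k)) (multiplicity-extend-top κ ks s) ⟩
  k ℕ.+ Vec.sum κ ∎
  where
  open ≡.≡-Reasoning
  lemma : ∀ a b c d → a ℕ.+ b ℕ.+ (c ℕ.+ d) ≡ (a ℕ.+ c) ℕ.+ (b ℕ.+ d)
  lemma = solve-∀

tabulate-∷ʳ : ∀ {n} {A : Set} (f : Fin (suc n) → A) → Vec.tabulate f ≡ Vec.tabulate (f ∘ inject₁) ∷ʳ f (fromℕ n)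
tabulate-∷ʳ {zero}  f = ≡.refl
tabulate-∷ʳ {suc n} f = ≡.cong (f zero ∷_) (tabulate-∷ʳ (f ∘ suc))

extend-content : ∀ {n m} {κ : Vec ℕ (suc m)} {λ′} {T : Tableau n} → Interlaces κ λ′ → HasShape T λ′ →
  content (extend κ T) ≡ content T ∷ʳ (Vec.sum κ ℕ.∸ Vec.sum λ′)
extend-content {n} {κ = κ} {λ′} {T} ks s = ≡.trans (tabulate-∷ʳ λ i → multiplicity i (concat (extend κ T)))
  (≡.cong₂ _∷ʳ_ (Vec.tabulate-cong λ i → multiplicity-extend-inject₁ i κ ks s)
    (≡.trans (≡.sym (ℕ.m+n∸n≡m _ (Vec.sum λ′))) (≡.cong (ℕ._∸ Vec.sum λ′) (multiplicity-extend-top κ ks s))))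

extend-isTableau : ∀ {n} {κ : Vec ℕ (suc n)} {λ′ w T} → Interlaces κ λ′ → IsTableau λ′ w T →
  IsTableau κ (Vec.sum κ ℕ.∸ Vec.sum λ′ ∷ w) (extend κ T)
extend-isTableau {w = w} ks (s , ss , c) =
  extend-shape ks s , extend-semistandard ks s ss ,
  ≡.trans (extend-content ks s) (≡.trans (≡.cong (_∷ʳ _) c) (≡.sym (Vec.reverse-∷ _ w)))

-- Removing the last letter

-- Cutting at the first occurrence of the last letter removes all of its occurrences from a weakly
-- increasing row.
strip : ∀ {n} → Row (suc n) → Row n
strip []      = []
strip (x ∷ r) with view x
... | ‵fromℕ         = []
... | ‵inj₁ {i = i} _ = i ∷ strip r

stripRows : ∀ {n} → Tableau (suc n) → Tableau n
stripRows []           = []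
stripRows (r ∷ [])     = []
stripRows (r ∷ r′ ∷ T) = strip r ∷ stripRows (r′ ∷ T)

strip-extendRow : ∀ {n} m (r : Row n) → strip (map inject₁ r ++ replicate m (fromℕ n)) ≡ r
strip-extendRow zero    [] = ≡.refl
strip-extendRow {n} (suc m) [] rewrite view-fromℕ n = ≡.refl
strip-extendRow m (x ∷ r) rewrite view-inject₁ x = ≡.cong (x ∷_) (strip-extendRow m r)

stripRows-extend : ∀ {n m} {κ : Vec ℕ (suc m)} {λ′} {T : Tableau n} → Interlaces κ λ′ → HasShape T λ′ → stripRows (extend κ T) ≡ T
stripRows-extend last [] = ≡.refl
stripRows-extend (cons {x = x} _ _ last) (_∷_ {r = r} ≡.refl []) = ≡.cong (_∷ []) (strip-extendRow (x ℕ.∸ length r) r)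
stripRows-extend (cons {x = x} _ _ ks@(cons _ _ _)) (_∷_ {r = r} ≡.refl s@(≡.refl ∷ _)) =
  ≡.cong₂ _∷_ (strip-extendRow (x ℕ.∸ length r) r) (stripRows-extend ks s)

top≤⇒≡top : ∀ {n} (x : Fin (suc n)) → n ℕ.≤ toℕ x → x ≡ fromℕ n
top≤⇒≡top {n} x n≤x = Fin.toℕ-injective (≡.trans (ℕ.≤-antisym (Fin.toℕ≤pred[n] x) n≤x) (≡.sym (Fin.toℕ-fromℕ n)))

all-top : ∀ {n} {r : Row (suc n)} → All (λ x → n ℕ.≤ toℕ x) r → r ≡ replicate (length r) (fromℕ n)
all-top []         = ≡.refl
all-top (n≤x ∷ ps) = ≡.cong₂ _∷_ (top≤⇒≡top _ n≤x) (all-top ps)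

weaklyIncreasing-top : ∀ {n} {r : Row (suc n)} → Linked Fin._≤_ (fromℕ n ∷ r) → All (λ x → n ℕ.≤ toℕ x) r
weaklyIncreasing-top [-]       = []
weaklyIncreasing-top {n} (_∷_ {y = y} n≤y r↑) with ≡.refl ← top≤⇒≡top y (≡.subst (ℕ._≤ toℕ y) (Fin.toℕ-fromℕ n) n≤y) =
  ℕ.≤-reflexive (≡.sym (Fin.toℕ-fromℕ n)) ∷ weaklyIncreasing-top r↑

extendRow-strip : ∀ {n} (r : Row (suc n)) → Linked Fin._≤_ r → extendRow (length r) (strip r) ≡ r
extendRow-strip []      _  = ≡.refl
extendRow-strip (x ∷ r) r↑ with view x
... | ‵fromℕ  = ≡.sym (all-top (ℕ.≤-reflexive (≡.sym (Fin.toℕ-fromℕ _)) ∷ weaklyIncreasing-top r↑))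
... | ‵inj₁ _ = ≡.cong (inject₁ _ ∷_) (extendRow-strip r (Linked.tail r↑))

strip-length : ∀ {n} (r : Row (suc n)) → length (strip r) ℕ.≤ length r
strip-length []      = z≤n
strip-length (x ∷ r) with view x
... | ‵fromℕ  = z≤n
... | ‵inj₁ _ = s≤s (strip-length r)

strip-weaklyIncreasing : ∀ {n} {r : Row (suc n)} → Linked Fin._≤_ r → Linked Fin._≤_ (strip r)
strip-weaklyIncreasing []  = []
strip-weaklyIncreasing ([-] {x}) with view x
... | ‵fromℕ  = []
... | ‵inj₁ _ = [-]
strip-weaklyIncreasing (_∷_ {x} {y} x≤y r↑) with view x
... | ‵fromℕ          = []
... | ‵inj₁ {i = i} _ with view y | strip-weaklyIncreasing r↑
...   | ‵fromℕ          | _   = [-]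
...   | ‵inj₁ {i = j} _ | r↑′ = ≡.subst₂ ℕ._≤_ (Fin.toℕ-inject₁ i) (Fin.toℕ-inject₁ j) x≤y ∷ r↑′

≮top : ∀ {n} {y : Fin (suc n)} → fromℕ n Fin.< y → ∀ {A : Set} → A
≮top {y = y} n<y = contradiction (ℕ.<-≤-trans n<y (Fin.≤fromℕ y)) (ℕ.<-irrefl ≡.refl)

strip-columnStrict : ∀ {n} {r r′ : Row (suc n)} → ColumnStrict r r′ → ColumnStrict (strip r) (strip r′)
strip-columnStrict []  = []
strip-columnStrict (_∷_ {a = a} {b} b<a ps) with view a | view b
... | ‵fromℕ          | _               = []
... | ‵inj₁ _         | ‵fromℕ          = ≮top b<a
... | ‵inj₁ {i = i} _ | ‵inj₁ {i = j} _ = ≡.subst₂ ℕ._<_ (Fin.toℕ-inject₁ j) (Fin.toℕ-inject₁ i) b<a ∷ strip-columnStrict ps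

-- An entry with another one below it cannot be the last letter. This gives the lower bound in the
-- interlacing condition.
columnStrict-length : ∀ {n} {r r′ : Row (suc n)} → ColumnStrict r r′ → length r′ ℕ.≤ length (strip r)
columnStrict-length []  = z≤n
columnStrict-length (_∷_ {b = b} b<a ps) with view b
... | ‵fromℕ  = ≮top b<a
... | ‵inj₁ _ = s≤s (columnStrict-length ps)

columnStrict-bound : ∀ {n b} {r r′ : Row n} → ColumnStrict r r′ → All (λ x → b ℕ.≤ toℕ x) r → All (λ x → suc b ℕ.≤ toℕ x) r′
columnStrict-bound []         _          = []
columnStrict-bound (x<y ∷ ps) (b≤x ∷ bs) = ℕ.≤-<-trans b≤x x<y ∷ columnStrict-bound ps bs

-- As the columns increase strictly, the entries of row b are at least b; in the
-- last row only the last letter is left.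
stripRows-isTableau : ∀ {n m} b → n ≡ b ℕ.+ m → {κ : Vec ℕ (suc m)} {T : Tableau (suc n)} → HasShape T κ → Semistandard T →
  All (λ x → b ℕ.≤ toℕ x) (concat (List.take 1 T)) →
  ∃ λ λ′ → Interlaces κ λ′ × HasShape (stripRows T) λ′ × Semistandard (stripRows T) × extend κ (stripRows T) ≡ T
stripRows-isTableau {m = zero} b n≡ (_∷_ {r = r} ≡.refl []) _ b≤ =
  [] , last , [] , ([] , []) , ≡.cong (_∷ []) (≡.sym (all-top (All.map (ℕ.≤-trans (ℕ.≤-reflexive (≡.trans n≡ (ℕ.+-identityʳ b))))
    (≡.subst (All _) (List.++-identityʳ r) b≤))))
stripRows-isTableau {m = suc m} b n≡ (_∷_ {r = r} ≡.refl s@(_∷_ {r = r′} {T = T} ≡.refl _)) (r↑ ∷ T↑ , r≺r′ ∷ T≺) b≤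
  with λ′ , ks , s′ , (T↑′ , T≺′) , eq ← stripRows-isTableau (suc b) (≡.trans n≡ (ℕ.+-suc b m)) s (T↑ , T≺)
         (≡.subst (All _) (≡.sym (List.++-identityʳ r′)) (columnStrict-bound r≺r′ (≡.subst (All _) (List.++-identityʳ r) b≤)))
  = length (strip r) ∷ λ′ , cons (columnStrict-length r≺r′) (strip-length r) ks , ≡.refl ∷ s′ ,
    (strip-weaklyIncreasing r↑ ∷ T↑′ , prepend T r≺r′ T≺′) , ≡.cong₂ _∷_ (extendRow-strip r r↑) eq
  where
  prepend : ∀ T → ColumnStrict r r′ → Linked ColumnStrict (stripRows (r′ ∷ T)) → Linked ColumnStrict (strip r ∷ stripRows (r′ ∷ T))
  prepend []      _  _  = [-]
  prepend (_ ∷ _) r≺ T≺ = strip-columnStrict r≺ ∷ T≺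

∈-tableaux⁻ : ∀ {n} {κ w : Vec ℕ n} {T} → Decreasing κ → T ∈ tableaux κ w → IsTableau κ w T
∈-tableaux⁻ {zero}  {[]} {[]}    _  (here ≡.refl) = [] , ([] , []) , ≡.refl
∈-tableaux⁻ {suc n} {κ}  {k ∷ w} κ↓ T∈
  with λ′ , λ∈ , T∈′ ← ∈-concatMap-∃ (λ λ′ → map (extend κ) (tableaux λ′ w)) _ T∈
  with λ∈′ , ≡.refl ← ∈-filter⁻ (λ λ′ → Vec.sum κ ℕ.∸ Vec.sum λ′ ℕ.≟ k) {xs = interlacings κ} λ∈
  with T′ , T′∈ , ≡.refl ← ∈-map⁻ (extend κ) T∈′
  = let ks = ∈-interlacings⁻ κ↓ λ∈′ in extend-isTableau {w = w} ks (∈-tableaux⁻ (interlaces-decreasing ks) T′∈)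

∈-tableaux⁺ : ∀ {n} {κ w : Vec ℕ n} {T} → IsTableau κ w T → T ∈ tableaux κ w
∈-tableaux⁺ {zero}  {[]} {[]}    ([] , _) = here ≡.refl
∈-tableaux⁺ {suc n} {κ}  {k ∷ w} {T} (s , ss , c)
  with λ′ , ks , s′ , ss′ , eq ← stripRows-isTableau 0 ≡.refl s ss (All.universal (λ _ → z≤n) _)
  with c′ , ≡.refl ← Vec.∷ʳ-injective (content (stripRows T)) (Vec.reverse w)
         (≡.trans (≡.sym (extend-content ks s′)) (≡.trans (≡.cong content eq) (≡.trans c (Vec.reverse-∷ k w))))
  = ∈-concatMap (∈-filter⁺ (λ λ′ → Vec.sum κ ℕ.∸ Vec.sum λ′ ℕ.≟ k) (∈-interlacings⁺ ks) ≡.refl)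
      (≡.subst (_∈ map (extend κ) (tableaux λ′ w)) eq (∈-map⁺ (extend κ) (∈-tableaux⁺ (s′ , ss′ , c′))))

range-unique : ∀ y k → Unique (range y k)
range-unique y zero    = []
range-unique y (suc k) = All.tabulate (λ i∈ y≡i → ℕ.<-irrefl y≡i (proj₁ (∈-range⁻ (suc y) k i∈))) ∷ range-unique (suc y) k

interlacings-unique : ∀ {n} (κ : Vec ℕ (suc n)) → Unique (interlacings κ)
interlacings-unique (x ∷ [])    = [] ∷ []
interlacings-unique (x ∷ y ∷ κ) =
  Unique.cartesianProductWith⁺ _∷_ Vec.∷-injective (range-unique y (suc x ℕ.∸ y)) (interlacings-unique (y ∷ κ))

-- `stripRows` undoes `extend κ`, and a tableau determines its shape; hence tableaux of the same or
-- of different interlacing shapes are extended to different tableaux.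
tableaux-unique : ∀ {n} {κ : Vec ℕ n} → Decreasing κ → ∀ w → Unique (tableaux κ w)
tableaux-unique {zero}  {[]} _  []      = [] ∷ []
tableaux-unique {suc n} {κ}  κ↓ (k ∷ w) = concatMap-unique _
  (Unique.filter⁺ _ (interlacings-unique κ))
  (λ λ∈ → let ks = interlaces λ∈ in map-unique (extend κ) (tableaux-unique (interlaces-decreasing ks) w)
    λ T∈ U∈ eq → extend-injective ks ks (∈-tableaux⁻ (interlaces-decreasing ks) T∈) (∈-tableaux⁻ (interlaces-decreasing ks) U∈) eq)
  same-interlacing
  where
  interlaces : ∀ {λ′} → λ′ ∈ filter (λ λ′ → Vec.sum κ ℕ.∸ Vec.sum λ′ ℕ.≟ k) (interlacings κ) → Interlaces κ λ′
  interlaces λ∈ = ∈-interlacings⁻ κ↓ (proj₁ (∈-filter⁻ (λ λ′ → Vec.sum κ ℕ.∸ Vec.sum λ′ ℕ.≟ k) {xs = interlacings κ} λ∈))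
  extend-injective : ∀ {λ₁ λ₂ T U} → Interlaces κ λ₁ → Interlaces κ λ₂ → IsTableau λ₁ w T → IsTableau λ₂ w U →
    extend κ T ≡ extend κ U → T ≡ U
  extend-injective ks₁ ks₂ (s₁ , _) (s₂ , _) eq =
    ≡.trans (≡.sym (stripRows-extend ks₁ s₁)) (≡.trans (≡.cong stripRows eq) (stripRows-extend ks₂ s₂))
  same-interlacing : ∀ {λ₁ λ₂ T} → λ₁ ∈ filter (λ λ′ → Vec.sum κ ℕ.∸ Vec.sum λ′ ℕ.≟ k) (interlacings κ) →
    λ₂ ∈ filter (λ λ′ → Vec.sum κ ℕ.∸ Vec.sum λ′ ℕ.≟ k) (interlacings κ) →
    T ∈ map (extend κ) (tableaux λ₁ w) → T ∈ map (extend κ) (tableaux λ₂ w) → λ₁ ≡ λ₂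
  same-interlacing λ₁∈ λ₂∈ T∈₁ T∈₂
    with T₁ , T₁∈ , eq₁ ← ∈-map⁻ (extend κ) T∈₁
    with T₂ , T₂∈ , eq₂ ← ∈-map⁻ (extend κ) T∈₂
    = let ks₁ = interlaces λ₁∈
          ks₂ = interlaces λ₂∈
          t₁  = ∈-tableaux⁻ (interlaces-decreasing ks₁) T₁∈
          t₂  = ∈-tableaux⁻ (interlaces-decreasing ks₂) T₂∈
          eq  = extend-injective ks₁ ks₂ t₁ t₂ (≡.trans (≡.sym eq₁) eq₂)
      in hasShape-unique (proj₁ t₁) (≡.subst (λ T → HasShape T _) (≡.sym eq) (proj₁ t₂))

-- Schur functions

pad : ∀ n → List ℕ → Vec ℕ n
pad zero    xs       = []
pad (suc n) []       = 0 ∷ pad n []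
pad (suc n) (x ∷ xs) = x ∷ pad n xs

pad-decreasing : ∀ n {xs} → Linked ℕ._≥_ xs → Decreasing (pad n xs)
pad-decreasing zero          _  = []
pad-decreasing (suc zero)    {[]}    _ = [-]
pad-decreasing (suc zero)    {_ ∷ _} _ = [-]
pad-decreasing (suc (suc n)) []          = z≤n ∷ pad-decreasing (suc n) []
pad-decreasing (suc (suc n)) [-]         = z≤n ∷ pad-decreasing (suc n) []
pad-decreasing (suc (suc n)) (y≤x ∷ xs↓) = y≤x ∷ pad-decreasing (suc n) xs↓

pad-injective : ∀ n {xs ys} → length xs ℕ.≤ n → length ys ℕ.≤ n → All NonZero xs → All NonZero ys → pad n xs ≡ pad n ys → xs ≡ ys
pad-injective n       {[]}     {[]}     _  _  _  _  _ = ≡.refl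
pad-injective (suc n) {x ∷ xs} {y ∷ ys} (s≤s p) (s≤s q) (_ ∷ xs≢0) (_ ∷ ys≢0) eq =
  ≡.cong₂ _∷_ (Vec.∷-injectiveˡ eq) (pad-injective n p q xs≢0 ys≢0 (Vec.∷-injectiveʳ eq))
pad-injective (suc n) {[]}     {y ∷ ys} _ _ _ (y≢0 ∷ _) eq = contradiction (≡.sym (Vec.∷-injectiveˡ eq)) (ℕ.≢-nonZero⁻¹ y {{y≢0}})
pad-injective (suc n) {x ∷ xs} {[]}     _ _ (x≢0 ∷ _) _ eq = contradiction (Vec.∷-injectiveˡ eq) (ℕ.≢-nonZero⁻¹ x {{x≢0}})

pad-sum : ∀ n xs → length xs ℕ.≤ n → Vec.sum (pad n xs) ≡ List.foldr ℕ._+_ 0 xs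
pad-sum zero    []       _       = ≡.refl
pad-sum (suc n) []       _       = pad-sum n [] z≤n
pad-sum (suc n) (x ∷ xs) (s≤s p) = ≡.cong (x ℕ.+_) (pad-sum n xs p)

padRows : ∀ {N} → ℕ → Tableau N → Tableau N
padRows zero    T       = []
padRows (suc n) []      = [] ∷ padRows n []
padRows (suc n) (r ∷ T) = r ∷ padRows n T

module _ {N : ℕ} where

  padRows-shape : ∀ n {T : Tableau N} {xs} → length xs ℕ.≤ n → map length T ≡ xs → HasShape (padRows n T) (pad n xs)
  padRows-shape zero    {[]}    _       ≡.refl = []
  padRows-shape (suc n) {[]}    _       ≡.refl = ≡.refl ∷ padRows-shape n z≤n ≡.refl
  padRows-shape (suc n) {r ∷ T} (s≤s p) ≡.refl = ≡.refl ∷ padRows-shape n p ≡.refl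

  padRows-shape⁻ : ∀ n {T : Tableau N} xs → length xs ℕ.≤ n → HasShape T (pad n xs) → ∃ λ U → map length U ≡ xs × padRows n U ≡ T
  padRows-shape⁻ zero    []       _       []      = [] , ≡.refl , ≡.refl
  padRows-shape⁻ (suc n) []       _       (_∷_ {r = []} ≡.refl s) with padRows-shape⁻ n [] z≤n s
  ... | [] , _ , ≡.refl = [] , ≡.refl , ≡.refl
  padRows-shape⁻ (suc n) (x ∷ xs) (s≤s p) (_∷_ {r = r} ≡.refl s) with U , ≡.refl , ≡.refl ← padRows-shape⁻ n xs p s = r ∷ U , ≡.refl , ≡.refl

  padRows-semistandard : ∀ n {T : Tableau N} → length T ℕ.≤ n → Semistandard T → Semistandard (padRows n T)
  padRows-semistandard zero          {[]} _ _ = [] , []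
  padRows-semistandard (suc zero)    {[]} _ _ = [] ∷ [] , [-]
  padRows-semistandard (suc (suc n)) {[]} _ _ =
    let T↑ , T≺ = padRows-semistandard (suc n) {[]} z≤n ([] , []) in [] ∷ T↑ , [] ∷ T≺
  padRows-semistandard (suc zero)    {r ∷ []} _ (r↑ ∷ [] , _) = r↑ ∷ [] , [-]
  padRows-semistandard (suc zero)    {_ ∷ _ ∷ _} (s≤s ()) _
  padRows-semistandard (suc (suc n)) {r ∷ []} _ (r↑ ∷ [] , _) =
    let T↑ , T≺ = padRows-semistandard (suc n) {[]} z≤n ([] , []) in r↑ ∷ T↑ , [] ∷ T≺
  padRows-semistandard (suc (suc n)) {r ∷ r′ ∷ T} (s≤s p) (r↑ ∷ T↑ , r≺ ∷ T≺) =
    let T↑′ , T≺′ = padRows-semistandard (suc n) p (T↑ , T≺) in r↑ ∷ T↑′ , r≺ ∷ T≺′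

  padRows-semistandard⁻ : ∀ n {T : Tableau N} → length T ℕ.≤ n → Semistandard (padRows n T) → Semistandard T
  padRows-semistandard⁻ n             {[]}        _ _ = [] , []
  padRows-semistandard⁻ (suc n)       {r ∷ []}    _ (r↑ ∷ _ , _) = r↑ ∷ [] , [-]
  padRows-semistandard⁻ (suc (suc n)) {r ∷ r′ ∷ T} (s≤s p) (r↑ ∷ T↑ , r≺ ∷ T≺) =
    let T↑′ , T≺′ = padRows-semistandard⁻ (suc n) p (T↑ , T≺) in r↑ ∷ T↑′ , r≺ ∷ T≺′
  padRows-semistandard⁻ (suc zero)    {_ ∷ _ ∷ _} (s≤s ()) _

  padRows-concat : ∀ n {T : Tableau N} → length T ℕ.≤ n → concat (padRows n T) ≡ concat T
  padRows-concat zero    {[]}    _       = ≡.refl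
  padRows-concat (suc n) {[]}    _       = padRows-concat n {[]} z≤n
  padRows-concat (suc n) {r ∷ T} (s≤s p) = ≡.cong (r ++_) (padRows-concat n p)

  padRows-content : ∀ n {T : Tableau N} → length T ℕ.≤ n → content (padRows n T) ≡ content T
  padRows-content n p = ≡.cong (λ xs → Vec.tabulate λ i → multiplicity i xs) (padRows-concat n p)

  padRows-injective : ∀ n {T U : Tableau N} → length T ℕ.≤ n → length T ≡ length U → padRows n T ≡ padRows n U → T ≡ U
  padRows-injective n       {[]}    {[]}    _       _  _  = ≡.refl
  padRows-injective (suc n) {r ∷ T} {_ ∷ U} (s≤s p) eq pd =
    ≡.cong₂ _∷_ (List.∷-injectiveˡ pd) (padRows-injective n p (ℕ.suc-injective eq) (List.∷-injectiveʳ pd))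

∈-words⁻ : ∀ N k {v} → v ∈ words N k → length v ≡ k
∈-words⁻ N zero    (here ≡.refl) = ≡.refl
∈-words⁻ N (suc k) v∈ with _ , u , _ , u∈ , ≡.refl ← ∈-cartesianProductWith⁻ _∷_ (List.allFin N) (words N k) v∈ =
  ≡.cong suc (∈-words⁻ N k u∈)

∈-words⁺ : ∀ {N} v → v ∈ words N (length v)
∈-words⁺ []      = here ≡.refl
∈-words⁺ (x ∷ v) = ∈-cartesianProductWith⁺ _∷_ (∈-allFin x) (∈-words⁺ v)

words-unique : ∀ N k → Unique (words N k)
words-unique N zero    = [] ∷ []
words-unique N (suc k) = Unique.cartesianProductWith⁺ _∷_ List.∷-injective (Unique.allFin⁺ N) (words-unique N k)

∈-fillings⁻ : ∀ N ks {T} → T ∈ fillings N ks → map length T ≡ ks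
∈-fillings⁻ N []       (here ≡.refl) = ≡.refl
∈-fillings⁻ N (k ∷ ks) T∈ with _ , _ , v∈ , U∈ , ≡.refl ← ∈-cartesianProductWith⁻ _∷_ (words N k) (fillings N ks) T∈ =
  ≡.cong₂ _∷_ (∈-words⁻ N k v∈) (∈-fillings⁻ N ks U∈)

∈-fillings⁺ : ∀ {N} (T : Tableau N) → T ∈ fillings N (map length T)
∈-fillings⁺ []      = here ≡.refl
∈-fillings⁺ (r ∷ T) = ∈-cartesianProductWith⁺ _∷_ (∈-words⁺ r) (∈-fillings⁺ T)

fillings-unique : ∀ N ks → Unique (fillings N ks)
fillings-unique N []       = [] ∷ []
fillings-unique N (k ∷ ks) = Unique.cartesianProductWith⁺ _∷_ List.∷-injective (words-unique N k) (fillings-unique N ks)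

-- Appending empty rows is a bijection between the two sets of tableaux, and both lists are free of
-- repetitions. The reversal reflects that `tableaux` strips the last letter first.
schur-kostka : ∀ κ {n} (w : Vec ℕ n) → ℓ κ ℕ.≤ n → schur κ (Vec.reverse w) ≡ + kostka (pad n (parts κ)) w
schur-kostka (mkPartition xs (xs↓ , _)) {n} w p = ≡.cong +_ (ℕ.≤-antisym
  (injection-length (padRows n) (Unique.filter⁺ P? (fillings-unique n xs)) pad∈
    λ T∈ U∈ → padRows-injective n (proj₁ (rows≤ T∈)) (≡.trans (proj₂ (rows≤ T∈)) (≡.sym (proj₂ (rows≤ U∈)))))
  (ℕ.≤-trans (⊆-length (tableaux-unique (pad-decreasing n xs↓) w) ∈pad) (ℕ.≤-reflexive (List.length-map (padRows n) (filter P? (fillings n xs))))))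
  where
  P : Tableau n → Set
  P T = Semistandard T × content T ≡ Vec.reverse w
  P? : ∀ T → Dec (P T)
  P? T = semistandard? T ×-dec Vec.≡-dec ℕ._≟_ (content T) (Vec.reverse w)
  length-rows : ∀ {T : Tableau n} → map length T ≡ xs → length T ≡ length xs
  length-rows {T} eq = ≡.trans (≡.sym (List.length-map length T)) (≡.cong length eq)
  rows≤ : ∀ {T} → T ∈ filter P? (fillings n xs) → length T ℕ.≤ n × length T ≡ length xs
  rows≤ T∈ = let eq = length-rows (∈-fillings⁻ n xs (proj₁ (∈-filter⁻ P? {xs = fillings n xs} T∈))) in ℕ.≤-trans (ℕ.≤-reflexive eq) p , eq
  pad∈ : ∀ {T} → T ∈ filter P? (fillings n xs) → padRows n T ∈ tableaux (pad n xs) w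
  pad∈ T∈ =
    let T∈′ , ss , c = ∈-filter⁻ P? {xs = fillings n xs} T∈
        q , _        = rows≤ T∈
    in ∈-tableaux⁺ (padRows-shape n p (∈-fillings⁻ n xs T∈′) , padRows-semistandard n q ss , ≡.trans (padRows-content n q) c)
  ∈pad : ∀ {T} → T ∈ tableaux (pad n xs) w → T ∈ map (padRows n) (filter P? (fillings n xs))
  ∈pad T∈
    with s , ss , c ← ∈-tableaux⁻ (pad-decreasing n xs↓) T∈
    with U , eq , ≡.refl ← padRows-shape⁻ n xs p s =
    let q = ℕ.≤-trans (ℕ.≤-reflexive (length-rows eq)) p
    in ∈-map⁺ (padRows n) (∈-filter⁺ P? (≡.subst (λ ks → U ∈ fillings n ks) eq (∈-fillings⁺ U))
         (padRows-semistandard⁻ n q ss , ≡.trans (≡.sym (padRows-content n q)) c))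

-- The first column increases strictly, so n letters allow at most n nonempty rows. The bound `b` on
-- the entries of the top row rises by one with each row.
semistandard-rows : ∀ {n} b (T : Tableau n) → All NonZero (map length T) → Linked ColumnStrict T →
  All (λ x → b ℕ.≤ toℕ x) (concat (List.take 1 T)) → b ℕ.≤ n → b ℕ.+ length T ℕ.≤ n
semistandard-rows b []       _        _ _  b≤n = ℕ.≤-trans (ℕ.≤-reflexive (ℕ.+-identityʳ b)) b≤n
semistandard-rows b ([] ∷ _) (0≢0 ∷ _) _ _ _ = contradiction ≡.refl (ℕ.≢-nonZero⁻¹ 0 {{0≢0}})
semistandard-rows b ((x ∷ r) ∷ []) _ _ (b≤x ∷ _) _ = ℕ.≤-trans (ℕ.≤-reflexive (ℕ.+-comm b 1)) (ℕ.≤-<-trans b≤x (Fin.toℕ<n x))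
semistandard-rows b ((x ∷ r) ∷ r′ ∷ T) (_ ∷ nz) (r≺r′ ∷ T≺) b≤@(b≤x ∷ _) _ =
  ℕ.≤-trans (ℕ.≤-reflexive (ℕ.+-suc b (suc (length T)))) (semistandard-rows (suc b) (r′ ∷ T) nz T≺
    (≡.subst (All _) (≡.sym (List.++-identityʳ r′)) (columnStrict-bound r≺r′ (≡.subst (All _) (List.++-identityʳ (x ∷ r)) b≤)))
    (ℕ.≤-<-trans b≤x (Fin.toℕ<n x)))

schur-long : ∀ κ {n} (w : Vec ℕ n) → n ℕ.< ℓ κ → schur κ w ≡ 0ℤ
schur-long (mkPartition xs (_ , xs≢0)) {n} w n<ℓ = ≡.cong (+_ ∘ length) (List.filter-none P? (All.tabulate none))
  where
  P? : ∀ T → Dec (Semistandard T × content T ≡ w)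
  P? T = semistandard? T ×-dec Vec.≡-dec ℕ._≟_ (content T) w
  none : ∀ {T} → T ∈ fillings n xs → ¬ (Semistandard T × content T ≡ w)
  none {T} T∈ ((_ , T≺) , _) = ℕ.<-irrefl ≡.refl (begin-strict
    n         <⟨ n<ℓ ⟩
    length xs ≡⟨ ≡.cong length (∈-fillings⁻ n xs T∈) ⟨
    length (map length T) ≡⟨ List.length-map length T ⟩
    length T  ≤⟨ semistandard-rows 0 T (≡.subst (All NonZero) (≡.sym (∈-fillings⁻ n xs T∈)) xs≢0) T≺ (All.universal (λ _ → z≤n) _) z≤n ⟩
    n         ∎)
    where open ℕ.≤-Reasoning

∈-tableaux-sum : ∀ {n} {κ w : Vec ℕ n} {T} → Decreasing κ → T ∈ tableaux κ w → Vec.sum w ≡ Vec.sum κ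
∈-tableaux-sum {zero}  {[]} {[]}    _  _  = ≡.refl
∈-tableaux-sum {suc n} {κ}  {k ∷ w} κ↓ T∈
  with λ′ , λ∈ , T∈′ ← ∈-concatMap-∃ (λ λ′ → map (extend κ) (tableaux λ′ w)) _ T∈
  with λ∈′ , ≡.refl ← ∈-filter⁻ (λ λ′ → Vec.sum κ ℕ.∸ Vec.sum λ′ ℕ.≟ k) {xs = interlacings κ} λ∈
  with T′ , T′∈ , ≡.refl ← ∈-map⁻ (extend κ) T∈′
  = let ks = ∈-interlacings⁻ κ↓ λ∈′
    in ≡.trans (≡.cong (Vec.sum κ ℕ.∸ Vec.sum λ′ ℕ.+_) (∈-tableaux-sum (interlaces-decreasing ks) T′∈)) (ℕ.m∸n+n≡m (interlaces-sum ks))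

kostka-degree : ∀ {n} {κ w : Vec ℕ n} → Decreasing κ → Vec.sum w ≢ Vec.sum κ → kostka κ w ≡ 0
kostka-degree {κ = κ} {w} κ↓ ≢ with tableaux κ w in eq
... | []    = ≡.refl
... | T ∷ _ = contradiction (∈-tableaux-sum κ↓ (≡.subst (T ∈_) (≡.sym eq) (here ≡.refl))) ≢

-- Lists of partitions

nonZero-irrelevant : ∀ {n} (p q : NonZero n) → p ≡ q
nonZero-irrelevant {suc n} _ _ = ≡.refl

partition-≡ : ∀ {κ κ′} → parts κ ≡ parts κ′ → κ ≡ κ′
partition-≡ {mkPartition xs (p , q)} {mkPartition .xs (p′ , q′)} ≡.refl =
  ≡.cong₂ (λ p q → mkPartition xs (p , q)) (Linked.irrelevant ℕ.≤-irrelevant p p′) (All.irrelevant nonZero-irrelevant q q′)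

∈-compositions⁻ : ∀ d {xs} → xs ∈ compositions d → List.foldr ℕ._+_ 0 xs ≡ d × All NonZero xs
∈-compositions⁻ zero    (here ≡.refl) = ≡.refl , []
∈-compositions⁻ (suc d) xs∈ with ∈-concatMap-∃ _ (compositions d) xs∈
... | []     , p , here ≡.refl         = ≡.cong suc (proj₁ (∈-compositions⁻ d p)) , _ ∷ []
... | y ∷ ys , p , here ≡.refl         = let eq , nz = ∈-compositions⁻ d p in ≡.cong suc eq , _ ∷ nz
... | y ∷ ys , p , there (here ≡.refl) = let eq , nz = ∈-compositions⁻ d p in ≡.cong suc eq , _ ∷ All.tail nz

∈-compositions⁺ : ∀ xs → All NonZero xs → xs ∈ compositions (List.foldr ℕ._+_ 0 xs)
∈-compositions⁺ xs nz = go _ xs nz ≡.refl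
  where
  go : ∀ d xs → All NonZero xs → List.foldr ℕ._+_ 0 xs ≡ d → xs ∈ compositions d
  go zero    []                   _        _      = here ≡.refl
  go zero    (zero ∷ xs)          (0≢0 ∷ _) _     = contradiction ≡.refl (ℕ.≢-nonZero⁻¹ 0 {{0≢0}})
  go (suc d) (zero ∷ xs)          (0≢0 ∷ _) _     = contradiction ≡.refl (ℕ.≢-nonZero⁻¹ 0 {{0≢0}})
  go (suc .0) (suc zero ∷ [])     _        ≡.refl = here ≡.refl
  go (suc d) (suc zero ∷ y ∷ ys)  (_ ∷ nz) eq     = ∈-concatMap (go d (y ∷ ys) nz (ℕ.suc-injective eq)) (here ≡.refl)
  go (suc d) (suc (suc x) ∷ xs)   (_ ∷ nz) eq     = ∈-concatMap (go d (suc x ∷ xs) (_ ∷ nz) (ℕ.suc-injective eq)) (there (here ≡.refl))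

-- The head tells how an extension arose: it is 1 after a prepended 1 and at least 2 after an
-- increase. The two could only be confused if some composition had head 0.
compositions-unique : ∀ d → Unique (compositions d)
compositions-unique zero    = [] ∷ []
compositions-unique (suc d) = concatMap-unique _ (compositions-unique d)
  (λ { {[]} _ → [] ∷ [] ; {x ∷ xs} _ → ((λ eq → ℕ.1+n≢n (≡.cong length eq)) ∷ []) ∷ [] ∷ [] })
  (λ { {[]}     {[]}     _ _ _ _ → ≡.refl
     ; {[]}     {y ∷ ys} _ _ (here ≡.refl) (here ())
     ; {[]}     {y ∷ ys} _ q (here ≡.refl) (there (here ≡.refl)) → head≢0 q
     ; {x ∷ xs} {[]}     _ _ (here ≡.refl) (here ())
     ; {x ∷ xs} {[]}     p _ (there (here ≡.refl)) (here ≡.refl) → head≢0 p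
     ; {x ∷ xs} {y ∷ ys} _ _ (here ≡.refl) (here ≡.refl) → ≡.refl
     ; {x ∷ xs} {y ∷ ys} _ q (here ≡.refl) (there (here ≡.refl)) → head≢0 q
     ; {x ∷ xs} {y ∷ ys} p _ (there (here ≡.refl)) (here ≡.refl) → head≢0 p
     ; {x ∷ xs} {y ∷ ys} _ _ (there (here ≡.refl)) (there (here ≡.refl)) → ≡.refl })
  where
  head≢0 : ∀ {xs} → 0 ∷ xs ∈ compositions d → ∀ {A : Set} → A
  head≢0 p with 0≢0 ∷ _ ← proj₂ (∈-compositions⁻ d p) = contradiction ≡.refl (ℕ.≢-nonZero⁻¹ 0 {{0≢0}})

module _ {A B : Set} (f : A → Maybe B) where

  ∈-mapMaybe⁻ : ∀ xs {y} → y ∈ mapMaybe f xs → ∃ λ x → x ∈ xs × f x ≡ just y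
  ∈-mapMaybe⁻ (x ∷ xs) y∈ with f x in eq
  ... | nothing = let x′ , x′∈ , eq′ = ∈-mapMaybe⁻ xs y∈ in x′ , there x′∈ , eq′
  ... | just z with y∈
  ...   | here ≡.refl = x , here ≡.refl , eq
  ...   | there y∈′   = let x′ , x′∈ , eq′ = ∈-mapMaybe⁻ xs y∈′ in x′ , there x′∈ , eq′

  ∈-mapMaybe⁺ : ∀ {xs x y} → x ∈ xs → f x ≡ just y → y ∈ mapMaybe f xs
  ∈-mapMaybe⁺ (here ≡.refl) eq rewrite eq = here ≡.refl
  ∈-mapMaybe⁺ {x′ ∷ xs} (there x∈) eq with f x′
  ... | nothing = ∈-mapMaybe⁺ x∈ eq
  ... | just _  = there (∈-mapMaybe⁺ x∈ eq)

  mapMaybe-unique : (∀ {x x′ y} → f x ≡ just y → f x′ ≡ just y → x ≡ x′) → ∀ {xs} → Unique xs → Unique (mapMaybe f xs)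
  mapMaybe-unique inj []              = []
  mapMaybe-unique inj {x ∷ xs} (x∉ ∷ xs!) with f x in eq
  ... | nothing = mapMaybe-unique inj xs!
  ... | just y  = All.tabulate (λ { y′∈ ≡.refl → let x′ , x′∈ , eq′ = ∈-mapMaybe⁻ xs y′∈ in All.lookup x∉ x′∈ (inj eq eq′) })
                  ∷ mapMaybe-unique inj xs!

toPartition : List ℕ → Maybe Partition
toPartition xs = Maybe.map (mkPartition xs) (dec⇒maybe (isPartition? xs))

toPartition-parts : ∀ {xs κ} → toPartition xs ≡ just κ → parts κ ≡ xs
toPartition-parts {xs} eq with yes _ ← isPartition? xs | ≡.refl ← eq = ≡.refl

parts-toPartition : ∀ κ → toPartition (parts κ) ≡ just κ
parts-toPartition κ with isPartition? (parts κ)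
... | yes _ = ≡.cong just (partition-≡ ≡.refl)
... | no ¬p = contradiction (isPartition κ) ¬p

∈-partitionsOf⁻ : ∀ {d κ} → κ ∈ partitionsOf d → ∣ κ ∣ ≡ d
∈-partitionsOf⁻ {d} {κ} κ∈ with xs , xs∈ , eq ← ∈-mapMaybe⁻ toPartition (compositions d) κ∈ =
  ≡.trans (≡.cong (List.foldr ℕ._+_ 0) (toPartition-parts {xs} eq)) (proj₁ (∈-compositions⁻ d xs∈))

∈-partitionsOf⁺ : ∀ κ → κ ∈ partitionsOf ∣ κ ∣
∈-partitionsOf⁺ κ = ∈-mapMaybe⁺ toPartition (∈-compositions⁺ (parts κ) (proj₂ (isPartition κ))) (parts-toPartition κ)

partitionsOf-unique : ∀ d → Unique (partitionsOf d)
partitionsOf-unique d =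
  mapMaybe-unique toPartition (λ {x} {x′} p q → ≡.trans (≡.sym (toPartition-parts {x} p)) (toPartition-parts {x′} q)) (compositions-unique d)

partitionsUpTo-unique : ∀ d → Unique (partitionsUpTo d)
partitionsUpTo-unique d = concatMap-unique partitionsOf (Unique.upTo⁺ (suc d)) (λ {e} _ → partitionsOf-unique e)
  λ _ _ p q → ≡.trans (≡.sym (∈-partitionsOf⁻ p)) (∈-partitionsOf⁻ q)

-- Coefficients of products and of alternants

private
  ℤring = ℤ.+-*-commutativeRing
  module Aℤ = Alternants ℤring
  module Mℤ = PowerSeries ℤring
  module P n = CommutativeRing (powerSeries n)
  module A n = Alternants (powerSeries n)
  module C n w = LinearMaps.IsLinear (coeff-linear n w)

module _ (R : CommutativeRing 0ℓ 0ℓ) where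
  open CommutativeRing R
  open PowerSeries R

  monomial-≡ : ∀ e a → monomial e a e ≈ a
  monomial-≡ zero    a = refl
  monomial-≡ (suc e) a = monomial-≡ e a

  monomial-≢ : ∀ e a k → e ≢ k → monomial e a k ≈ 0#
  monomial-≢ zero    a zero    e≢k = contradiction ≡.refl e≢k
  monomial-≢ zero    a (suc k) _   = refl
  monomial-≢ (suc e) a zero    _   = refl
  monomial-≢ (suc e) a (suc k) e≢k = monomial-≢ e a k (e≢k ∘ ≡.cong suc)

  ⋆-upTo : ∀ f g k → (f ⋆ g) k ≈ Alternants.Σ[_] R (upTo (suc k)) (λ i → f i * g (k ℕ.∸ i))
  ⋆-upTo f g zero    = sym (+-identityʳ _)
  ⋆-upTo f g (suc k) = +-congˡ (trans (⋆-upTo (f ∘ suc) g k)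
    (trans (sym (Alternants.Σ-map R suc (upTo (suc k)) (λ i → f i * g (suc k ℕ.∸ i))))
      (reflexive (≡.cong (λ xs → Alternants.Σ[_] R xs (λ i → f i * g (suc k ℕ.∸ i))) (List.map-upTo suc (suc k))))))

-- Both sides follow the same branching: extracting the exponent `k` of the first variable keeps the
-- interlacing shapes that the filter in `tableaux` selects.
coeff-kostka : ∀ {n} (κ w : Vec ℕ n) → coeff n (A.schurPolynomial n κ (variables n)) w ≡ + kostka κ w
coeff-kostka {zero}  []  []      = ≡.refl
coeff-kostka {suc n} κ   (k ∷ w) = ≡.trans (coeff-schurPolynomial n κ k w) (count (interlacings κ))
  where
  P? : ∀ λ′ → Dec (Vec.sum κ ℕ.∸ Vec.sum λ′ ≡ k)
  P? λ′ = Vec.sum κ ℕ.∸ Vec.sum λ′ ℕ.≟ k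
  rows : List (Vec ℕ n) → List (Tableau (suc n))
  rows = concatMap (λ λ′ → map (extend κ) (tableaux λ′ w))
  c : Vec ℕ n → ℤ
  c λ′ = coeff n (A.schurPolynomial n λ′ (variables n)) w
  count : ∀ λs → Aℤ.Σ[ λs ] (λ λ′ → Mℤ.monomial (Vec.sum κ ℕ.∸ Vec.sum λ′) (c λ′) k) ≡ + length (rows (filter P? λs))
  count []       = ≡.refl
  count (λ′ ∷ λs) = step (P? λ′)
    where
    open ≡.≡-Reasoning
    step : Dec (Vec.sum κ ℕ.∸ Vec.sum λ′ ≡ k) →
      Aℤ.Σ[ λ′ ∷ λs ] (λ λ′ → Mℤ.monomial (Vec.sum κ ℕ.∸ Vec.sum λ′) (c λ′) k) ≡ + length (rows (filter P? (λ′ ∷ λs)))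
    step (no e≢k) = begin
      _                                ≡⟨ ≡.cong₂ ℤ._+_ (monomial-≢ ℤring _ (c λ′) k e≢k) (count λs) ⟩
      0ℤ ℤ.+ + length (rows (filter P? λs)) ≡⟨ ℤ.+-identityˡ _ ⟩
      + length (rows (filter P? λs))        ≡⟨ ≡.cong (λ xs → + length (rows xs)) (List.filter-reject P? {λ′} {λs} e≢k) ⟨
      _ ∎
    step (yes e≡k) = begin
      _
        ≡⟨ ≡.cong₂ ℤ._+_ (≡.trans (≡.cong (λ e → Mℤ.monomial e (c λ′) k) e≡k) (≡.trans (monomial-≡ ℤring k (c λ′)) (coeff-kostka λ′ w))) (count λs) ⟩
      + kostka λ′ w ℤ.+ + length (rows (filter P? λs))
        ≡⟨ ≡.cong (λ x → + (x ℕ.+ length (rows (filter P? λs)))) (List.length-map (extend κ) (tableaux λ′ w)) ⟨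
      + (length (map (extend κ) (tableaux λ′ w)) ℕ.+ length (rows (filter P? λs)))
        ≡⟨ ≡.cong +_ (List.length-++ (map (extend κ) (tableaux λ′ w))) ⟨
      + length (rows (λ′ ∷ filter P? λs))
        ≡⟨ ≡.cong (λ xs → + length (rows xs)) (List.filter-accept P? {λ′} {λs} e≡k) ⟨
      _ ∎

coeff-* : ∀ n (f g : ⟪ n ⟫) w → coeff n (P._*_ n f g) w ≡ ∑ (splittings w) λ (u , v) → coeff n f u ℤ.* coeff n g v
coeff-* zero    f g []      = ≡.sym (ℤ.+-identityʳ (f ℤ.* g))
coeff-* (suc n) f g (k ∷ w) = begin
  coeff n ((f ⋆ g) k) w
    ≡⟨ C.cong n w (⋆-upTo (powerSeries n) f g k) ⟩
  coeff n (A.Σ[_] n (upTo (suc k)) (λ i → P._*_ n (f i) (g (k ℕ.∸ i)))) w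
    ≡⟨ LinearMaps.IsLinear.Σ-map (coeff-linear n w) (upTo (suc k)) _ ⟩
  ∑ (upTo (suc k)) (λ i → coeff n (P._*_ n (f i) (g (k ℕ.∸ i))) w)
    ≡⟨ Aℤ.Σ-cong (upTo (suc k)) (λ i → coeff-* n (f i) (g (k ℕ.∸ i)) w) ⟩
  ∑ (upTo (suc k)) (λ i → ∑ (splittings w) λ (u , v) → coeff n (f i) u ℤ.* coeff n (g (k ℕ.∸ i)) v)
    ≡⟨ Aℤ.Σ-cartesianProductWith (λ i (u , v) → (i ∷ u , k ℕ.∸ i ∷ v)) (upTo (suc k)) (splittings w) (λ (u , v) → coeff (suc n) f u ℤ.* coeff (suc n) g v) ⟨
  _ ∎
  where
  open ≡.≡-Reasoning
  open PowerSeries (powerSeries n) using (_⋆_)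

∑-add : {A : Set} (xs : List A) (f g : A → ℤ) → ∑ xs (λ x → f x ℤ.+ g x) ≡ ∑ xs f ℤ.+ ∑ xs g
∑-add []       f g = ≡.refl
∑-add (x ∷ xs) f g = ≡.trans (≡.cong (λ z → f x ℤ.+ g x ℤ.+ z) (∑-add xs f g)) (lemma (f x) (g x) (∑ xs f) (∑ xs g))
  where
  lemma : ∀ a b c d → a ℤ.+ b ℤ.+ (c ℤ.+ d) ≡ a ℤ.+ c ℤ.+ (b ℤ.+ d)
  lemma = ℤ-Solver.solve-∀

∑-zero : {A : Set} (xs : List A) → ∑ xs (λ _ → 0ℤ) ≡ 0ℤ
∑-zero []       = ≡.refl
∑-zero (x ∷ xs) = ≡.trans (ℤ.+-identityˡ _) (∑-zero xs)

∑-swap : {A B : Set} (xs : List A) (ys : List B) (f : A → B → ℤ) →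
  ∑ xs (λ x → ∑ ys (λ y → f x y)) ≡ ∑ ys (λ y → ∑ xs (λ x → f x y))
∑-swap []       ys f = ≡.sym (∑-zero ys)
∑-swap (x ∷ xs) ys f = ≡.trans (≡.cong (λ z → ∑ ys (f x) ℤ.+ z) (∑-swap xs ys f)) (≡.sym (∑-add ys (f x) (λ y → ∑ xs (λ x → f x y))))

∑-splittings-∷ʳ : ∀ {n} (w : Vec ℕ n) k (h : Vec ℕ (suc n) × Vec ℕ (suc n) → ℤ) →
  ∑ (splittings (w ∷ʳ k)) h ≡ ∑ (splittings w) λ (u , v) → ∑ (upTo (suc k)) λ i → h (u ∷ʳ i , v ∷ʳ (k ℕ.∸ i))
∑-splittings-∷ʳ [] k h = begin
  ∑ (splittings (k ∷ [])) h
    ≡⟨ Aℤ.Σ-cartesianProductWith (λ i (u , v) → (i ∷ u , k ℕ.∸ i ∷ v)) (upTo (suc k)) (splittings []) h ⟩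
  ∑ (upTo (suc k)) (λ i → h (i ∷ [] , k ℕ.∸ i ∷ []) ℤ.+ 0ℤ)
    ≡⟨ Aℤ.Σ-cong (upTo (suc k)) (λ i → ℤ.+-identityʳ (h (i ∷ [] , k ℕ.∸ i ∷ []))) ⟩
  ∑ (upTo (suc k)) (λ i → h (i ∷ [] , k ℕ.∸ i ∷ []))
    ≡⟨ ℤ.+-identityʳ _ ⟨
  _ ∎
  where open ≡.≡-Reasoning
∑-splittings-∷ʳ (m ∷ w) k h = begin
  ∑ (splittings (m ∷ (w ∷ʳ k))) h
    ≡⟨ Aℤ.Σ-cartesianProductWith (λ i (u , v) → (i ∷ u , m ℕ.∸ i ∷ v)) (upTo (suc m)) (splittings (w ∷ʳ k)) h ⟩
  ∑ (upTo (suc m)) (λ j → ∑ (splittings (w ∷ʳ k)) λ (u , v) → h (j ∷ u , m ℕ.∸ j ∷ v))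
    ≡⟨ Aℤ.Σ-cong (upTo (suc m)) (λ j → ∑-splittings-∷ʳ w k λ (u , v) → h (j ∷ u , m ℕ.∸ j ∷ v)) ⟩
  ∑ (upTo (suc m)) (λ j → ∑ (splittings w) λ (u , v) → ∑ (upTo (suc k)) λ i → h (j ∷ (u ∷ʳ i) , m ℕ.∸ j ∷ (v ∷ʳ (k ℕ.∸ i))))
    ≡⟨ Aℤ.Σ-cartesianProductWith (λ i (u , v) → (i ∷ u , m ℕ.∸ i ∷ v)) (upTo (suc m)) (splittings w) (λ (u , v) → ∑ (upTo (suc k)) λ i → h (u ∷ʳ i , v ∷ʳ (k ℕ.∸ i))) ⟨
  _ ∎
  where open ≡.≡-Reasoning

-- `schurSeries` reads exponents backwards. This identity makes the product of such series agree
-- with `_⊛_`.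
∑-splittings-reverse : ∀ {n} (w : Vec ℕ n) (h : Vec ℕ n × Vec ℕ n → ℤ) →
  ∑ (splittings (Vec.reverse w)) h ≡ ∑ (splittings w) λ (u , v) → h (Vec.reverse u , Vec.reverse v)
∑-splittings-reverse []      h = ≡.refl
∑-splittings-reverse (k ∷ w) h = begin
  ∑ (splittings (Vec.reverse (k ∷ w))) h
    ≡⟨ ≡.cong (λ w → ∑ (splittings w) h) (Vec.reverse-∷ k w) ⟩
  ∑ (splittings (Vec.reverse w ∷ʳ k)) h
    ≡⟨ ∑-splittings-∷ʳ (Vec.reverse w) k h ⟩
  ∑ (splittings (Vec.reverse w)) (λ (u , v) → ∑ (upTo (suc k)) λ i → h (u ∷ʳ i , v ∷ʳ (k ℕ.∸ i)))
    ≡⟨ ∑-splittings-reverse w (λ (u , v) → ∑ (upTo (suc k)) λ i → h (u ∷ʳ i , v ∷ʳ (k ℕ.∸ i))) ⟩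
  ∑ (splittings w) (λ (u , v) → ∑ (upTo (suc k)) λ i → h (Vec.reverse u ∷ʳ i , Vec.reverse v ∷ʳ (k ℕ.∸ i)))
    ≡⟨ ∑-swap (splittings w) (upTo (suc k)) (λ (u , v) i → h (Vec.reverse u ∷ʳ i , Vec.reverse v ∷ʳ (k ℕ.∸ i))) ⟩
  ∑ (upTo (suc k)) (λ i → ∑ (splittings w) λ (u , v) → h (Vec.reverse u ∷ʳ i , Vec.reverse v ∷ʳ (k ℕ.∸ i)))
    ≡⟨ Aℤ.Σ-cong (upTo (suc k)) (λ i → Aℤ.Σ-cong (splittings w) λ (u , v) →
         ≡.cong₂ (λ u v → h (u , v)) (≡.sym (Vec.reverse-∷ i u)) (≡.sym (Vec.reverse-∷ (k ℕ.∸ i) v))) ⟩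
  ∑ (upTo (suc k)) (λ i → ∑ (splittings w) λ (u , v) → h (Vec.reverse (i ∷ u) , Vec.reverse (k ℕ.∸ i ∷ v)))
    ≡⟨ Aℤ.Σ-cartesianProductWith (λ i (u , v) → (i ∷ u , k ℕ.∸ i ∷ v)) (upTo (suc k)) (splittings w) (λ (u , v) → h (Vec.reverse u , Vec.reverse v)) ⟨
  _ ∎
  where open ≡.≡-Reasoning

remove-∈ : ∀ {n x e} {l : Vec ℕ (suc n)} {r} → Remove l e r → x Vec∈.∈ l → x ≢ e → x Vec∈.∈ r
remove-∈ here        (here x≡e) x≢e = contradiction x≡e x≢e
remove-∈ here        (there x∈) _   = x∈
remove-∈ (there rem) (here x≡y) _   = here x≡y
remove-∈ (there rem) (there x∈) x≢e = there (remove-∈ rem x∈ x≢e)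

remove-all : ∀ {n e} {l : Vec ℕ (suc n)} {r} {Q : ℕ → Set} → Remove l e r → VecAll.All Q l → Q e
remove-all here        (q ∷ _)  = q
remove-all (there rem) (_ ∷ qs) = remove-all rem qs

alternantCoeff : ∀ {n} → Vec ℕ n → Vec ℕ n → ℤ
alternantCoeff {n} l w = coeff n (A.alternant n l (variables n)) w

-- Every monomial of the alternant distributes all the exponents in `l` among the variables, so some
-- variable carries the exponent `x`.
alternantCoeff-absent : ∀ {n x} (l w : Vec ℕ n) → x Vec∈.∈ l → VecAll.All (x ≢_) w → alternantCoeff l w ≡ 0ℤ
alternantCoeff-absent {suc n} {x} l (k ∷ w) x∈ (x≢k ∷ x∉) = ≡.trans (coeff-alternant n l k w) (Aℤ.laplace-zero _ l zero-term)
  where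
  zero-term : ∀ {e r} → Remove l e r → Mℤ.monomial e (alternantCoeff r w) k ≡ 0ℤ
  zero-term {e} {r} rem with e ℕ.≟ k
  ... | no e≢k     = monomial-≢ ℤring e _ k e≢k
  ... | yes ≡.refl = ≡.trans (monomial-≡ ℤring e _) (alternantCoeff-absent r w (remove-∈ rem x∈ x≢k) x∉)

StrictlyDecreasing : ∀ {n} → Vec ℕ n → Set
StrictlyDecreasing = VecAllPairs.AllPairs ℕ._>_

-- Since `x` exceeds every entry of `l`, the first variable can obtain the exponent `x` only from
-- the head, where the sign is positive.
alternantCoeff-head : ∀ {n} x (l w : Vec ℕ n) → VecAll.All (x ℕ.>_) l → alternantCoeff (x ∷ l) (x ∷ w) ≡ alternantCoeff l w
alternantCoeff-head {zero}  x [] [] _   = ≡.trans (coeff-alternant 0 (x ∷ []) x []) (monomial-≡ ℤring x _)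
alternantCoeff-head {suc n} x l  w  x>l = begin
  alternantCoeff (x ∷ l) (x ∷ w) ≡⟨ coeff-alternant (suc n) (x ∷ l) x w ⟩
  Mℤ.monomial x (alternantCoeff l w) x Aℤ.- Aℤ.laplace (λ e r → Mℤ.monomial e (alternantCoeff (x ∷ r) w) x) l
    ≡⟨ Aℤ.-cong (monomial-≡ ℤring x _) (Aℤ.laplace-zero _ l λ {e} {r} rem → monomial-≢ ℤring e _ x (ℕ.<⇒≢ (remove-all rem x>l))) ⟩
  alternantCoeff l w Aℤ.- 0ℤ     ≡⟨ Aℤ.x-0≈x _ ⟩
  alternantCoeff l w             ∎
  where open ≡.≡-Reasoning

alternantCoeff-≡ : ∀ {n} {l : Vec ℕ n} → StrictlyDecreasing l → alternantCoeff l l ≡ + 1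
alternantCoeff-≡ []                = ≡.refl
alternantCoeff-≡ (_∷_ {x = x} {xs = l} x>l l↓) = ≡.trans (alternantCoeff-head x l l x>l) (alternantCoeff-≡ l↓)

-- At the first difference, the larger of the two heads is missing from the other vector: a larger
-- `x` is an exponent that `w` does not use, and a larger `k` is one that `l` cannot supply.
alternantCoeff-≢ : ∀ {n} {l w : Vec ℕ n} → StrictlyDecreasing l → StrictlyDecreasing w → l ≢ w → alternantCoeff l w ≡ 0ℤ
alternantCoeff-≢ [] [] l≢w = contradiction ≡.refl l≢w
alternantCoeff-≢ {suc n} (_∷_ {x = x} {xs = l} x>l l↓) (_∷_ {x = k} {xs = w} k>w w↓) l≢w with ℕ.<-cmp x k
... | tri≈ _ ≡.refl _ = ≡.trans (alternantCoeff-head x l w x>l) (alternantCoeff-≢ l↓ w↓ (l≢w ∘ ≡.cong (x ∷_)))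
... | tri> _ x≢k k<x  = alternantCoeff-absent (x ∷ l) (k ∷ w) (here ≡.refl) (x≢k ∷ VecAll.map (λ j<k x≡j → ℕ.<-asym (≡.subst (ℕ._< k) (≡.sym x≡j) j<k) k<x) k>w)
... | tri< x<k _ _    = ≡.trans (coeff-alternant n (x ∷ l) k w) (Aℤ.laplace-zero _ (x ∷ l)
  λ {e} rem → monomial-≢ ℤring e _ k (ℕ.<⇒≢ (remove-all rem (x<k ∷ VecAll.map (λ j<x → ℕ.<-trans j<x x<k) x>l))))

decreasing-bound : ∀ {n x} {κ : Vec ℕ n} → Decreasing (x ∷ κ) → VecAll.All (ℕ._≤ x) κ
decreasing-bound [-] = []
decreasing-bound {κ = y ∷ κ} (y≤x ∷ κ↓) = y≤x ∷ VecAll.map (λ z≤y → ℕ.≤-trans z≤y y≤x) (decreasing-bound κ↓)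

addρ-bound : ∀ {n x} {κ : Vec ℕ n} → VecAll.All (ℕ._≤ x) κ → VecAll.All (ℕ._< x ℕ.+ n) (addρ κ)
addρ-bound []                                = []
addρ-bound {suc n} {x} (_∷_ {x = y} y≤x κ≤x) rewrite ℕ.+-suc x n =
  s≤s (ℕ.+-monoˡ-≤ n y≤x) ∷ VecAll.map ℕ.m<n⇒m<1+n (addρ-bound κ≤x)

addρ-strictlyDecreasing : ∀ {n} {κ : Vec ℕ n} → Decreasing κ → StrictlyDecreasing (addρ κ)
addρ-strictlyDecreasing {κ = []}    _  = []
addρ-strictlyDecreasing {κ = x ∷ κ} κ↓ = addρ-bound (decreasing-bound κ↓) ∷ addρ-strictlyDecreasing (tail κ↓)
  where
  tail : ∀ {n} {κ : Vec ℕ n} → Decreasing (x ∷ κ) → Decreasing κ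
  tail [-]      = []
  tail (_ ∷ κ↓) = κ↓

addρ-injective : ∀ {n} {κ κ′ : Vec ℕ n} → addρ κ ≡ addρ κ′ → κ ≡ κ′
addρ-injective {κ = []}    {[]}     _  = ≡.refl
addρ-injective {κ = x ∷ κ} {y ∷ κ′} eq =
  ≡.cong₂ _∷_ (ℕ.+-cancelʳ-≡ _ x y (Vec.∷-injectiveˡ eq)) (addρ-injective (Vec.∷-injectiveʳ eq))

-- Littlewood–Richardson coefficients

∑-δ : {A : Set} {xs : List A} {x₀ : A} (f : A → ℤ) → Unique xs → x₀ ∈ xs → (∀ {x} → x ∈ xs → x ≢ x₀ → f x ≡ 0ℤ) → ∑ xs f ≡ f x₀
∑-δ {xs = x ∷ xs} f (x∉ ∷ xs!) (here ≡.refl) f≡0 =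
  ≡.trans (≡.cong (λ z → f x ℤ.+ z) (≡.trans (Aℤ.Σ-cong-∈ xs λ y∈ → f≡0 (there y∈) λ { ≡.refl → All.lookup x∉ y∈ ≡.refl }) (∑-zero xs))) (ℤ.+-identityʳ _)
∑-δ {xs = x ∷ xs} f (x∉ ∷ xs!) (there x₀∈) f≡0 =
  ≡.trans (≡.cong₂ ℤ._+_ (f≡0 (here ≡.refl) λ { ≡.refl → All.lookup x∉ x₀∈ ≡.refl }) (∑-δ f xs! x₀∈ (f≡0 ∘ there))) (ℤ.+-identityˡ _)

scalar : ∀ n → ℤ → ⟪ n ⟫
scalar zero    z = z
scalar (suc n) z = PowerSeries.constant (powerSeries n) (scalar n z)

coeff-scalar : ∀ n z f w → coeff n (P._*_ n (scalar n z) f) w ≡ z ℤ.* coeff n f w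
coeff-scalar zero    z f []      = ≡.refl
coeff-scalar (suc n) z f (k ∷ w) =
  ≡.trans (C.cong n w (PowerSeries.constant-⋆ (powerSeries n) (scalar n z) f k)) (coeff-scalar n z (f k) w)

schurSeries : ∀ n → Partition → ⟪ n ⟫
schurSeries n κ = fromCoeffs n (λ w → schur κ (Vec.reverse w))

shape : ∀ n → Partition → Vec ℕ n
shape n κ = pad n (parts κ)

shape-decreasing : ∀ n κ → Decreasing (shape n κ)
shape-decreasing n κ = pad-decreasing n (proj₁ (isPartition κ))

module _ (n : ℕ) where

  private
    open module Pn = CommutativeRing (powerSeries n) using () renaming (_*_ to _*ₙ_; _≈_ to _≈ₙ_; 0# to 0ₙ)

  schurSeries-polynomial : ∀ κ → ℓ κ ℕ.≤ n → schurSeries n κ ≈ₙ A.schurPolynomial n (shape n κ) (variables n)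
  schurSeries-polynomial κ ℓ≤n = coeff-ext n λ w →
    ≡.trans (coeff-fromCoeffs n _ w) (≡.trans (schur-kostka κ w ℓ≤n) (≡.sym (coeff-kostka (shape n κ) w)))

  schurSeries-zero : ∀ κ → n ℕ.< ℓ κ → schurSeries n κ ≈ₙ 0ₙ
  schurSeries-zero κ n<ℓ = coeff-ext n λ w →
    ≡.trans (coeff-fromCoeffs n _ w) (≡.trans (schur-long κ (Vec.reverse w) n<ℓ) (≡.sym (C.zero# n w)))

  schurSeries-degree : ∀ κ w → Vec.sum w ≢ ∣ κ ∣ → coeff n (schurSeries n κ) w ≡ 0ℤ
  schurSeries-degree κ w deg with ℕ.≤-<-connex (ℓ κ) n
  ... | inj₂ n<ℓ = ≡.trans (C.cong n w (schurSeries-zero κ n<ℓ)) (C.zero# n w)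
  ... | inj₁ ℓ≤n = ≡.trans (C.cong n w (schurSeries-polynomial κ ℓ≤n)) (≡.trans (coeff-kostka (shape n κ) w)
    (≡.cong +_ (kostka-degree (shape-decreasing n κ) λ eq → deg (≡.trans eq (pad-sum n (parts κ) ℓ≤n)))))

  V : ⟪ n ⟫
  V = A.vandermonde n (variables n)

  V-schurSeries : ∀ κ → ℓ κ ℕ.≤ n → V *ₙ schurSeries n κ ≈ₙ A.alternant n (addρ (shape n κ)) (variables n)
  V-schurSeries κ ℓ≤n = Pn.trans (Pn.*-congˡ (schurSeries-polynomial κ ℓ≤n)) (A.bialternant n (shape n κ) (variables n) (shape-decreasing n κ))

  -- As V s_κ is an alternant, the coefficient of V H at κ₀ + ρ is that of s_κ₀ in H.
  schurCoefficient : ∀ {H} (a : Partition → ℤ) d → H ≈ₙ A.Σ[_] n (partitionsOf d) (λ κ → scalar n (a κ) *ₙ schurSeries n κ) →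
    ∀ κ₀ → ∣ κ₀ ∣ ≡ d → ℓ κ₀ ℕ.≤ n → coeff n (V *ₙ H) (addρ (shape n κ₀)) ≡ a κ₀
  schurCoefficient {H} a d H≈ κ₀ ≡.refl ℓ≤n = begin
    coeff n (V *ₙ H) w₀
      ≡⟨ C.cong n w₀ (Pn.trans (Pn.*-congˡ H≈) (A.*-distribˡ-Σ n (partitionsOf d) _ V)) ⟩
    coeff n (A.Σ[_] n (partitionsOf d) λ κ → V *ₙ (scalar n (a κ) *ₙ schurSeries n κ)) w₀
      ≡⟨ C.Σ-map n w₀ (partitionsOf d) _ ⟩
    ∑ (partitionsOf d) (λ κ → coeff n (V *ₙ (scalar n (a κ) *ₙ schurSeries n κ)) w₀)
      ≡⟨ Aℤ.Σ-cong (partitionsOf d) (λ κ → ≡.trans (C.cong n w₀ (exchange κ)) (coeff-scalar n (a κ) _ w₀)) ⟩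
    ∑ (partitionsOf d) (λ κ → a κ ℤ.* coeff n (V *ₙ schurSeries n κ) w₀)
      ≡⟨ ∑-δ _ (partitionsOf-unique d) (∈-partitionsOf⁺ κ₀) (λ {κ} _ κ≢κ₀ → ≡.trans (≡.cong (a κ ℤ.*_) (other κ κ≢κ₀)) (ℤ.*-zeroʳ (a κ))) ⟩
    a κ₀ ℤ.* coeff n (V *ₙ schurSeries n κ₀) w₀
      ≡⟨ ≡.cong (a κ₀ ℤ.*_) (≡.trans (C.cong n w₀ (V-schurSeries κ₀ ℓ≤n)) (alternantCoeff-≡ (addρ-strictlyDecreasing (shape-decreasing n κ₀)))) ⟩
    a κ₀ ℤ.* + 1 ≡⟨ ℤ.*-identityʳ (a κ₀) ⟩
    a κ₀ ∎
    where
    open ≡.≡-Reasoning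
    w₀ = addρ (shape n κ₀)
    exchange : ∀ κ → V *ₙ (scalar n (a κ) *ₙ schurSeries n κ) ≈ₙ scalar n (a κ) *ₙ (V *ₙ schurSeries n κ)
    exchange κ = Pn.trans (Pn.sym (Pn.*-assoc V (scalar n (a κ)) (schurSeries n κ)))
      (Pn.trans (Pn.*-congʳ (Pn.*-comm V (scalar n (a κ)))) (Pn.*-assoc (scalar n (a κ)) V (schurSeries n κ)))
    other : ∀ κ → κ ≢ κ₀ → coeff n (V *ₙ schurSeries n κ) w₀ ≡ 0ℤ
    other κ κ≢κ₀ with ℕ.≤-<-connex (ℓ κ) n
    ... | inj₂ n<ℓ = ≡.trans (C.cong n w₀ (Pn.trans (Pn.*-congˡ (schurSeries-zero κ n<ℓ)) (Pn.zeroʳ V))) (C.zero# n w₀)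
    ... | inj₁ ℓκ≤n = ≡.trans (C.cong n w₀ (V-schurSeries κ ℓκ≤n))
      (alternantCoeff-≢ (addρ-strictlyDecreasing (shape-decreasing n κ)) (addρ-strictlyDecreasing (shape-decreasing n κ₀))
        λ eq → κ≢κ₀ (partition-≡ (pad-injective n ℓκ≤n ℓ≤n (proj₂ (isPartition κ)) (proj₂ (isPartition κ₀)) (addρ-injective eq))))

∈-splittings-sum : ∀ {n} (w : Vec ℕ n) {u v} → (u , v) ∈ splittings w → Vec.sum u ℕ.+ Vec.sum v ≡ Vec.sum w
∈-splittings-sum []      (here ≡.refl) = ≡.refl
∈-splittings-sum (k ∷ w) uv∈
  with i , (u , v) , i∈ , uv∈′ , ≡.refl ← ∈-cartesianProductWith⁻ _ (upTo (suc k)) (splittings w) uv∈ =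
  ≡.trans (lemma i (Vec.sum u) (k ℕ.∸ i) (Vec.sum v)) (≡.cong₂ ℕ._+_ (ℕ.m+[n∸m]≡n (ℕ.s≤s⁻¹ (∈-upTo⁻ i∈))) (∈-splittings-sum w uv∈′))
  where
  lemma : ∀ a b c d → (a ℕ.+ b) ℕ.+ (c ℕ.+ d) ≡ (a ℕ.+ c) ℕ.+ (b ℕ.+ d)
  lemma = solve-∀

coeff-*-degree : ∀ n {f g p q} → (∀ w → Vec.sum w ≢ p → coeff n f w ≡ 0ℤ) → (∀ w → Vec.sum w ≢ q → coeff n g w ≡ 0ℤ) →
  ∀ w → Vec.sum w ≢ p ℕ.+ q → coeff n (P._*_ n f g) w ≡ 0ℤ
coeff-*-degree n {f} {g} {p} {q} f-deg g-deg w deg = ≡.trans (coeff-* n f g w)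
  (≡.trans (Aℤ.Σ-cong-∈ (splittings w) (λ {(u , v)} uv∈ → zero-term u v (∈-splittings-sum w uv∈))) (∑-zero (splittings w)))
  where
  zero-term : ∀ u v → Vec.sum u ℕ.+ Vec.sum v ≡ Vec.sum w → coeff n f u ℤ.* coeff n g v ≡ 0ℤ
  zero-term u v eq with Vec.sum u ℕ.≟ p | Vec.sum v ℕ.≟ q
  ... | no u≢p     | _          = ≡.trans (≡.cong (ℤ._* coeff n g v) (f-deg u u≢p)) (ℤ.*-zeroˡ (coeff n g v))
  ... | yes _      | no v≢q     = ≡.trans (≡.cong (coeff n f u ℤ.*_) (g-deg v v≢q)) (ℤ.*-zeroʳ (coeff n f u))
  ... | yes ≡.refl | yes ≡.refl = contradiction (≡.sym eq) deg

sum-∷ʳ : ∀ {n} (w : Vec ℕ n) k → Vec.sum (w ∷ʳ k) ≡ Vec.sum w ℕ.+ k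
sum-∷ʳ []      k = ℕ.+-comm k 0
sum-∷ʳ (x ∷ w) k = ≡.trans (≡.cong (x ℕ.+_) (sum-∷ʳ w k)) (≡.sym (ℕ.+-assoc x _ k))

sum-reverse : ∀ {n} (w : Vec ℕ n) → Vec.sum (Vec.reverse w) ≡ Vec.sum w
sum-reverse []      = ≡.refl
sum-reverse (k ∷ w) = begin
  Vec.sum (Vec.reverse (k ∷ w))   ≡⟨ ≡.cong Vec.sum (Vec.reverse-∷ k w) ⟩
  Vec.sum (Vec.reverse w ∷ʳ k)    ≡⟨ sum-∷ʳ (Vec.reverse w) k ⟩
  Vec.sum (Vec.reverse w) ℕ.+ k   ≡⟨ ≡.cong (ℕ._+ k) (sum-reverse w) ⟩
  Vec.sum w ℕ.+ k                 ≡⟨ ℕ.+-comm _ k ⟩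
  k ℕ.+ Vec.sum w                 ∎
  where open ≡.≡-Reasoning

mulʳ-linear : ∀ R (g : CommutativeRing.Carrier R) → LinearMaps.IsLinear R R (λ f → CommutativeRing._*_ R f g)
mulʳ-linear R g = record
  { cong = *-congʳ ; add = distribʳ g ; zero# = zeroˡ g ; -1#* = λ f → *-assoc _ f g }
  where open CommutativeRing R

-- Coefficient bounds for products with alternants

laplace-bound : ∀ {n C} (φ : ℕ → Vec ℕ n → ℤ) l → (∀ e r → ℤ.∣ φ e r ∣ ℕ.≤ C) → ℤ.∣ Aℤ.laplace φ l ∣ ℕ.≤ suc n ℕ.* C
laplace-bound {zero}  {C} φ (x ∷ []) φ≤C = ℕ.≤-trans (φ≤C x []) (ℕ.≤-reflexive (≡.sym (ℕ.*-identityˡ C)))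
laplace-bound {suc n} {C} φ (x ∷ l)  φ≤C = begin
  ℤ.∣ φ x l ℤ.+ ℤ.- (+ 1) ℤ.* rest ∣           ≤⟨ ℤ.∣i+j∣≤∣i∣+∣j∣ (φ x l) _ ⟩
  ℤ.∣ φ x l ∣ ℕ.+ ℤ.∣ ℤ.- (+ 1) ℤ.* rest ∣     ≡⟨ ≡.cong (ℤ.∣ φ x l ∣ ℕ.+_) (≡.trans (ℤ.abs-* (ℤ.- (+ 1)) rest) (ℕ.*-identityˡ _)) ⟩
  ℤ.∣ φ x l ∣ ℕ.+ ℤ.∣ rest ∣                   ≤⟨ ℕ.+-mono-≤ (φ≤C x l) (laplace-bound _ l λ e r → φ≤C e (x ∷ r)) ⟩
  C ℕ.+ suc n ℕ.* C                            ∎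
  where
  open ℕ.≤-Reasoning
  rest = Aℤ.laplace (λ e r → φ e (x ∷ r)) l

-- Multiplication by a power of the first variable only shifts coefficients, with zeros moving in.
monomial-⋆-bound : ∀ n {C} e a (G : ⟪ suc n ⟫) k w → (∀ j → ℤ.∣ coeff n (P._*_ n a (G j)) w ∣ ℕ.≤ C) →
  ℤ.∣ coeff n (PowerSeries._⋆_ (powerSeries n) (PowerSeries.monomial (powerSeries n) e a) G k) w ∣ ℕ.≤ C
monomial-⋆-bound n zero    a G k       w a≤ = ℕ.≤-trans (ℕ.≤-reflexive (≡.cong ℤ.∣_∣ (C.cong n w (PowerSeries.constant-⋆ (powerSeries n) a G k)))) (a≤ k)
monomial-⋆-bound n (suc e) a G zero    w a≤ =
  ℕ.≤-trans (ℕ.≤-reflexive (≡.cong ℤ.∣_∣ (≡.trans (C.cong n w (P.zeroˡ n (G 0))) (C.zero# n w)))) z≤n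
monomial-⋆-bound n (suc e) a G (suc k) w a≤ =
  ℕ.≤-trans (ℕ.≤-reflexive (≡.cong ℤ.∣_∣ (C.cong n w (P.trans n (P.+-congʳ n (P.zeroˡ n (G (suc k)))) (P.+-identityˡ n _)))))
    (monomial-⋆-bound n e a G k w a≤)

-- The factorial builds up by induction: the expansion along the first variable has `suc n` terms,
-- each a shift times an alternant in one variable fewer.
alternant-*-bound : ∀ n (l : Vec ℕ n) (G : ⟪ n ⟫) {M} → (∀ v → ℤ.∣ coeff n G v ∣ ℕ.≤ M) →
  ∀ w → ℤ.∣ coeff n (P._*_ n (A.alternant n l (variables n)) G) w ∣ ℕ.≤ n ! ℕ.* M
alternant-*-bound zero    []  G {M} G≤M []      = ℕ.≤-trans (ℕ.≤-reflexive (≡.cong ℤ.∣_∣ (ℤ.*-identityˡ G)))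
  (ℕ.≤-trans (G≤M []) (ℕ.≤-reflexive (≡.sym (ℕ.+-identityʳ M))))
alternant-*-bound (suc n) l G {M} G≤M (k ∷ w) = begin
  ℤ.∣ coeff (suc n) (P._*_ (suc n) (A.laplace (suc n) term l) G) (k ∷ w) ∣
    ≡⟨ ≡.cong ℤ.∣_∣ (≡.trans (C.cong (suc n) (k ∷ w) (LinearMaps.IsLinear.laplace-map (mulʳ-linear (powerSeries (suc n)) G) term l))
                            (C.laplace-map (suc n) (k ∷ w) (λ e r → P._*_ (suc n) (term e r) G) l)) ⟩
  ℤ.∣ Aℤ.laplace (λ e r → coeff (suc n) (P._*_ (suc n) (term e r) G) (k ∷ w)) l ∣
    ≤⟨ laplace-bound _ l term-bound ⟩
  suc n ℕ.* (n ! ℕ.* M) ≡⟨ ℕ.*-assoc (suc n) (n !) M ⟨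
  suc n ! ℕ.* M ∎
  where
  open ℕ.≤-Reasoning
  open PowerSeries (powerSeries n)
  open import Algebra.Properties.Semiring.Exp (P.semiring (suc n)) using (_^_)
  term : ℕ → Vec ℕ n → ⟪ suc n ⟫
  term e r = P._*_ (suc n) (variableX ^ e) (A.alternant (suc n) r (Vec.map constant (variables n)))
  term≈ : ∀ e r → P._≈_ (suc n) (term e r) (monomial e (A.alternant n r (variables n)))
  term≈ e r k = P.trans n (P.*-congˡ (suc n) {x = variableX ^ e} (alternant-constant (powerSeries n) r (variables n)) k)
    (variableX^-constant e (A.alternant n r (variables n)) k)
  term-bound : ∀ e r → ℤ.∣ coeff (suc n) (P._*_ (suc n) (term e r) G) (k ∷ w) ∣ ℕ.≤ n ! ℕ.* M
  term-bound e r = ℕ.≤-trans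
    (ℕ.≤-reflexive (≡.cong ℤ.∣_∣ (C.cong n w (P.*-congʳ (suc n) {x = G} (term≈ e r) k))))
    (monomial-⋆-bound n e (A.alternant n r (variables n)) G k w λ j → alternant-*-bound n r (G j) (λ v → G≤M (j ∷ v)) w)

module LittlewoodRichardson (c : Partition → Partition → Partition → ℤ) (isLR : IsLittlewoodRichardson c) (n : ℕ) where

  private
    open module Pn = CommutativeRing (powerSeries n) using () renaming (_*_ to _*ₙ_; _≈_ to _≈ₙ_; 0# to 0ₙ)
    S = schurSeries n

  coeff-product : ∀ μ ν w → coeff n (S μ *ₙ S ν) w ≡ ∑ (partitionsOf (Vec.sum w)) λ κ → c μ ν κ ℤ.* coeff n (S κ) w
  coeff-product μ ν w = begin
    coeff n (S μ *ₙ S ν) w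
      ≡⟨ coeff-* n (S μ) (S ν) w ⟩
    ∑ (splittings w) (λ (u , v) → coeff n (S μ) u ℤ.* coeff n (S ν) v)
      ≡⟨ Aℤ.Σ-cong (splittings w) (λ (u , v) → ≡.cong₂ ℤ._*_ (coeff-fromCoeffs n _ u) (coeff-fromCoeffs n _ v)) ⟩
    ∑ (splittings w) (λ (u , v) → schur μ (Vec.reverse u) ℤ.* schur ν (Vec.reverse v))
      ≡⟨ ∑-splittings-reverse w (λ (u , v) → schur μ u ℤ.* schur ν v) ⟨
    (schur μ ⊛ schur ν) (Vec.reverse w)
      ≡⟨ isLR μ ν (Vec.reverse w) ⟩
    ∑ (partitionsOf (Vec.sum (Vec.reverse w))) (λ κ → c μ ν κ ℤ.* schur κ (Vec.reverse w))
      ≡⟨ ≡.cong (λ d → ∑ (partitionsOf d) (λ κ → c μ ν κ ℤ.* schur κ (Vec.reverse w))) (sum-reverse w) ⟩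
    ∑ (partitionsOf (Vec.sum w)) (λ κ → c μ ν κ ℤ.* schur κ (Vec.reverse w))
      ≡⟨ Aℤ.Σ-cong (partitionsOf (Vec.sum w)) (λ κ → ≡.cong (c μ ν κ ℤ.*_) (coeff-fromCoeffs n (λ w → schur κ (Vec.reverse w)) w)) ⟨
    ∑ (partitionsOf (Vec.sum w)) (λ κ → c μ ν κ ℤ.* coeff n (S κ) w) ∎
    where open ≡.≡-Reasoning

  coeff-combination : ∀ (a : Partition → ℤ) d w →
    coeff n (A.Σ[_] n (partitionsOf d) (λ κ → scalar n (a κ) *ₙ S κ)) w ≡ ∑ (partitionsOf d) λ κ → a κ ℤ.* coeff n (S κ) w
  coeff-combination a d w = ≡.trans (C.Σ-map n w (partitionsOf d) _)
    (Aℤ.Σ-cong (partitionsOf d) λ κ → coeff-scalar n (a κ) (S κ) w)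

  combination-degree : ∀ (a : Partition → ℤ) d w → Vec.sum w ≢ d → ∑ (partitionsOf d) (λ κ → a κ ℤ.* coeff n (S κ) w) ≡ 0ℤ
  combination-degree a d w deg = ≡.trans (Aℤ.Σ-cong-∈ (partitionsOf d) (λ {κ} κ∈ →
      ≡.trans (≡.cong (a κ ℤ.*_) (schurSeries-degree n κ w λ eq → deg (≡.trans eq (∈-partitionsOf⁻ κ∈)))) (ℤ.*-zeroʳ (a κ))))
    (∑-zero (partitionsOf d))

  product-degree : ∀ μ ν w → Vec.sum w ≢ ∣ μ ∣ ℕ.+ ∣ ν ∣ → coeff n (S μ *ₙ S ν) w ≡ 0ℤ
  product-degree μ ν = coeff-*-degree n (schurSeries-degree n μ) (schurSeries-degree n ν)

  -- `IsSchurExpansion` sums over the partitions of the degree of the monomial at hand,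
  -- `schurCoefficient` over those of one fixed degree. They agree because the product is
  -- homogeneous: in any other degree both sides vanish.
  c-formula : ∀ μ ν κ → ∣ μ ∣ ℕ.+ ∣ ν ∣ ≡ ∣ κ ∣ → ℓ κ ℕ.≤ n → c μ ν κ ≡ coeff n (V n *ₙ (S μ *ₙ S ν)) (addρ (shape n κ))
  c-formula μ ν κ deg ℓ≤n = ≡.sym (schurCoefficient n (c μ ν) ∣ κ ∣ (coeff-ext n expansion) κ ≡.refl ℓ≤n)
    where
    expansion : ∀ w → coeff n (S μ *ₙ S ν) w ≡ coeff n (A.Σ[_] n (partitionsOf ∣ κ ∣) (λ κ → scalar n (c μ ν κ) *ₙ S κ)) w
    expansion w with Vec.sum w ℕ.≟ ∣ κ ∣
    ... | yes eq = ≡.trans (coeff-product μ ν w)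
      (≡.trans (≡.cong (λ d → ∑ (partitionsOf d) λ κ → c μ ν κ ℤ.* coeff n (S κ) w) eq) (≡.sym (coeff-combination (c μ ν) ∣ κ ∣ w)))
    ... | no ≢κ = ≡.trans (product-degree μ ν w (λ eq → ≢κ (≡.trans eq deg)))
      (≡.sym (≡.trans (coeff-combination (c μ ν) ∣ κ ∣ w) (combination-degree (c μ ν) ∣ κ ∣ w ≢κ)))

  -- The expansion in degree |κ| represents the component of the product in that degree, which is
  -- zero. So `schurCoefficient` is applied to the zero series.
  c-degree : ∀ μ ν κ → ∣ μ ∣ ℕ.+ ∣ ν ∣ ≢ ∣ κ ∣ → ℓ κ ℕ.≤ n → c μ ν κ ≡ 0ℤ
  c-degree μ ν κ deg ℓ≤n = ≡.trans (≡.sym (schurCoefficient n (c μ ν) ∣ κ ∣ (coeff-ext n expansion) κ ≡.refl ℓ≤n))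
    (≡.trans (C.cong n (addρ (shape n κ)) (Pn.zeroʳ (V n))) (C.zero# n (addρ (shape n κ))))
    where
    expansion : ∀ w → coeff n 0ₙ w ≡ coeff n (A.Σ[_] n (partitionsOf ∣ κ ∣) (λ κ → scalar n (c μ ν κ) *ₙ S κ)) w
    expansion w = ≡.trans (C.zero# n w) (≡.sym (≡.trans (coeff-combination (c μ ν) ∣ κ ∣ w) vanish))
      where
      vanish : ∑ (partitionsOf ∣ κ ∣) (λ κ → c μ ν κ ℤ.* coeff n (S κ) w) ≡ 0ℤ
      vanish with Vec.sum w ℕ.≟ ∣ κ ∣
      ... | no ≢κ  = combination-degree (c μ ν) ∣ κ ∣ w ≢κ
      ... | yes eq = ≡.trans (≡.cong (λ d → ∑ (partitionsOf d) λ κ → c μ ν κ ℤ.* coeff n (S κ) w) (≡.sym eq))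
        (≡.trans (≡.sym (coeff-product μ ν w)) (product-degree μ ν w (λ eq′ → deg (≡.trans (≡.sym eq′) eq))))

  private
    product-zero : ∀ μ ν κ → ℓ κ ℕ.≤ n → S μ *ₙ S ν ≈ₙ 0ₙ → c μ ν κ ≡ 0ℤ
    product-zero μ ν κ ℓ≤n eq with ∣ μ ∣ ℕ.+ ∣ ν ∣ ℕ.≟ ∣ κ ∣
    ... | no  deg = c-degree μ ν κ deg ℓ≤n
    ... | yes deg = ≡.trans (c-formula μ ν κ deg ℓ≤n)
      (≡.trans (C.cong n (addρ (shape n κ)) (Pn.trans (Pn.*-congˡ eq) (Pn.zeroʳ (V n)))) (C.zero# n (addρ (shape n κ))))

  -- In n variables s_μ vanishes, whereas s_κ survives and its coefficient can still be read off.
  -- This limits the lengths of α, β and γ.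
  c-longˡ : ∀ μ ν κ → ℓ κ ℕ.≤ n → n ℕ.< ℓ μ → c μ ν κ ≡ 0ℤ
  c-longˡ μ ν κ ℓ≤n n<ℓ = product-zero μ ν κ ℓ≤n (Pn.trans (Pn.*-congʳ (schurSeries-zero n μ n<ℓ)) (Pn.zeroˡ (S ν)))

  c-longʳ : ∀ μ ν κ → ℓ κ ℕ.≤ n → n ℕ.< ℓ ν → c μ ν κ ≡ 0ℤ
  c-longʳ μ ν κ ℓ≤n n<ℓ = product-zero μ ν κ ℓ≤n (Pn.trans (Pn.*-congˡ (schurSeries-zero n ν n<ℓ)) (Pn.zeroʳ (S μ)))

  c-bound : ∀ μ ν κ {M} → ∣ μ ∣ ℕ.+ ∣ ν ∣ ≡ ∣ κ ∣ → ℓ μ ℕ.≤ n → ℓ ν ℕ.≤ n → ℓ κ ℕ.≤ n → (∀ v → kostka (shape n ν) v ℕ.≤ M) →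
    ℤ.∣ c μ ν κ ∣ ℕ.≤ n ! ℕ.* M
  c-bound μ ν κ {M} deg ℓμ ℓν ℓκ K≤M = begin
    ℤ.∣ c μ ν κ ∣
      ≡⟨ ≡.cong ℤ.∣_∣ (c-formula μ ν κ deg ℓκ) ⟩
    ℤ.∣ coeff n (V n *ₙ (S μ *ₙ S ν)) w ∣
      ≡⟨ ≡.cong ℤ.∣_∣ (C.cong n w (Pn.trans (Pn.sym (Pn.*-assoc (V n) (S μ) (S ν))) (Pn.*-congʳ (V-schurSeries n μ ℓμ)))) ⟩
    ℤ.∣ coeff n (A.alternant n (addρ (shape n μ)) (variables n) *ₙ S ν) w ∣
      ≤⟨ alternant-*-bound n (addρ (shape n μ)) (S ν) S≤M w ⟩
    n ! ℕ.* M ∎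
    where
    open ℕ.≤-Reasoning
    w = addρ (shape n κ)
    S≤M : ∀ v → ℤ.∣ coeff n (S ν) v ∣ ℕ.≤ M
    S≤M v = ℕ.≤-trans (ℕ.≤-reflexive (≡.cong ℤ.∣_∣ (≡.trans (coeff-fromCoeffs n _ v) (schur-kostka ν v ℓν)))) (K≤M v)

-- Counting

boundedVecs : ∀ m → ℕ → List (Vec ℕ m)
boundedVecs zero    B = [] ∷ []
boundedVecs (suc m) B = cartesianProductWith _∷_ (upTo (suc B)) (boundedVecs m B)

length-cartesianProductWith : {A B C : Set} (f : A → B → C) (xs : List A) (ys : List B) →
  length (cartesianProductWith f xs ys) ≡ length xs ℕ.* length ys
length-cartesianProductWith f []       ys = ≡.refl
length-cartesianProductWith f (x ∷ xs) ys = ≡.trans (List.length-++ (map (f x) ys))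
  (≡.cong₂ ℕ._+_ (List.length-map (f x) ys) (length-cartesianProductWith f xs ys))

length-boundedVecs : ∀ m B → length (boundedVecs m B) ≡ suc B ℕ.^ m
length-boundedVecs zero    B = ≡.refl
length-boundedVecs (suc m) B = ≡.trans (length-cartesianProductWith _∷_ (upTo (suc B)) (boundedVecs m B))
  (≡.cong₂ ℕ._*_ (List.length-upTo (suc B)) (length-boundedVecs m B))

∈-boundedVecs : ∀ {m B} (v : Vec ℕ m) → Vec.sum v ℕ.≤ B → v ∈ boundedVecs m B
∈-boundedVecs []      _  = here ≡.refl
∈-boundedVecs (x ∷ v) ≤B = ∈-cartesianProductWith⁺ _∷_ (∈-upTo⁺ (s≤s (ℕ.m+n≤o⇒m≤o x ≤B))) (∈-boundedVecs v (ℕ.m+n≤o⇒n≤o x ≤B))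

-- A vector is determined by its sum and all its entries but the first.
vecs-of-sum-length : ∀ {n s B} {vs : List (Vec ℕ n)} → Unique vs → (∀ {v} → v ∈ vs → Vec.sum v ≡ s) → s ℕ.≤ B →
  length vs ℕ.≤ suc B ℕ.^ (n ℕ.∸ 1)
vecs-of-sum-length {zero}      vs! sum≡ s≤B = ⊆-length {ys = [] ∷ []} vs! λ { {[]} _ → here ≡.refl }
vecs-of-sum-length {suc n} {s} {B} vs! sum≡ s≤B = ℕ.≤-trans
  (injection-length Vec.tail vs! (λ { {x ∷ v} v∈ → ∈-boundedVecs v (ℕ.m+n≤o⇒n≤o x (ℕ.≤-trans (ℕ.≤-reflexive (sum≡ v∈)) s≤B)) })
    λ { {x ∷ v} {y ∷ .v} v∈ u∈ ≡.refl → ≡.cong (_∷ v) (ℕ.+-cancelʳ-≡ (Vec.sum v) x y (≡.trans (sum≡ v∈) (≡.sym (sum≡ u∈)))) })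
  (ℕ.≤-reflexive (length-boundedVecs n B))

length-concatMap : {A B : Set} (f : A → List B) (xs : List A) {C : ℕ} → (∀ {x} → x ∈ xs → length (f x) ℕ.≤ C) →
  length (concatMap f xs) ℕ.≤ length xs ℕ.* C
length-concatMap f []       f≤ = z≤n
length-concatMap f (x ∷ xs) f≤ = ℕ.≤-trans (ℕ.≤-reflexive (List.length-++ (f x)))
  (ℕ.+-mono-≤ (f≤ (here ≡.refl)) (length-concatMap f xs (f≤ ∘ there)))

-- The sum of k ∸ 1 over k < n: a row of length k of a Gelfand-Tsetlin pattern with prescribed sum
-- has k ∸ 1 free entries. The truncation accounts for the empty row.
patternDimension : ℕ → ℕ
patternDimension zero    = 0
patternDimension (suc n) = n ℕ.∸ 1 ℕ.+ patternDimension n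

kostka-bound : ∀ {n B} {κ : Vec ℕ n} → Decreasing κ → Vec.sum κ ℕ.≤ B → ∀ w → kostka κ w ℕ.≤ suc B ℕ.^ patternDimension n
kostka-bound {zero} {κ = []} _ _ [] = ℕ.≤-refl
kostka-bound {suc n} {B} {κ} κ↓ ≤B (k ∷ w) = begin
  kostka κ (k ∷ w)
    ≤⟨ length-concatMap _ (filter P? (interlacings κ)) (λ {λ′} λ∈ → ℕ.≤-trans (ℕ.≤-reflexive (List.length-map (extend κ) (tableaux λ′ w)))
         (kostka-bound (interlaces-decreasing (interlaces λ∈)) (ℕ.≤-trans (interlaces-sum (interlaces λ∈)) ≤B) w)) ⟩
  length (filter P? (interlacings κ)) ℕ.* suc B ℕ.^ patternDimension n
    ≤⟨ ℕ.*-monoˡ-≤ (suc B ℕ.^ patternDimension n) (vecs-of-sum-length (Unique.filter⁺ P? (interlacings-unique κ)) sum≡ (ℕ.≤-trans (ℕ.m∸n≤m (Vec.sum κ) k) ≤B)) ⟩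
  suc B ℕ.^ (n ℕ.∸ 1) ℕ.* suc B ℕ.^ patternDimension n
    ≡⟨ ℕ.^-distribˡ-+-* (suc B) (n ℕ.∸ 1) (patternDimension n) ⟨
  suc B ℕ.^ patternDimension (suc n) ∎
  where
  open ℕ.≤-Reasoning
  P? : ∀ λ′ → Dec (Vec.sum κ ℕ.∸ Vec.sum λ′ ≡ k)
  P? λ′ = Vec.sum κ ℕ.∸ Vec.sum λ′ ℕ.≟ k
  interlaces : ∀ {λ′} → λ′ ∈ filter P? (interlacings κ) → Interlaces κ λ′
  interlaces λ∈ = ∈-interlacings⁻ κ↓ (proj₁ (∈-filter⁻ P? {xs = interlacings κ} λ∈))
  -- The prescribed multiplicity `k` fixes the size of the next row and so saves one factor `suc B`
  -- per row.
  sum≡ : ∀ {λ′} → λ′ ∈ filter P? (interlacings κ) → Vec.sum λ′ ≡ Vec.sum κ ℕ.∸ k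
  sum≡ λ∈ = ≡.trans (≡.sym (ℕ.m∸[m∸n]≡n (interlaces-sum (interlaces λ∈))))
    (≡.cong (Vec.sum κ ℕ.∸_) (proj₂ (∈-filter⁻ P? {xs = interlacings κ} λ∈)))

HasSizeAndLength : ℕ → ℕ → Partition → Set
HasSizeAndLength d n κ = ∣ κ ∣ ≡ d × ℓ κ ℕ.≤ n

hasSizeAndLength? : ∀ d n κ → Dec (HasSizeAndLength d n κ)
hasSizeAndLength? d n κ = (∣ κ ∣ ℕ.≟ d) ×-dec (ℓ κ ℕ.≤? n)

-- Padded to length n, these partitions are distinct vectors of sum `d`. The bound does not involve
-- the range `D` of the summation.
partitions-length : ∀ {d n B D} → d ℕ.≤ B → length (filter (hasSizeAndLength? d n) (partitionsUpTo D)) ℕ.≤ suc B ℕ.^ (n ℕ.∸ 1)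
partitions-length {d} {n} {B} {D} d≤B = ℕ.≤-trans (ℕ.≤-reflexive (≡.sym (List.length-map (shape n) ps)))
  (vecs-of-sum-length (map-unique (shape n) (Unique.filter⁺ (hasSizeAndLength? d n) (partitionsUpTo-unique D))
      λ {κ} {κ′} κ∈ κ′∈ eq → partition-≡ (pad-injective n (proj₂ (member κ∈)) (proj₂ (member κ′∈)) (proj₂ (isPartition κ)) (proj₂ (isPartition κ′)) eq))
    (λ v∈ → let κ , κ∈ , eq = ∈-map⁻ (shape n) v∈ in
      ≡.trans (≡.cong Vec.sum eq) (≡.trans (pad-sum n (parts κ) (proj₂ (member κ∈))) (proj₁ (member κ∈))))
    d≤B)
  where
  ps = filter (hasSizeAndLength? d n) (partitionsUpTo D)
  member : ∀ {κ} → κ ∈ ps → HasSizeAndLength d n κ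
  member κ∈ = proj₂ (∈-filter⁻ (hasSizeAndLength? d n) {xs = partitionsUpTo D} κ∈)

∑-bound : {A : Set} {P : A → Set} (P? : ∀ x → Dec (P x)) (xs : List A) (f : A → ℤ) {C : ℕ} →
  (∀ x → ℤ.∣ f x ∣ ℕ.≤ C) → (∀ x → ¬ P x → f x ≡ 0ℤ) → ℤ.∣ ∑ xs f ∣ ℕ.≤ length (filter P? xs) ℕ.* C
∑-bound P? []       f f≤C f≡0 = z≤n
∑-bound P? (x ∷ xs) f {C} f≤C f≡0 with P? x
... | yes _ = ℕ.≤-trans (ℤ.∣i+j∣≤∣i∣+∣j∣ (f x) (∑ xs f)) (ℕ.+-mono-≤ (f≤C x) (∑-bound P? xs f f≤C f≡0))
... | no ¬p = ℕ.≤-trans (ℕ.≤-reflexive (≡.cong ℤ.∣_∣ (≡.trans (≡.cong (ℤ._+ ∑ xs f) (f≡0 x ¬p)) (ℤ.+-identityˡ (∑ xs f))))) (∑-bound P? xs f f≤C f≡0)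

∑-partitions-bound : ∀ n d D {B C} (f : Partition → ℤ) → d ℕ.≤ B → (∀ κ → ℤ.∣ f κ ∣ ℕ.≤ C) →
  (∀ κ → ¬ HasSizeAndLength d n κ → f κ ≡ 0ℤ) → ℤ.∣ ∑ (partitionsUpTo D) f ∣ ℕ.≤ suc B ℕ.^ (n ℕ.∸ 1) ℕ.* C
∑-partitions-bound n d D {C = C} f d≤B f≤C f≡0 = ℕ.≤-trans
  (∑-bound (hasSizeAndLength? d n) (partitionsUpTo D) f f≤C f≡0)
  (ℕ.*-monoˡ-≤ C (partitions-length {d} {n} {D = D} d≤B))

-- Growth of the Newell-Littlewood coefficients

module NewellLittlewoodBound (c : Partition → Partition → Partition → ℤ) (isLR : IsLittlewoodRichardson c)
  (n : ℕ) (μ ν κ : Partition) (ℓμ : ℓ μ ℕ.≤ n) (ℓν : ℓ ν ℕ.≤ n) (ℓκ : ℓ κ ℕ.≤ n)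
  (D : ℕ) (μνκ≤D : ∣ μ ∣ ℕ.+ ∣ ν ∣ ℕ.+ ∣ κ ∣ ℕ.≤ D) where

  open LittlewoodRichardson c isLR n

  μ≤D : ∣ μ ∣ ℕ.≤ D
  μ≤D = ℕ.m+n≤o⇒m≤o ∣ μ ∣ (ℕ.m+n≤o⇒m≤o (∣ μ ∣ ℕ.+ ∣ ν ∣) μνκ≤D)
  ν≤D : ∣ ν ∣ ℕ.≤ D
  ν≤D = ℕ.m+n≤o⇒n≤o ∣ μ ∣ (ℕ.m+n≤o⇒m≤o (∣ μ ∣ ℕ.+ ∣ ν ∣) μνκ≤D)
  κ≤D : ∣ κ ∣ ℕ.≤ D
  κ≤D = ℕ.m+n≤o⇒n≤o (∣ μ ∣ ℕ.+ ∣ ν ∣) μνκ≤D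

  -- The base is that of `N`, where the sizes of α, β and γ are only bounded by `D + D`, so that all
  -- the powers can be merged later.
  C : ℕ
  C = n ! ℕ.* suc (D ℕ.+ D) ℕ.^ patternDimension n

  c-nonzero : ∀ α β π → ℓ π ℕ.≤ n → c α β π ≡ 0ℤ ⊎ (∣ α ∣ ℕ.+ ∣ β ∣ ≡ ∣ π ∣ × ℓ α ℕ.≤ n × ℓ β ℕ.≤ n)
  c-nonzero α β π ℓπ with ∣ α ∣ ℕ.+ ∣ β ∣ ℕ.≟ ∣ π ∣ | ℕ.≤-<-connex (ℓ α) n | ℕ.≤-<-connex (ℓ β) n
  ... | no deg  | _        | _        = inj₁ (c-degree α β π deg ℓπ)
  ... | yes _   | inj₂ n<ℓ | _        = inj₁ (c-longˡ α β π ℓπ n<ℓ)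
  ... | yes _   | inj₁ _   | inj₂ n<ℓ = inj₁ (c-longʳ α β π ℓπ n<ℓ)
  ... | yes deg | inj₁ ℓα  | inj₁ ℓβ  = inj₂ (deg , ℓα , ℓβ)

  c≤C : ∀ α β π → ℓ π ℕ.≤ n → ∣ π ∣ ℕ.≤ D → ℤ.∣ c α β π ∣ ℕ.≤ C
  c≤C α β π ℓπ π≤D with c-nonzero α β π ℓπ
  ... | inj₁ c≡0             = ℕ.≤-trans (ℕ.≤-reflexive (≡.cong ℤ.∣_∣ c≡0)) z≤n
  ... | inj₂ (deg , ℓα , ℓβ) = c-bound α β π deg ℓα ℓβ ℓπ (kostka-bound (shape-decreasing n β)
    (ℕ.≤-trans (ℕ.≤-reflexive (pad-sum n (parts β) ℓβ)) (ℕ.≤-trans (ℕ.m+n≤o⇒n≤o ∣ α ∣ (ℕ.≤-reflexive deg)) (ℕ.≤-trans π≤D (ℕ.m≤m+n D D)))))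

  term : Partition → Partition → Partition → ℤ
  term α β γ = c α β μ ℤ.* c α γ ν ℤ.* c β γ κ

  term-bound : ∀ α β γ → ℤ.∣ term α β γ ∣ ℕ.≤ C ℕ.* C ℕ.* C
  term-bound α β γ = ℕ.≤-trans
    (ℕ.≤-reflexive (≡.trans (ℤ.abs-* (c α β μ ℤ.* c α γ ν) (c β γ κ)) (≡.cong (ℕ._* ℤ.∣ c β γ κ ∣) (ℤ.abs-* (c α β μ) (c α γ ν)))))
    (ℕ.*-mono-≤ (ℕ.*-mono-≤ (c≤C α β μ ℓμ μ≤D) (c≤C α γ ν ℓν ν≤D)) (c≤C β γ κ ℓκ κ≤D))

  -- The solution of |α| + |β| = |μ|, |α| + |γ| = |ν|, |β| + |γ| = |κ|. If this system has no
  -- solution in natural numbers, the truncated values do no harm, since then every term is zero.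
  sizeα sizeβ sizeγ : ℕ
  sizeα = (∣ μ ∣ ℕ.+ ∣ ν ∣ ℕ.∸ ∣ κ ∣) / 2
  sizeβ = (∣ μ ∣ ℕ.+ ∣ κ ∣ ℕ.∸ ∣ ν ∣) / 2
  sizeγ = (∣ ν ∣ ℕ.+ ∣ κ ∣ ℕ.∸ ∣ μ ∣) / 2

  size : ∀ {x y z p q r} → x ℕ.+ y ≡ p → x ℕ.+ z ≡ q → y ℕ.+ z ≡ r → x ≡ (p ℕ.+ q ℕ.∸ r) / 2
  size {x} {y} {z} ≡.refl ≡.refl ≡.refl = ≡.sym (≡.trans
    (≡.cong (_/ 2) (≡.trans (≡.cong (ℕ._∸ (y ℕ.+ z)) (lemma x y z)) (ℕ.m+n∸n≡m (x ℕ.* 2) (y ℕ.+ z))))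
    (m*n/n≡m x 2))
    where
    lemma : ∀ x y z → x ℕ.+ y ℕ.+ (x ℕ.+ z) ≡ x ℕ.* 2 ℕ.+ (y ℕ.+ z)
    lemma = solve-∀

  term-nonzero : ∀ α β γ → term α β γ ≡ 0ℤ ⊎
    (HasSizeAndLength sizeα n α × HasSizeAndLength sizeβ n β × HasSizeAndLength sizeγ n γ)
  term-nonzero α β γ with c-nonzero α β μ ℓμ | c-nonzero α γ ν ℓν | c-nonzero β γ κ ℓκ
  ... | inj₁ c≡0 | _ | _ = inj₁ (≡.cong (λ z → z ℤ.* c α γ ν ℤ.* c β γ κ) c≡0)
  ... | inj₂ _ | inj₁ c≡0 | _ =
    inj₁ (≡.cong (ℤ._* c β γ κ) (≡.trans (≡.cong (c α β μ ℤ.*_) c≡0) (ℤ.*-zeroʳ (c α β μ))))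
  ... | inj₂ _ | inj₂ _ | inj₁ c≡0 = inj₁ (≡.trans (≡.cong (c α β μ ℤ.* c α γ ν ℤ.*_) c≡0) (ℤ.*-zeroʳ (c α β μ ℤ.* c α γ ν)))
  ... | inj₂ (αβ , ℓα , ℓβ) | inj₂ (αγ , _ , ℓγ) | inj₂ (βγ , _) = inj₂
    ( (size αβ αγ βγ , ℓα)
    , (size (≡.trans (ℕ.+-comm ∣ β ∣ ∣ α ∣) αβ) βγ αγ , ℓβ)
    , (size (≡.trans (ℕ.+-comm ∣ γ ∣ ∣ α ∣) αγ) (≡.trans (ℕ.+-comm ∣ γ ∣ ∣ β ∣) βγ) αβ , ℓγ) )

  half-bound : ∀ {p q s} r → p ℕ.≤ s → q ℕ.≤ s → (p ℕ.+ q ℕ.∸ r) / 2 ℕ.≤ s ℕ.+ s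
  half-bound {p} {q} r p≤s q≤s = ℕ.≤-trans (m/n≤m (p ℕ.+ q ℕ.∸ r) 2) (ℕ.≤-trans (ℕ.m∸n≤m (p ℕ.+ q) r) (ℕ.+-mono-≤ p≤s q≤s))

  N : ℕ
  N = suc (D ℕ.+ D) ℕ.^ (n ℕ.∸ 1)

  newellLittlewood-bound : ℤ.∣ newellLittlewood c μ ν κ ∣ ℕ.≤ N ℕ.* (N ℕ.* (N ℕ.* (C ℕ.* C ℕ.* C)))
  newellLittlewood-bound =
    ∑-partitions-bound n sizeα ∣ μ ∣ _ (half-bound ∣ κ ∣ μ≤D ν≤D)
      (λ α → ∑-partitions-bound n sizeβ ∣ μ ∣ _ (half-bound ∣ ν ∣ μ≤D κ≤D)
        (λ β → ∑-partitions-bound n sizeγ ∣ ν ∣ (term α β) (half-bound ∣ μ ∣ ν≤D κ≤D) (term-bound α β)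
          λ γ ¬γ → when α β γ λ (_ , _ , pγ) → ¬γ pγ)
        λ β ¬β → zero-sum (partitionsUpTo ∣ ν ∣) λ γ → when α β γ λ (_ , pβ , _) → ¬β pβ)
      λ α ¬α → zero-sum (partitionsUpTo ∣ μ ∣) λ β → zero-sum (partitionsUpTo ∣ ν ∣) λ γ → when α β γ λ (pα , _) → ¬α pα
    where
    when : ∀ α β γ → ¬ (HasSizeAndLength sizeα n α × HasSizeAndLength sizeβ n β × HasSizeAndLength sizeγ n γ) → term α β γ ≡ 0ℤ
    when α β γ ¬p with term-nonzero α β γ
    ... | inj₁ ≡0 = ≡0
    ... | inj₂ p  = contradiction p ¬p
    zero-sum : {A : Set} (xs : List A) {f : A → ℤ} → (∀ x → f x ≡ 0ℤ) → ∑ xs f ≡ 0ℤ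
    zero-sum []       f≡0 = ≡.refl
    zero-sum (x ∷ xs) f≡0 = ≡.cong₂ ℤ._+_ (f≡0 x) (zero-sum xs f≡0)

^-distribʳ-* : ∀ e a b → (a ℕ.* b) ℕ.^ e ≡ a ℕ.^ e ℕ.* b ℕ.^ e
^-distribʳ-* zero    a b = ≡.refl
^-distribʳ-* (suc e) a b = ≡.trans (≡.cong (a ℕ.* b ℕ.*_) (^-distribʳ-* e a b)) (lemma a b (a ℕ.^ e) (b ℕ.^ e))
  where
  lemma : ∀ a b c d → a ℕ.* b ℕ.* (c ℕ.* d) ≡ a ℕ.* c ℕ.* (b ℕ.* d)
  lemma = solve-∀

newellLittlewoodConstant : ℕ → ℕ → ℕ
newellLittlewoodConstant n D = n ! ℕ.* n ! ℕ.* n ! ℕ.* suc (D ℕ.+ D) ℕ.^ (3 ℕ.* patternDimension (suc n))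

newellLittlewood-growth : ∀ c → IsLittlewoodRichardson c → ∀ n μ ν κ → ℓ μ ℕ.≤ n → ℓ ν ℕ.≤ n → ℓ κ ℕ.≤ n →
  ∀ t .{{_ : NonZero t}} → ℤ.∣ newellLittlewood c (t · μ) (t · ν) (t · κ) ∣
    ℕ.≤ newellLittlewoodConstant n (∣ μ ∣ ℕ.+ ∣ ν ∣ ℕ.+ ∣ κ ∣) ℕ.* t ℕ.^ (3 ℕ.* patternDimension (suc n))
newellLittlewood-growth c isLR n μ ν κ ℓμ ℓν ℓκ t = begin
  ℤ.∣ newellLittlewood c (t · μ) (t · ν) (t · κ) ∣
    ≤⟨ NewellLittlewoodBound.newellLittlewood-bound c isLR n (t · μ) (t · ν) (t · κ)
         (length≤ μ ℓμ) (length≤ ν ℓν) (length≤ κ ℓκ) (t ℕ.* D) (ℕ.≤-reflexive size≡) ⟩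
  S ℕ.^ q ℕ.* (S ℕ.^ q ℕ.* (S ℕ.^ q ℕ.* (n ! ℕ.* S ℕ.^ p ℕ.* (n ! ℕ.* S ℕ.^ p) ℕ.* (n ! ℕ.* S ℕ.^ p))))
    ≡⟨ collect (S ℕ.^ q) (S ℕ.^ p) (n !) ⟩
  f ℕ.* ((S ℕ.^ q ℕ.* S ℕ.^ p) ℕ.* ((S ℕ.^ q ℕ.* S ℕ.^ p) ℕ.* ((S ℕ.^ q ℕ.* S ℕ.^ p) ℕ.* 1)))
    -- By definition `q + p` is `patternDimension (suc n)`: the n ∸ 1 free parts of one of the
    -- partitions α, β, γ count like a further row of a pattern.
    ≡⟨ ≡.cong (λ x → f ℕ.* (x ℕ.^ 3)) (ℕ.^-distribˡ-+-* S q p) ⟨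
  f ℕ.* (S ℕ.^ (q ℕ.+ p)) ℕ.^ 3
    ≡⟨ ≡.cong (f ℕ.*_) (≡.trans (ℕ.^-*-assoc S (q ℕ.+ p) 3) (≡.cong (S ℕ.^_) (ℕ.*-comm (q ℕ.+ p) 3))) ⟩
  f ℕ.* S ℕ.^ E
    ≤⟨ ℕ.*-monoʳ-≤ f (ℕ.^-monoˡ-≤ E S≤) ⟩
  f ℕ.* (suc (D ℕ.+ D) ℕ.* t) ℕ.^ E
    ≡⟨ ≡.cong (f ℕ.*_) (^-distribʳ-* E (suc (D ℕ.+ D)) t) ⟩
  f ℕ.* (suc (D ℕ.+ D) ℕ.^ E ℕ.* t ℕ.^ E)
    ≡⟨ ℕ.*-assoc f _ _ ⟨
  f ℕ.* suc (D ℕ.+ D) ℕ.^ E ℕ.* t ℕ.^ E ∎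
  where
  open ℕ.≤-Reasoning
  p q E D f S : ℕ
  p = patternDimension n
  q = n ℕ.∸ 1
  E = 3 ℕ.* patternDimension (suc n)
  D = ∣ μ ∣ ℕ.+ ∣ ν ∣ ℕ.+ ∣ κ ∣
  f = n ! ℕ.* n ! ℕ.* n !
  S = suc (t ℕ.* D ℕ.+ t ℕ.* D)
  length≤ : ∀ π → ℓ π ℕ.≤ n → ℓ (t · π) ℕ.≤ n
  length≤ π = ≡.subst (ℕ._≤ n) (≡.sym (List.length-map (t ℕ.*_) (parts π)))
  scale : ∀ xs → List.foldr ℕ._+_ 0 (map (t ℕ.*_) xs) ≡ t ℕ.* List.foldr ℕ._+_ 0 xs
  scale []       = ≡.sym (ℕ.*-zeroʳ t)
  scale (x ∷ xs) = ≡.trans (≡.cong (t ℕ.* x ℕ.+_) (scale xs)) (≡.sym (ℕ.*-distribˡ-+ t x _))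
  size≡ : ∣ t · μ ∣ ℕ.+ ∣ t · ν ∣ ℕ.+ ∣ t · κ ∣ ≡ t ℕ.* D
  size≡ rewrite scale (parts μ) | scale (parts ν) | scale (parts κ) =
    ≡.sym (≡.trans (ℕ.*-distribˡ-+ t (∣ μ ∣ ℕ.+ ∣ ν ∣) ∣ κ ∣) (≡.cong (ℕ._+ t ℕ.* ∣ κ ∣) (ℕ.*-distribˡ-+ t ∣ μ ∣ ∣ ν ∣)))
  -- Since t ≥ 1, the summand 1 in `S` is at most t, which makes the bound a constant times a pure
  -- power of t.
  S≤ : S ℕ.≤ suc (D ℕ.+ D) ℕ.* t
  S≤ = ℕ.+-mono-≤ (ℕ.>-nonZero⁻¹ t) (ℕ.≤-reflexive (≡.trans (≡.sym (ℕ.*-distribˡ-+ t D D)) (ℕ.*-comm t (D ℕ.+ D))))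
  collect : ∀ x y z → x ℕ.* (x ℕ.* (x ℕ.* (z ℕ.* y ℕ.* (z ℕ.* y) ℕ.* (z ℕ.* y))))
    ≡ z ℕ.* z ℕ.* z ℕ.* ((x ℕ.* y) ℕ.* ((x ℕ.* y) ℕ.* ((x ℕ.* y) ℕ.* 1)))
  collect = solve-∀

patternDimension-double : ∀ n → patternDimension (suc n) ℕ.* 2 ≡ n ℕ.* (n ℕ.∸ 1)
patternDimension-double zero          = ≡.refl
patternDimension-double (suc zero)    = ≡.refl
patternDimension-double (suc (suc n)) = ≡.trans (ℕ.*-distribʳ-+ 2 (suc n) (patternDimension (suc (suc n))))
  (≡.trans (≡.cong (suc n ℕ.* 2 ℕ.+_) (patternDimension-double (suc n))) (lemma n))
  where
  lemma : ∀ n → suc n ℕ.* 2 ℕ.+ suc n ℕ.* n ≡ suc (suc n) ℕ.* suc n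
  lemma = solve-∀

patternDimension-half : ∀ n → 3 ℕ.* patternDimension (suc n) ≡ 3 ℕ.* n ℕ.* (n ℕ.∸ 1) / 2
patternDimension-half n = ≡.sym (≡.trans
  (≡.cong (_/ 2) (≡.trans (ℕ.*-assoc 3 n (n ℕ.∸ 1)) (≡.trans (≡.cong (3 ℕ.*_) (≡.sym (patternDimension-double n)))
    (≡.sym (ℕ.*-assoc 3 (patternDimension (suc n)) 2)))))
  (m*n/n≡m (3 ℕ.* patternDimension (suc n)) 2))

-- Growth of polynomials

fromℤ : ℤ → ℚ
fromℤ i = i ℚ./ 1

toℚ : ℕ → ℚ
toℚ n = fromℤ (+ n)

-- `i ℚ./ 1` is normalised by a gcd that does not compute for variable `i`; the unnormalised
-- fraction has explicit numerator and denominator.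
toℚᵘ-fromℤ : ∀ i → ℚ.toℚᵘ (fromℤ i) ℚᵘ.≃ mkℚᵘ i 0
toℚᵘ-fromℤ i = ℚ.toℚᵘ-fromℚᵘ (mkℚᵘ i 0)

fromℤ-* : ∀ i j → fromℤ (i ℤ.* j) ≡ fromℤ i ℚ.* fromℤ j
fromℤ-* i j = ℚ.toℚᵘ-injective (begin
  ℚ.toℚᵘ (fromℤ (i ℤ.* j))                        ≈⟨ toℚᵘ-fromℤ (i ℤ.* j) ⟩
  mkℚᵘ (i ℤ.* j) 0                                ≡⟨⟩
  mkℚᵘ i 0 ℚᵘ.* mkℚᵘ j 0                          ≈⟨ ℚᵘ.*-cong (toℚᵘ-fromℤ i) (toℚᵘ-fromℤ j) ⟨
  ℚ.toℚᵘ (fromℤ i) ℚᵘ.* ℚ.toℚᵘ (fromℤ j)          ≈⟨ ℚ.toℚᵘ-homo-* (fromℤ i) (fromℤ j) ⟨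
  ℚ.toℚᵘ (fromℤ i ℚ.* fromℤ j)                    ∎)
  where open ℚᵘ.≃-Reasoning

∣fromℤ∣ : ∀ i → ℚ.∣ fromℤ i ∣ ≡ toℚ ℤ.∣ i ∣
∣fromℤ∣ i = ℚ.toℚᵘ-injective (begin
  ℚ.toℚᵘ ℚ.∣ fromℤ i ∣         ≈⟨ ℚ.toℚᵘ-homo-∣-∣ (fromℤ i) ⟩
  ℚᵘ.∣ ℚ.toℚᵘ (fromℤ i) ∣      ≈⟨ ℚᵘ.∣-∣-cong (toℚᵘ-fromℤ i) ⟩
  mkℚᵘ (+ ℤ.∣ i ∣) 0           ≈⟨ toℚᵘ-fromℤ (+ ℤ.∣ i ∣) ⟨
  ℚ.toℚᵘ (toℚ ℤ.∣ i ∣)       ∎)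
  where open ℚᵘ.≃-Reasoning

toℚ-mono : ∀ {m n} → m ℕ.≤ n → toℚ m ℚ.≤ toℚ n
toℚ-mono {m} {n} m≤n = ℚ.toℚᵘ-cancel-≤ (begin
  ℚ.toℚᵘ (toℚ m)   ≃⟨ toℚᵘ-fromℤ (+ m) ⟩
  mkℚᵘ (+ m) 0       ≤⟨ *≤* (ℤ.*-monoʳ-≤-nonNeg (+ 1) (ℤ.+≤+ m≤n)) ⟩
  mkℚᵘ (+ n) 0       ≃⟨ toℚᵘ-fromℤ (+ n) ⟨
  ℚ.toℚᵘ (toℚ n)   ∎)
  where open ℚᵘ.≤-Reasoning

toℚ-cancel : ∀ {m n} → toℚ m ℚ.≤ toℚ n → m ℕ.≤ n
toℚ-cancel {m} {n} m≤n with ≤′ ← ℚᵘ.≤-respʳ-≃ (toℚᵘ-fromℤ (+ n)) (ℚᵘ.≤-respˡ-≃ (toℚᵘ-fromℤ (+ m)) (ℚ.toℚᵘ-mono-≤ m≤n)) =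
  ℤ.drop‿+≤+ (ℤ.*-cancelʳ-≤-pos (+ m) (+ n) (+ 1) (ℚᵘ.drop-*≤* ≤′))

denominator-* : ∀ b → fromℤ (ℚ.↧ b) ℚ.* b ≡ fromℤ (ℚ.↥ b)
denominator-* b@(mkℚ n d-1 _) = ℚ.toℚᵘ-injective (begin
  ℚ.toℚᵘ (fromℤ (ℚ.↧ b) ℚ.* b)                ≈⟨ ℚ.toℚᵘ-homo-* (fromℤ (ℚ.↧ b)) b ⟩
  ℚ.toℚᵘ (fromℤ (ℚ.↧ b)) ℚᵘ.* mkℚᵘ n d-1      ≈⟨ ℚᵘ.*-cong (toℚᵘ-fromℤ (ℚ.↧ b)) ℚᵘ.≃-refl ⟩
  mkℚᵘ (ℚ.↧ b) 0 ℚᵘ.* mkℚᵘ n d-1              ≈⟨ *≡* (lemma (ℚ.↧ b) n) ⟩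
  mkℚᵘ n 0                                    ≈⟨ toℚᵘ-fromℤ n ⟨
  ℚ.toℚᵘ (fromℤ n)                            ∎)
  where
  open ℚᵘ.≃-Reasoning
  lemma : ∀ d n → d ℤ.* n ℤ.* + 1 ≡ n ℤ.* (+ 1 ℤ.* d)
  lemma = ℤ-Solver.solve-∀

-- The Archimedean property with an explicit witness.
≤∣numerator∣ : ∀ C → C ℚ.≤ toℚ ℤ.∣ ℚ.↥ C ∣
≤∣numerator∣ C@(mkℚ n d-1 _) = ℚ.toℚᵘ-cancel-≤ (begin
  mkℚᵘ n d-1                        ≤⟨ *≤* (bound n) ⟩
  mkℚᵘ (+ ℤ.∣ n ∣) 0                ≃⟨ toℚᵘ-fromℤ (+ ℤ.∣ n ∣) ⟨
  ℚ.toℚᵘ (toℚ ℤ.∣ n ∣)            ∎)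
  where
  open ℚᵘ.≤-Reasoning
  bound : ∀ n → n ℤ.* + 1 ℤ.≤ + ℤ.∣ n ∣ ℤ.* + suc d-1
  bound (+ m)         = ≡.subst (ℤ._≤ + m ℤ.* + suc d-1) (≡.sym (ℤ.*-identityʳ (+ m)))
    (≡.subst (+ m ℤ.≤_) (ℤ.pos-* m (suc d-1)) (ℤ.+≤+ (ℕ.m≤m*n m (suc d-1))))
  bound ℤ.-[1+ m ] = ℤ.-≤+

Unbounded : (ℕ → Set) → Set
Unbounded P = ∀ m → ∃ λ t → m ℕ.< t × P t

module _ {P : ℕ → Set} (unbounded : Unbounded P) where

  -- If b = p/d with p ≠ 0, then t ≤ |t p| = d |t b| ≤ d N with N the absolute value of the
  -- numerator of C. Some admissible t exceeds this.
  linear-growth : ∀ {b C} → (∀ t → 0 ℕ.< t → P t → ℚ.∣ toℚ t ℚ.* b ∣ ℚ.≤ C) → b ≡ 0ℚ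
  linear-growth {b} {C} bounded with ℤ.∣ ℚ.↥ b ∣ in eq
  ... | zero  = ℚ.↥p≡0⇒p≡0 b (ℤ.∣i∣≡0⇒i≡0 eq)
  ... | suc m with t , large , pt ← unbounded (ℚ.↧ₙ b ℕ.* suc ℤ.∣ ℚ.↥ C ∣) =
    contradiction (toℚ-cancel t≤) (ℕ.<⇒≱ (ℕ.≤-<-trans d*≤ large))
    where
    d : ℕ
    d = ℚ.↧ₙ b
    N : ℕ
    N = ℤ.∣ ℚ.↥ C ∣
    instance
      d≥0 : ℚ.NonNegative (toℚ d)
      d≥0 = ℚ.nonNegative (toℚ-mono {0} {d} z≤n)
    d*≤ : d ℕ.* N ℕ.≤ d ℕ.* suc N
    d*≤ = ℕ.*-monoʳ-≤ d (ℕ.n≤1+n N)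
    t≤ : toℚ t ℚ.≤ toℚ (d ℕ.* N)
    t≤ = begin
      toℚ t
        ≤⟨ toℚ-mono (ℕ.m≤m*n t (suc m)) ⟩
      toℚ (t ℕ.* suc m)
        ≡⟨ ≡.cong (λ k → toℚ (t ℕ.* k)) eq ⟨
      toℚ (t ℕ.* ℤ.∣ ℚ.↥ b ∣)
        ≡⟨ ≡.cong toℚ (ℤ.abs-* (+ t) (ℚ.↥ b)) ⟨
      toℚ ℤ.∣ + t ℤ.* ℚ.↥ b ∣
        ≡⟨ ∣fromℤ∣ (+ t ℤ.* ℚ.↥ b) ⟨
      ℚ.∣ fromℤ (+ t ℤ.* ℚ.↥ b) ∣
        ≡⟨ ≡.cong ℚ.∣_∣ (≡.trans (fromℤ-* (+ t) (ℚ.↥ b)) (≡.cong (toℚ t ℚ.*_) (≡.sym (denominator-* b)))) ⟩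
      ℚ.∣ toℚ t ℚ.* (toℚ d ℚ.* b) ∣
        ≡⟨ ≡.cong ℚ.∣_∣ (exchange (toℚ t) (toℚ d) b) ⟩
      ℚ.∣ toℚ d ℚ.* (toℚ t ℚ.* b) ∣
        ≡⟨ ≡.trans (ℚ.∣p*q∣≡∣p∣*∣q∣ (toℚ d) (toℚ t ℚ.* b)) (≡.cong (ℚ._* ℚ.∣ toℚ t ℚ.* b ∣) (∣fromℤ∣ (+ d))) ⟩
      toℚ d ℚ.* ℚ.∣ toℚ t ℚ.* b ∣
        ≤⟨ ℚ.*-monoˡ-≤-nonNeg (toℚ d) (ℚ.≤-trans (bounded t (ℕ.≤-<-trans z≤n large) pt) (≤∣numerator∣ C)) ⟩
      toℚ d ℚ.* toℚ N
        ≡⟨ ≡.trans (≡.cong fromℤ (ℤ.pos-* d N)) (fromℤ-* (+ d) (+ N)) ⟨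
      toℚ (d ℕ.* N) ∎
      where
      open ℚ.≤-Reasoning
      exchange : ∀ x y z → x ℚ.* (y ℚ.* z) ≡ y ℚ.* (x ℚ.* z)
      exchange x y z = ≡.trans (≡.sym (ℚ.*-assoc x y z)) (≡.trans (≡.cong (ℚ._* z) (ℚ.*-comm x y)) (ℚ.*-assoc y x z))

  toℚ-positive : ∀ {t} → 0 ℕ.< t → ℚ.Positive (toℚ t)
  toℚ-positive {suc t} _ = ℚ.normalize-pos (suc t) 1

  summand-bound : ∀ a b {C} → ℚ.∣ a ℚ.+ b ∣ ℚ.≤ C → ℚ.∣ b ∣ ℚ.≤ C ℚ.+ ℚ.∣ a ∣
  summand-bound a b {C} bound = begin
    ℚ.∣ b ∣                       ≡⟨ ≡.cong ℚ.∣_∣ cancel ⟨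
    ℚ.∣ a ℚ.+ b ℚ.- a ∣           ≤⟨ ℚ.∣p-q∣≤∣p∣+∣q∣ (a ℚ.+ b) a ⟩
    ℚ.∣ a ℚ.+ b ∣ ℚ.+ ℚ.∣ a ∣     ≤⟨ ℚ.+-monoˡ-≤ ℚ.∣ a ∣ bound ⟩
    C ℚ.+ ℚ.∣ a ∣                 ∎
    where
    open ℚ.≤-Reasoning
    cancel : a ℚ.+ b ℚ.- a ≡ b
    cancel = ≡.trans (≡.cong (ℚ._- a) (ℚ.+-comm a b)) (≡.trans (ℚ.+-assoc b a (ℚ.- a))
      (≡.trans (≡.cong (b ℚ.+_) (ℚ.+-inverseʳ a)) (ℚ.+-identityʳ b)))

  eval-zero : ∀ p x → (∀ k → coefficient p k ≡ 0ℚ) → eval p x ≡ 0ℚ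
  eval-zero []      x _   = ≡.refl
  eval-zero (a ∷ p) x p≡0 = ≡.trans (≡.cong₂ (λ a y → a ℚ.+ x ℚ.* y) (p≡0 0) (eval-zero p x λ k → p≡0 (suc k)))
    (≡.trans (ℚ.+-identityˡ _) (ℚ.*-zeroʳ x))

  -- The extra factor t drives the induction. For p = b + x q, boundedness of t p(t) with t ≥ 1
  -- bounds p(t) and hence t q(t), so q is zero; then t b is bounded and b is zero.
  bounded⇒zero : ∀ p {C} → (∀ t → 0 ℕ.< t → P t → ℚ.∣ toℚ t ℚ.* eval p (toℚ t) ∣ ℚ.≤ C) → ∀ k → coefficient p k ≡ 0ℚ
  bounded⇒zero []      bounded k = ≡.refl
  bounded⇒zero (b ∷ q) {C} bounded = λ { zero → b≡0 ; (suc k) → q≡0 k }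
    where
    q≡0 : ∀ k → coefficient q k ≡ 0ℚ
    q≡0 = bounded⇒zero q {C ℚ.+ ℚ.∣ b ∣} λ t t>0 pt → summand-bound b (toℚ t ℚ.* eval q (toℚ t))
      (begin
        ℚ.∣ y t ∣                          ≡⟨ ℚ.*-identityˡ ℚ.∣ y t ∣ ⟨
        1ℚ ℚ.* ℚ.∣ y t ∣                   ≤⟨ ℚ.*-monoʳ-≤-nonNeg ℚ.∣ y t ∣ {{ℚ.∣-∣-nonNeg (y t)}} (toℚ-mono t>0) ⟩
        toℚ t ℚ.* ℚ.∣ y t ∣              ≡⟨ ≡.trans (ℚ.∣p*q∣≡∣p∣*∣q∣ (toℚ t) (y t)) (≡.cong (ℚ._* ℚ.∣ y t ∣) (∣fromℤ∣ (+ t))) ⟨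
        ℚ.∣ toℚ t ℚ.* y t ∣              ≤⟨ bounded t t>0 pt ⟩
        C                                  ∎)
      where
      open ℚ.≤-Reasoning
      y : ℕ → ℚ
      y t = b ℚ.+ toℚ t ℚ.* eval q (toℚ t)
    b≡0 : b ≡ 0ℚ
    b≡0 = linear-growth λ t t>0 pt → ≡.subst (λ y → ℚ.∣ toℚ t ℚ.* y ∣ ℚ.≤ C)
      (≡.trans (≡.cong (λ y → b ℚ.+ toℚ t ℚ.* y) (eval-zero q (toℚ t) q≡0))
        (≡.trans (≡.cong (b ℚ.+_) (ℚ.*-zeroʳ (toℚ t))) (ℚ.+-identityʳ b)))
      (bounded t t>0 pt)

  -- Splitting off the constant term and dividing by t lowers both the exponent and the degree by
  -- one. At exponent 0 what remains is t times a polynomial, bounded, which `bounded⇒zero` settles.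
  growth⇒degree : ∀ E p {C} → (∀ t → 0 ℕ.< t → P t → ℚ.∣ eval p (toℚ t) ∣ ℚ.≤ C ℚ.* toℚ (t ℕ.^ E)) → DegreeAtMost p E
  growth⇒degree E       []      bounded k       _   = ≡.refl
  growth⇒degree zero    (a ∷ p) {C} bounded (suc k) _ = bounded⇒zero p {C ℚ.+ ℚ.∣ a ∣}
    (λ t t>0 pt → summand-bound a (toℚ t ℚ.* eval p (toℚ t)) (≡.subst (ℚ.∣ eval (a ∷ p) (toℚ t) ∣ ℚ.≤_) (ℚ.*-identityʳ C) (bounded t t>0 pt))) k
  growth⇒degree (suc E) (a ∷ p) {C} bounded (suc k) (s≤s E<k) = growth⇒degree E p {C ℚ.+ ℚ.∣ a ∣} bounded′ k E<k
    where
    bounded′ : ∀ t → 0 ℕ.< t → P t → ℚ.∣ eval p (toℚ t) ∣ ℚ.≤ (C ℚ.+ ℚ.∣ a ∣) ℚ.* toℚ (t ℕ.^ E)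
    bounded′ t t>0 pt = ℚ.*-cancelˡ-≤-pos (toℚ t) {{toℚ-positive t>0}} (begin
      toℚ t ℚ.* ℚ.∣ eval p (toℚ t) ∣
        ≡⟨ ≡.trans (ℚ.∣p*q∣≡∣p∣*∣q∣ (toℚ t) _) (≡.cong (ℚ._* ℚ.∣ eval p (toℚ t) ∣) (∣fromℤ∣ (+ t))) ⟨
      ℚ.∣ toℚ t ℚ.* eval p (toℚ t) ∣
        ≤⟨ summand-bound a _ (bounded t t>0 pt) ⟩
      C ℚ.* T ℚ.+ ℚ.∣ a ∣
        ≡⟨ ≡.cong (C ℚ.* T ℚ.+_) (ℚ.*-identityʳ ℚ.∣ a ∣) ⟨
      C ℚ.* T ℚ.+ ℚ.∣ a ∣ ℚ.* 1ℚ
        ≤⟨ ℚ.+-monoʳ-≤ (C ℚ.* T) (ℚ.*-monoˡ-≤-nonNeg ℚ.∣ a ∣ {{ℚ.∣-∣-nonNeg a}} (toℚ-mono (ℕ.m^n>0 t {{ℕ.>-nonZero t>0}} (suc E)))) ⟩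
      C ℚ.* T ℚ.+ ℚ.∣ a ∣ ℚ.* T
        ≡⟨ ℚ.*-distribʳ-+ T C ℚ.∣ a ∣ ⟨
      (C ℚ.+ ℚ.∣ a ∣) ℚ.* T
        ≡⟨ ≡.cong ((C ℚ.+ ℚ.∣ a ∣) ℚ.*_) (≡.trans (≡.cong fromℤ (ℤ.pos-* t (t ℕ.^ E))) (fromℤ-* (+ t) (+ (t ℕ.^ E)))) ⟩
      (C ℚ.+ ℚ.∣ a ∣) ℚ.* (toℚ t ℚ.* toℚ (t ℕ.^ E))
        ≡⟨ exchange (C ℚ.+ ℚ.∣ a ∣) (toℚ t) (toℚ (t ℕ.^ E)) ⟩
      toℚ t ℚ.* ((C ℚ.+ ℚ.∣ a ∣) ℚ.* toℚ (t ℕ.^ E)) ∎)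
      where
      open ℚ.≤-Reasoning
      T : ℚ
      T = toℚ (t ℕ.^ suc E)
      exchange : ∀ x y z → x ℚ.* (y ℚ.* z) ≡ y ℚ.* (x ℚ.* z)
      exchange x y z = ≡.trans (≡.sym (ℚ.*-assoc x y z)) (≡.trans (≡.cong (ℚ._* z) (ℚ.*-comm x y)) (ℚ.*-assoc y x z))

even-unbounded : Unbounded (2 ∣_)
even-unbounded m = suc m ℕ.* 2 , ℕ.m≤m*n (suc m) 2 , divides (suc m) ≡.refl

odd-unbounded : Unbounded (2 ∤_)
odd-unbounded m = suc m ℕ.* 2 ℕ.+ 1 , ℕ.≤-trans (ℕ.m≤m*n (suc m) 2) (ℕ.m≤m+n _ 1) ,
  λ 2∣t → contradiction (∣1⇒≡1 (∣m+n∣m⇒∣n 2∣t (divides (suc m) ≡.refl))) λ ()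

-- The degree bound for both parities

open import Data.Nat.Base using (ℕ; _*_; _∸_; _⊔_; NonZero)

mainTheorem7 : (c : Partition → Partition → Partition → ℤ) → IsLittlewoodRichardson c →
    (μ ν κ : Partition) (Pₑ Pₒ : Polynomial) →
    (∀ (t : ℕ) .{{_ : NonZero t}} →
    (2 ∣ t → newellLittlewood c (t · μ) (t · ν) (t · κ) ℚ./ 1 ≡ eval Pₑ (+ t ℚ./ 1)) ×
    (2 ∤ t → newellLittlewood c (t · μ) (t · ν) (t · κ) ℚ./ 1 ≡ eval Pₒ (+ t ℚ./ 1))) →
    let n = ℓ μ ⊔ ℓ ν ⊔ ℓ κ in
    DegreeAtMost Pₑ (3 * n * (n ∸ 1) / 2) × DegreeAtMost Pₒ (3 * n * (n ∸ 1) / 2)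
mainTheorem7 c isLR μ ν κ Pₑ Pₒ quasiPolynomial =
  degree Pₑ even-unbounded (λ t 2∣t → proj₁ (quasiPolynomial t) 2∣t) ,
  degree Pₒ odd-unbounded (λ t 2∤t → proj₂ (quasiPolynomial t) 2∤t)
  where
  n E D : ℕ
  n = ℓ μ ⊔ ℓ ν ⊔ ℓ κ
  E = 3 * patternDimension (suc n)
  D = ∣ μ ∣ ℕ.+ ∣ ν ∣ ℕ.+ ∣ κ ∣
  degree : ∀ p {Q : ℕ → Set} → Unbounded Q →
    (∀ t .{{_ : NonZero t}} → Q t → newellLittlewood c (t · μ) (t · ν) (t · κ) ℚ./ 1 ≡ eval p (+ t ℚ./ 1)) →
    DegreeAtMost p (3 * n * (n ∸ 1) / 2)
  degree p {Q} unbounded values = ≡.subst (DegreeAtMost p) (patternDimension-half n)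
    (growth⇒degree unbounded E p {toℚ (newellLittlewoodConstant n D)} bound)
    where
    bound : ∀ t → 0 ℕ.< t → Q t → ℚ.∣ eval p (toℚ t) ∣ ℚ.≤ toℚ (newellLittlewoodConstant n D) ℚ.* toℚ (t ℕ.^ E)
    bound t t>0 qt = begin
      ℚ.∣ eval p (toℚ t) ∣
        ≡⟨ ≡.cong ℚ.∣_∣ (values t qt) ⟨
      ℚ.∣ fromℤ (newellLittlewood c (t · μ) (t · ν) (t · κ)) ∣
        ≡⟨ ∣fromℤ∣ (newellLittlewood c (t · μ) (t · ν) (t · κ)) ⟩
      toℚ ℤ.∣ newellLittlewood c (t · μ) (t · ν) (t · κ) ∣
        ≤⟨ toℚ-mono (newellLittlewood-growth c isLR n μ ν κ
             (ℕ.≤-trans (ℕ.m≤m⊔n (ℓ μ) (ℓ ν)) (ℕ.m≤m⊔n _ (ℓ κ))) (ℕ.≤-trans (ℕ.m≤n⊔m (ℓ μ) (ℓ ν)) (ℕ.m≤m⊔n _ (ℓ κ))) (ℕ.m≤n⊔m _ (ℓ κ)) t) ⟩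
      toℚ (newellLittlewoodConstant n D * t ℕ.^ E)
        ≡⟨ ≡.trans (≡.cong fromℤ (ℤ.pos-* (newellLittlewoodConstant n D) (t ℕ.^ E))) (fromℤ-* (+ newellLittlewoodConstant n D) (+ (t ℕ.^ E))) ⟩
      toℚ (newellLittlewoodConstant n D) ℚ.* toℚ (t ℕ.^ E) ∎
      where
      open ℚ.≤-Reasoning
      instance
        t≢0 : NonZero t
        t≢0 = ℕ.>-nonZero t>0
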